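{- Let $G$ be a connected ribbon graph and $A\subseteq E(G)$. Then (1) $G$ and $G^A$ are both plane if and only if $A$ defines a plane-join-biseparation of $G$; (2) $G$ and $G^A$ are both $\mathbb{R}\mathrm{P}^2$ if and only if $A$ defines an $\mathbb{R}\mathrm{P}^2$-join-biseparation of $G$.
   Context: A ribbon graph is a surface with boundary made of vertex discs and edge discs meeting in disjoint segments, each segment on the boundary of exactly one vertex and one edge, each edge containing exactly two segments; considered up to homeomorphism. Euler genus $\gamma$: twice the genus if orientable, non-orientable genus otherwise, summed over components. "Plane" (resp. "$\mathbb{R}\mathrm{P}^2$") ribbon graph: connected with $\gamma=0$ (resp. $\gamma=1$). Partial dual $G^A$ ($A\subseteq E(G)$): orient each edge boundary arbitrarily; the boundary components of the spanning ribbon subgraph $(V(G),A)$ meet the edges of $G$ in disjoint arcs; mark each such arc with an arrow in the direction of the edge's boundary orientation, labelled by the edge; $G^A$ is obtained by capping each marked boundary component with a vertex disc and, for each label $e$, attaching an edge disc along the two $e$-labelled arrows respecting directions. Edges of $G^A$ are identified with those of $G$. Join: for connected $G$ with non-trivial connected ribbon subgraphs $P,Q$, $G=P\cup Q$, $P\cap Q=\{v\}$, and an arc on the boundary of $v$ met by all edges of $P$ incident to $v$ and by no edges of $Q$, write $G=P\vee Q$. $H_1\vee\cdots\vee H_l$ means $(\cdots(H_1\vee H_2)\vee\cdots)\vee H_l$ (joins may occur at any vertices, not necessarily distinct). $A$ defines a join-biseparation of $G$ if $G=H_1\vee\cdots\vee H_l$ for some $l\ge1$ with $A=\bigcup_{i\in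 I}E(H_i)$ for some $I\subseteq\{1,\dots,l\}$; it is a plane-join-biseparation if moreover each $H_i$ is plane, and an $\mathbb{R}\mathrm{P}^2$-join-biseparation if exactly one $H_i$ is $\mathbb{R}\mathrm{P}^2$ and all others are plane. -}

module Defs where

open import Data.Nat using (ℕ; zero; suc; _+_; _*_; _∸_; _≤_; _≤ᵇ_; _<ᵇ_; _≡ᵇ_)
open import Data.Bool using (Bool; true; false; not; _∧_; _∨_; if_then_else_; T)
open import Data.Bool.Properties using (not-involutive)
open import Data.Fin using (Fin; toℕ)
open import Data.Fin.Properties using (_≟_)
open import Data.Product using (_×_; _,_; Σ; ∃)
open import Data.Sum using (_⊎_)
open import Data.List using (List; []; _∷_; concatMap; allFin; filterᵇ)
open import Data.Bool.ListAction using (any; all)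
open import Relation.Nullary using (¬_; does)
open import Relation.Binary.PropositionalEquality using (_≡_; _≢_; refl; cong; trans; sym)

-- Combinatorial encoding of ribbon graphs (graph-encoded maps / gems).
--
-- A flag of a ribbon graph with m edges is a triple (e , a , b): the
-- edge e, one of its two ends a (= the edge segment on a vertex), and one
-- of the two sides b of the edge.  The three flag involutions are
--   σ0 : change the end   (keeps edge and boundary component)
--   σ2 : change the side  (keeps edge and vertex)
--   σ1 : change the edge  (keeps vertex and boundary component) -- this
--        pairs flags across the corners of the vertex discs and is the
--        data of the ribbon graph.
-- Every fixed-point-free involution σ1 gives a ribbon graph and every
-- ribbon graph arises this way; vertices are ⟨σ1,σ2⟩-orbits, edges are
-- ⟨σ0,σ2⟩-orbits, boundary components are ⟨σ0,σ1⟩-orbits, connected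
-- components are ⟨σ0,σ1,σ2⟩-orbits.  Vertices with no incident edge
-- carry no flags, so their number is recorded separately (nIso).

Flag : ℕ → Set
Flag m = Fin m × Bool × Bool

module _ {m : ℕ} where

  edge : Flag m → Fin m
  edge (e , _ , _) = e

  σ0 : Flag m → Flag m
  σ0 (e , a , b) = (e , not a , b)

  σ2 : Flag m → Flag m
  σ2 (e , a , b) = (e , a , not b)

  code : Flag m → ℕ
  code (e , a , b) = 4 * toℕ e + (if a then 2 else 0) + (if b then 1 else 0)

  flagEq : Flag m → Flag m → Bool
  flagEq f g = code f ≡ᵇ code g

record RibbonGraph : Set where
  field
    nE        : ℕ
    nIso      : ℕ
    σ1        : Flag nE → Flag nE
    σ1-invol  : ∀ f → σ1 (σ1 f) ≡ f
    σ1-fpf    : ∀ f → σ1 f ≢ f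
open RibbonGraph public

EdgeSet : RibbonGraph → Set
EdgeSet G = Fin (nE G) → Bool

allFlags : (m : ℕ) → List (Flag m)
allFlags m = concatMap (λ e → (e , false , false) ∷ (e , false , true)
                             ∷ (e , true , false) ∷ (e , true , true) ∷ []) (allFin m)

countB : {A : Set} → (A → Bool) → List A → ℕ
countB p [] = 0
countB p (x ∷ xs) = if p x then suc (countB p xs) else countB p xs

-- Partial duality: on the flags of the edges in A, exchange the roles of
-- σ0 and σ2 (i.e. swap "end" and "side").  Edges are kept.

module _ {m : ℕ} (A : Fin m → Bool) where
  φ : Flag m → Flag m
  φ (e , a , b) = if A e then (e , b , a) else (e , a , b)

  φ-invol : ∀ f → φ (φ f) ≡ f
  φ-invol (e , a , b) with A e in eq
  ... | true  rewrite eq = refl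
  ... | false rewrite eq = refl

private
  pd-invol : ∀ {m} (A : Fin m → Bool) (s : Flag m → Flag m) → (∀ f → s (s f) ≡ f)
           → ∀ f → φ A (s (φ A (φ A (s (φ A f))))) ≡ f
  pd-invol A s inv f =
    trans (cong (λ x → φ A (s x)) (φ-invol A (s (φ A f))))
          (trans (cong (φ A) (inv (φ A f))) (φ-invol A f))

  pd-fpf : ∀ {m} (A : Fin m → Bool) (s : Flag m → Flag m) → (∀ f → s f ≢ f)
         → ∀ f → φ A (s (φ A f)) ≢ f
  pd-fpf A s fpf f eq = fpf (φ A f) (trans (sym (φ-invol A (s (φ A f)))) (cong (φ A) eq))

_^_ : (G : RibbonGraph) → EdgeSet G → RibbonGraph
G ^ A = record
  { nE = nE G ; nIso = nIso G
  ; σ1 = λ f → φ A (σ1 G (φ A f))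
  ; σ1-invol = pd-invol A (σ1 G) (σ1-invol G)
  ; σ1-fpf = pd-fpf A (σ1 G) (σ1-fpf G) }

module _ {m : ℕ} where

  elemB : Flag m → List (Flag m) → Bool
  elemB x = any (flagEq x)

  step : List (Flag m → Flag m) → List (Flag m) → List (Flag m)
  step gens R = filterᵇ (λ x → elemB x R ∨ any (λ y → any (λ h → flagEq (h y) x) gens) R)
                        (allFlags m)

  explore : List (Flag m → Flag m) → ℕ → List (Flag m) → List (Flag m)
  explore gens zero R = R
  explore gens (suc k) R = explore gens k (step gens R)

  -- same orbit of the group generated by gens (orbits have ≤ 4m flags,
  -- so 4m steps suffice)
  sameOrbit : List (Flag m → Flag m) → Flag m → Flag m → Bool
  sameOrbit gens f g = elemB g (explore gens (4 * m) (f ∷ []))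

  keptFlags : (Fin m → Bool) → List (Flag m)
  keptFlags B = concatMap (λ f → if B (edge f) then f ∷ [] else []) (allFlags m)

  orbitCount : List (Flag m → Flag m) → (Fin m → Bool) → ℕ
  orbitCount gens B = countB isRep (keptFlags B)
    where
    isRep : Flag m → Bool
    isRep f = all (λ g → not (sameOrbit gens g f) ∨ (code f ≤ᵇ code g)) (keptFlags B)

  -- σ1 of the ribbon subgraph with edge set B: skip over the ends of
  -- deleted edges around the vertex
  skip : (Flag m → Flag m) → (Fin m → Bool) → ℕ → Flag m → Flag m
  skip s B zero f = s f
  skip s B (suc k) f = if B (edge (s f)) then s f else skip s B k (σ2 (s f))

  σ1↾ : (Flag m → Flag m) → (Fin m → Bool) → Flag m → Flag m
  σ1↾ s B = skip s B (4 * m)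

-- the ribbon subgraph (V , B) where V = vertices incident to B together
-- with the nIso G edgeless vertices of G
module Sub (G : RibbonGraph) (B : EdgeSet G) where
  s : Flag (nE G) → Flag (nE G)
  s = σ1↾ (σ1 G) B

  #V #E #F #K : ℕ
  #V = nIso G + orbitCount (s ∷ σ2 ∷ []) B
  #E = countB B (allFin (nE G))
  #F = nIso G + orbitCount (σ0 ∷ s ∷ []) B
  #K = nIso G + orbitCount (σ0 ∷ s ∷ σ2 ∷ []) B

  -- Euler genus via Euler's formula: γ = 2k − v + e − f
  eulerGenus : ℕ
  eulerGenus = (2 * #K + #E) ∸ (#V + #F)

  connected : Set
  connected = #K ≡ 1

allEdges : (G : RibbonGraph) → EdgeSet G
allEdges G _ = true

Connected : RibbonGraph → Set
Connected G = Sub.connected G (allEdges G)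

SubPlane SubRP2 : (G : RibbonGraph) → EdgeSet G → Set
SubPlane G B = Sub.connected G B × Sub.eulerGenus G B ≡ 0
SubRP2   G B = Sub.connected G B × Sub.eulerGenus G B ≡ 1

IsPlane IsRP2 : RibbonGraph → Set
IsPlane G = SubPlane G (allEdges G)
IsRP2   G = SubRP2 G (allEdges G)

-- Joins.  A decomposition G = H₁ ∨ ⋯ ∨ H_l is given by l and a labelling
-- lab : E(G) → Fin l, H_i being the ribbon subgraph with edges lab⁻¹(i).

module _ (G : RibbonGraph) {l : ℕ} (lab : Fin (nE G) → Fin l) where
  private m = nE G

  part : Fin l → EdgeSet G
  part i e = does (lab e ≟ i)

  before upto : Fin l → EdgeSet G
  before k e = toℕ (lab e) <ᵇ toℕ k
  upto   k e = toℕ (lab e) ≤ᵇ toℕ k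

  -- same vertex of G (vertices of ribbon subgraphs are vertices of G)
  sameV : Flag m → Flag m → Bool
  sameV = sameOrbit (σ1 G ∷ σ2 ∷ [])

  -- (H₁ ∨ ⋯ ∨ H_{k-1}) ∨ H_k  inside the ribbon subgraph upto k:
  -- P = before k and Q = part k share exactly one vertex v (the one of
  -- flag f₀), and some arc of the boundary of v meets all P-edge ends and
  -- no Q-edge ends, i.e. at most two corners of v (in upto k) go from a
  -- P-end to a Q-end.
  JoinStep : Fin l → Set
  JoinStep k = Σ (Flag m) λ f₀ → Σ (Flag m) λ g₀ →
      T (before k (edge f₀)) × T (part k (edge g₀)) × T (sameV f₀ g₀)
    × (∀ f g → T (before k (edge f)) → T (part k (edge g)) → T (sameV f g) → T (sameV f f₀))
    × countB (λ f → sameV f₀ f ∧ before k (edge f) ∧ part k (edge (σ1↾ (σ1 G) (upto k) f)))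
             (allFlags m) ≤ 2

  IsJoinDecomposition : Set
  IsJoinDecomposition =
      l ≡ 1
    ⊎ (2 ≤ l × nIso G ≡ 0
       × (∀ i → Σ (Fin m) λ e → lab e ≡ i)
       × (∀ i → Sub.connected G (part i))
       × (∀ k → 1 ≤ toℕ k → JoinStep k))

  HPlane HRP2 : Fin l → Set
  HPlane i = SubPlane G (part i)
  HRP2   i = SubRP2 G (part i)

  Defines : EdgeSet G → Set
  Defines A = Σ (Fin l → Bool) λ I → ∀ e → A e ≡ I (lab e)

PlaneJoinBiseparation : (G : RibbonGraph) → EdgeSet G → Set
PlaneJoinBiseparation G A = Σ ℕ λ l → Σ (Fin (nE G) → Fin l) λ lab →
  IsJoinDecomposition G lab × Defines G lab A × (∀ i → HPlane G lab i)

RP2JoinBiseparation : (G : RibbonGraph) → EdgeSet G → Set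
RP2JoinBiseparation G A = Σ ℕ λ l → Σ (Fin (nE G) → Fin l) λ lab →
  IsJoinDecomposition G lab × Defines G lab A
  × Σ (Fin l) λ i₀ → HRP2 G lab i₀ × (∀ i → i ≢ i₀ → HPlane G lab i)

{-# OPTIONS --safe #-}

-- Vertices, faces and components of G, of its ribbon subgraphs and of its partial duals are the
-- classes of relations on flags generated by σ1, by σ0 on some edges and by σ2 on some edges
-- (for the vertices of G ^ A: σ0 on A and σ2 off A).  Adding edges one at a time gives
-- V + F ≤ 2K + E.
--
-- Call a corner mixed if its two flags belong to edges of different colour (A or not A).  Surgery
-- at two mixed corners {f, σ1 f}, {g, σ1 g} with f, g of one colour pairs f with g and σ1 f with
-- σ1 g.  If G and G ^ A have genus at most 1, Euler's inequality for A and for its complement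
-- shows that the components of A and of its complement, linked at the vertices they share, form
-- a forest.  In a leaf the face walk from a mixed corner ends at a mixed corner of the same
-- vertex; surgery there separates a face, and it also separates the vertex unless the leaf is
-- one-sided.  Two one-sided leaves would exceed the genus of G or of G ^ A, so one of any two
-- leaves gives a surgery which, again by Euler's inequality, disconnects the graph.  Repeating
-- this until no mixed corner is left decomposes G into monochromatic components, linked by the
-- surgeries in a tree; removing the leaves of that tree one by one is the sequence of joins.
--
-- Conversely a join is the inverse of a separating surgery, which lowers each of the four counts
-- V, F of G and of G ^ A by one, so both genera are the sum of the genera of the parts.
module Submission where

open import Defs
open import Data.Nat as ℕ using (ℕ; zero; suc; _+_; _*_; _∸_; _≤_; _<_; z≤n; s≤s)
import Data.Nat.Properties as ℕ
import Data.Nat.DivMod as ℕ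
open import Data.Nat.Tactic.RingSolver using (solve-∀)
open import Data.Bool using (Bool; true; false; not; _∧_; _∨_; if_then_else_; T)
import Data.Bool.Properties as Bool
open import Data.Bool.ListAction using (any; all)
open import Data.Fin as Fin using (Fin; toℕ)
import Data.Fin.Properties as Fin
open import Data.Product using (_×_; _,_; Σ; ∃; proj₁; proj₂)
open import Data.Product.Properties using (≡-dec)
open import Data.Sum using (_⊎_; inj₁; inj₂; [_,_]′)
open import Data.Empty using (⊥; ⊥-elim)
open import Data.Unit using (⊤; tt)
open import Data.List using (List; []; _∷_; length; lookup; map; _++_; filter; filterᵇ; concatMap; allFin)
open import Data.Nat.ListAction using (sum)
import Data.List.Properties as List
open import Data.List.Relation.Unary.All as All using (All; []; _∷_)
import Data.List.Relation.Unary.All.Properties as All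
open import Data.List.Relation.Unary.Any as Any using (Any; here; there)
import Data.List.Relation.Unary.Any.Properties as Any
open import Data.List.Relation.Unary.AllPairs as AllPairs using (AllPairs; []; _∷_)
import Data.List.Relation.Unary.AllPairs.Properties as AllPairs
open import Data.List.Relation.Unary.Unique.Propositional using (Unique)
import Data.List.Relation.Unary.Unique.Propositional.Properties as Unique
open import Data.List.Membership.Propositional using (_∈_; lose; find)
import Data.List.Membership.Propositional.Properties as Mem
open import Relation.Nullary using (¬_; Dec; yes; no; does; contradiction)
open import Relation.Nullary.Decidable using (map′; ¬?; _×-dec_; _⊎-dec_)
open import Relation.Binary using (IsEquivalence)
open import Relation.Binary.Construct.Closure.ReflexiveTransitive using (Star; ε; _◅_)
open import Relation.Binary.PropositionalEquality using (_≡_; _≢_; refl; sym; trans; cong; cong₂; subst; subst₂; module ≡-Reasoning)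
open import Function using (_∘_; id)
open import Function.Bundles using (_⇔_; mk⇔; Equivalence)

-- Counting equivalence classes

-- A subgraph, a surgery or a dual never changes the set of flags, only the matching or the edges on
-- which `σ0` and `σ2` act; so two counts are compared by comparing relations on one set. Where `σ0`
-- and `σ2` act on complementary edge sets the classes are cycles alternating with the matching.
-- Vertices, faces and boundary components of spanning subgraphs are all of this kind, and for them
-- a surgery that separates `f` from `s ⟨ f ⟩` adds exactly one class.
--
-- The genus bound enters as the slack 1 in `2K + E ≤ V + F + 1`. Adding Euler's inequalities for
-- the two colours leaves `2(V + K) ≤ 2(k + l) + 1`, where `k` and `l` count the components of the
-- two spanning subgraphs, and parity removes the 1: this gives the forest. The slack remains in the
-- surgeries, where a single leaf may be one-sided, and for this reason two leaves are compared.
--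
-- The tree of surgeries is never stored. A count of changed flags against components replaces it,
-- and averaging that count yields a leaf each time a part is split off.

record Count {X : Set} (R : X → X → Set) (P : X → Set) (n : ℕ) : Set where
  field
    reps  : List X
    len   : length reps ≡ n
    inP   : All P reps
    indep : AllPairs (λ a b → ¬ R a b) reps
    cover : ∀ {x} → P x → Any (R x) reps

module _ {X : Set} {R : X → X → Set} (eq : IsEquivalence R) where
  private module E = IsEquivalence eq

  indep-injective : ∀ {xs} → AllPairs (λ a b → ¬ R a b) xs →
    ∀ i j → R (lookup xs i) (lookup xs j) → i ≡ j
  indep-injective (p ∷ ps) Fin.zero Fin.zero r = refl
  indep-injective (p ∷ ps) Fin.zero (Fin.suc j) r = ⊥-elim (All.lookup p (Mem.∈-lookup j) r)
  indep-injective (p ∷ ps) (Fin.suc i) Fin.zero r = ⊥-elim (All.lookup p (Mem.∈-lookup i) (E.sym r))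
  indep-injective (p ∷ ps) (Fin.suc i) (Fin.suc j) r = cong Fin.suc (indep-injective ps i j r)

-- For an equivalence `R` this is the equivalence generated by `R` and one further pair. A path
-- needs that pair at most once, in one of the two directions, so no closure has to be taken.
Plus : {X : Set} → (X → X → Set) → X → X → X → X → Set
Plus R x y a b = R a b ⊎ ((R a x × R y b) ⊎ (R a y × R x b))

plus-equivalence : ∀ {X : Set} {R : X → X → Set} → IsEquivalence R → ∀ x y → IsEquivalence (Plus R x y)
plus-equivalence {R = R} eq x y = record { refl = inj₁ E.refl ; sym = sy ; trans = tr }
  where
  module E = IsEquivalence eq
  sy : ∀ {a b} → Plus R x y a b → Plus R x y b a
  sy (inj₁ p) = inj₁ (E.sym p)
  sy (inj₂ (inj₁ (p , q))) = inj₂ (inj₂ (E.sym q , E.sym p))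
  sy (inj₂ (inj₂ (p , q))) = inj₂ (inj₁ (E.sym q , E.sym p))
  tr : ∀ {a b c} → Plus R x y a b → Plus R x y b c → Plus R x y a c
  tr (inj₁ p) (inj₁ q) = inj₁ (E.trans p q)
  tr (inj₁ p) (inj₂ (inj₁ (q , r))) = inj₂ (inj₁ (E.trans p q , r))
  tr (inj₁ p) (inj₂ (inj₂ (q , r))) = inj₂ (inj₂ (E.trans p q , r))
  tr (inj₂ (inj₁ (p , q))) (inj₁ r) = inj₂ (inj₁ (p , E.trans q r))
  tr (inj₂ (inj₂ (p , q))) (inj₁ r) = inj₂ (inj₂ (p , E.trans q r))
  tr (inj₂ (inj₁ (p , q))) (inj₂ (inj₁ (r , t))) = inj₂ (inj₁ (p , t))
  tr (inj₂ (inj₁ (p , q))) (inj₂ (inj₂ (r , t))) = inj₁ (E.trans p t)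
  tr (inj₂ (inj₂ (p , q))) (inj₂ (inj₁ (r , t))) = inj₁ (E.trans p t)
  tr (inj₂ (inj₂ (p , q))) (inj₂ (inj₂ (r , t))) = inj₂ (inj₂ (p , t))

-- Send each representative for `R′` to the representative of its class for `R`; two with the same
-- image are `R`-related, hence `R′`-related, hence equal. Relations are compared on `P′` alone,
-- which may be any set of elements, such as the flags of a subgraph.
count-≤ : ∀ {X : Set} {R R′ : X → X → Set} {P P′ : X → Set} {n n′} →
  IsEquivalence R → IsEquivalence R′ → (∀ {x} → P′ x → P x) →
  (∀ {x y} → P′ x → P′ y → R x y → R′ x y) → Count R P n → Count R′ P′ n′ → n′ ≤ n
count-≤ {R = R} {P′ = P′} eq eq′ P′⊆P R⊆R′ c c′ = subst₂ _≤_ C′.len C.len (Fin.injective⇒≤ inj)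
  where
  module C = Count c
  module C′ = Count c′
  module E = IsEquivalence eq
  at : ∀ i → P′ (lookup C′.reps i)
  at i = All.lookup C′.inP (Mem.∈-lookup i)
  cov : ∀ i → Any (R (lookup C′.reps i)) C.reps
  cov i = C.cover (P′⊆P (at i))
  ix : Fin (length C′.reps) → Fin (length C.reps)
  ix i = Any.index (cov i)
  inj : ∀ {i j} → ix i ≡ ix j → i ≡ j
  inj {i} {j} e = indep-injective eq′ C′.indep i j (R⊆R′ (at i) (at j)
    (E.trans (Any.lookup-result (cov i))
      (E.sym (subst (λ k → R (lookup C′.reps j) (lookup C.reps k)) (sym e) (Any.lookup-result (cov j))))))

count-≡ : ∀ {X : Set} {R R′ : X → X → Set} {P P′ : X → Set} {n n′} →
  IsEquivalence R → IsEquivalence R′ → (∀ {x} → P x → P′ x) → (∀ {x} → P′ x → P x) →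
  (∀ {x y} → P x → P y → R x y → R′ x y) → (∀ {x y} → P x → P y → R′ x y → R x y) →
  Count R P n → Count R′ P′ n′ → n ≡ n′
count-≡ eq eq′ P⊆ ⊆P R⊆ ⊆R c c′ = ℕ.≤-antisym
  (count-≤ eq′ eq P⊆ (λ p q r → ⊆R p q r) c′ c)
  (count-≤ eq eq′ ⊆P (λ p q r → R⊆ (⊆P p) (⊆P q) r) c c′)

-- An element of `W` has only to be related to one of `P` or `Q`; this serves where a vertex is
-- counted through some of its flags.
count-++ : ∀ {X : Set} {R : X → X → Set} {P Q W : X → Set} {n k} → IsEquivalence R →
  (∀ {x} → P x → W x) → (∀ {x} → Q x → W x) →
  (∀ {x} → W x → (∃ λ y → P y × R x y) ⊎ (∃ λ y → Q y × R x y)) →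
  (∀ {x y} → P x → Q y → ¬ R x y) → Count R P n → Count R Q k → Count R W (n + k)
count-++ {R = R} eq P⊆ Q⊆ W⊆ sep c d = record
  { reps  = C.reps ++ D.reps
  ; len   = trans (List.length-++ C.reps) (cong₂ _+_ C.len D.len)
  ; inP   = All.++⁺ (All.map P⊆ C.inP) (All.map Q⊆ D.inP)
  ; indep = AllPairs.++⁺ C.indep D.indep (All.map (λ p → All.map (sep p) D.inP) C.inP)
  ; cover = λ w → [ (λ { (y , p , r) → Any.++⁺ˡ (Any.map (E.trans r) (C.cover p)) })
                  , (λ { (y , q , r) → Any.++⁺ʳ C.reps (Any.map (E.trans r) (D.cover q)) }) ]′ (W⊆ w) }
  where
  module C = Count c
  module D = Count d
  module E = IsEquivalence eq

count-split : ∀ {X : Set} {R : X → X → Set} {P : X → Set} {n k l} → IsEquivalence R → (∀ x → Dec (P x)) →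
  (∀ {x y} → R x y → P x → P y) → Count R P n → Count R (λ x → ¬ P x) k → Count R (λ _ → ⊤) l → l ≡ n + k
count-split {R = R} {P} eq P? resp c d e = count-≡ eq eq id id (λ _ _ → id) (λ _ _ → id) e
  (count-++ eq _ _ cover (λ p ¬p r → ¬p (resp r p)) c d)
  where
  cover : ∀ {x} → ⊤ → (∃ λ y → P y × R x y) ⊎ (∃ λ y → ¬ P y × R x y)
  cover {x} _ with P? x
  ... | yes p = inj₁ (x , p , IsEquivalence.refl eq)
  ... | no ¬p = inj₂ (x , ¬p , IsEquivalence.refl eq)

count-map : ∀ {X : Set} {R R′ : X → X → Set} {P P′ : X → Set} {n} (φ : X → X) → (∀ x → φ (φ x) ≡ x) →
  (∀ {x} → P x → P′ (φ x)) → (∀ {x} → P′ x → P (φ x)) →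
  (∀ {x y} → R (φ x) (φ y) → R′ x y) → (∀ {x y} → R′ x y → R (φ x) (φ y)) → Count R P n → Count R′ P′ n
count-map {R = R} {R′} φ inv P⊆ ⊆P R⊆ ⊆R c = record
  { reps  = map φ C.reps
  ; len   = trans (List.length-map φ C.reps) C.len
  ; inP   = All.map⁺ (All.map P⊆ C.inP)
  ; indep = AllPairs.map⁺ (AllPairs.map (λ {x} {y} n r → n (subst₂ R (inv x) (inv y) (⊆R r))) C.indep)
  ; cover = λ {x} p → Any.map⁺ (Any.map (λ {y} r → R⊆ (subst (R (φ x)) (sym (inv y)) r)) (C.cover (⊆P p))) }
  where module C = Count c

module _ {X : Set} {R : X → X → Set} (eq : IsEquivalence R) where
  private module E = IsEquivalence eq

  -- Used for merging two classes and again for taking one component off the list when the joins are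
  -- put in order.
  remove-class : ∀ y xs → AllPairs (λ a b → ¬ R a b) xs → Any (R y) xs →
    Σ (List X) λ ys → length xs ≡ suc (length ys) × AllPairs (λ a b → ¬ R a b) ys × All (λ z → ¬ R y z) ys
      × (∀ {Q : X → Set} → All Q xs → All Q ys) × (∀ {z} → Any (R z) xs → Any (R z) ys ⊎ R z y)
  remove-class y (x ∷ xs) (p ∷ ps) (here yx) = xs , refl , ps , All.map (λ ¬xz yz → ¬xz (E.trans (E.sym yx) yz)) p
    , (λ { (_ ∷ qs) → qs }) , λ { (here zx) → inj₂ (E.trans zx (E.sym yx)) ; (there a) → inj₁ a }
  remove-class y (x ∷ xs) (p ∷ ps) (there a) with remove-class y xs ps a
  ... | ys , l , ind , far , sub , cov = x ∷ ys , cong suc l , sub p ∷ ind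
    , (λ yx → All.lookupWith (λ ¬xz yz → ¬xz (E.trans (E.sym yx) yz)) p a) ∷ far
    , (λ { (q ∷ qs) → q ∷ sub qs })
    , λ { (here zx) → inj₁ (here zx) ; (there b) → [ inj₁ ∘ there , inj₂ ]′ (cov b) }

  count-merge : ∀ {P : X → Set} {n x y} → P x → P y → ¬ R x y → Count R P n →
    ∃ λ n′ → n ≡ suc n′ × Count (Plus R x y) P n′
  count-merge {P} {n} {x} {y} px py ¬xy c with remove-class y (Count.reps c) (Count.indep c) (Count.cover c py)
  ... | ys , l , ind , far , sub , cov = length ys , trans (sym (Count.len c)) l , record
    { reps = ys ; len = refl ; inP = sub (Count.inP c)
    ; indep = indep′ ys ind far
    ; cover = λ pz → [ Any.map inj₁ , (λ zy → Any.map (λ r → inj₂ (inj₂ (zy , r))) x∈ys) ]′ (cov (Count.cover c pz)) }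
    where
    notplus : ∀ {a b} → ¬ R y a → ¬ R y b → ¬ R a b → ¬ Plus R x y a b
    notplus na nb nab (inj₁ r) = nab r
    notplus na nb nab (inj₂ (inj₁ (_ , r))) = nb r
    notplus na nb nab (inj₂ (inj₂ (r , _))) = na (E.sym r)
    indep′ : ∀ zs → AllPairs (λ a b → ¬ R a b) zs → All (λ z → ¬ R y z) zs → AllPairs (λ a b → ¬ Plus R x y a b) zs
    indep′ [] [] [] = []
    indep′ (z ∷ zs) (i ∷ is) (f ∷ fs) = All.zipWith (λ { (na , nr) → notplus f na nr }) (fs , i) ∷ indep′ zs is fs
    x∈ys : Any (R x) ys
    x∈ys = [ id , (λ xy → ⊥-elim (¬xy xy)) ]′ (cov (Count.cover c px))

  count-plus : ∀ {R′ : X → X → Set} {P : X → Set} {n n′ x y} → IsEquivalence R′ → P x → P y → Dec (R x y) →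
    (∀ {a b} → R′ a b → Plus R x y a b) → Count R P n → Count R′ P n′ → n ≤ suc n′
  count-plus {x = x} {y} eq′ px py (yes xy) sub c c′ = ℕ.m≤n⇒m≤1+n (count-≤ eq′ eq id (λ _ _ r → back (sub r)) c′ c)
    where
    back : ∀ {a b} → Plus R x y a b → R a b
    back (inj₁ r) = r
    back (inj₂ (inj₁ (p , q))) = E.trans p (E.trans xy q)
    back (inj₂ (inj₂ (p , q))) = E.trans p (E.trans (E.sym xy) q)
  count-plus {x = x} {y} eq′ px py (no ¬xy) sub c c′ with count-merge px py ¬xy c
  ... | k , refl , d = s≤s (count-≤ eq′ (plus-equivalence eq x y) id (λ _ _ → sub) c′ d)

  module _ (R? : ∀ x y → Dec (R x y)) where

    count-list : ∀ {P : X → Set} → (∀ x → Dec (P x)) → ∀ xs → ∃ λ n → Count R (λ x → P x × x ∈ xs) n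
    count-list P? [] = 0 , record { reps = [] ; len = refl ; inP = [] ; indep = [] ; cover = λ () }
    count-list {P} P? (x ∷ xs) with count-list P? xs
    ... | n , c with P? x
    ... | no ¬p = n , record
      { Count c ; inP = All.map (λ { (p , i) → p , there i }) (Count.inP c)
      ; cover = λ { (p , here refl) → ⊥-elim (¬p p) ; (p , there i) → Count.cover c (p , i) } }
    ... | yes p with Any.any? (R? x) (Count.reps c)
    ... | yes a = n , record
      { Count c ; inP = All.map (λ { (p , i) → p , there i }) (Count.inP c)
      ; cover = λ { (p , here refl) → a ; (p , there i) → Count.cover c (p , i) } }
    ... | no ¬a = suc n , record
      { reps = x ∷ Count.reps c ; len = cong suc (Count.len c)
      ; inP = (p , here refl) ∷ All.map (λ { (p , i) → p , there i }) (Count.inP c)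
      ; indep = All.¬Any⇒All¬ _ ¬a ∷ Count.indep c
      ; cover = λ { (p , here refl) → here E.refl ; (p , there i) → there (Count.cover c (p , i)) } }

    abstract
      count-exists : ∀ {P : X → Set} (xs : List X) → (∀ x → x ∈ xs) → (∀ x → Dec (P x)) → ∃ λ n → Count R P n
      count-exists xs full P? with count-list P? xs
      ... | n , c = n , record { Count c ; inP = All.map proj₁ (Count.inP c) ; cover = λ p → Count.cover c (p , full _) }

    degree : List X → X → ℕ
    degree xs r = length (filter (λ x → R? x r) xs)

    private
      bit : X → X → ℕ
      bit x r = if does (R? x r) then 1 else 0

      degree-∷ : ∀ x xs r → degree (x ∷ xs) r ≡ bit x r + degree xs r
      degree-∷ x xs r with does (R? x r)
      ... | true = refl
      ... | false = refl

      sum-+ : ∀ (f g : X → ℕ) L → sum (map (λ r → f r + g r) L) ≡ sum (map f L) + sum (map g L)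
      sum-+ f g [] = refl
      sum-+ f g (r ∷ L) rewrite sum-+ f g L = interchange (f r) (g r) _ _
        where
        interchange : ∀ a b c d → a + b + (c + d) ≡ a + c + (b + d)
        interchange = solve-∀

      sum-bit0 : ∀ x L → All (λ r → ¬ R x r) L → sum (map (bit x) L) ≡ 0
      sum-bit0 x [] [] = refl
      sum-bit0 x (r ∷ L) (n ∷ ns) with R? x r
      ... | yes p = ⊥-elim (n p)
      ... | no _ = sum-bit0 x L ns

      sum-bit1 : ∀ x L → AllPairs (λ a b → ¬ R a b) L → Any (R x) L → sum (map (bit x) L) ≡ 1
      sum-bit1 x (r ∷ L) (p ∷ ps) a with R? x r
      ... | yes xr = cong suc (sum-bit0 x L (All.map (λ n xs → n (E.trans (E.sym xr) xs)) p))
      sum-bit1 x (r ∷ L) (p ∷ ps) (here xr) | no n = ⊥-elim (n xr)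
      sum-bit1 x (r ∷ L) (p ∷ ps) (there a) | no n = sum-bit1 x L ps a

    -- Double counting: each element of `xs` contributes to exactly one representative.
    sum-degree : ∀ {L} xs → AllPairs (λ a b → ¬ R a b) L → All (λ x → Any (R x) L) xs →
      sum (map (degree xs) L) ≡ length xs
    sum-degree {L} [] ind [] = zeros L
      where
      zeros : ∀ L → sum (map (degree []) L) ≡ 0
      zeros [] = refl
      zeros (r ∷ L) = zeros L
    sum-degree {L} (x ∷ xs) ind (a ∷ as) = trans (cong sum (List.map-cong (degree-∷ x xs) L))
      (trans (sum-+ (bit x) (degree xs) L) (cong₂ _+_ (sum-bit1 x L ind a) (sum-degree xs ind as)))

-- Flags and orbits

module _ {X : Set} where

  countB-filter : ∀ (p : X → Bool) xs → countB p xs ≡ length (filterᵇ p xs)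
  countB-filter p [] = refl
  countB-filter p (x ∷ xs) with p x
  ... | true = cong suc (countB-filter p xs)
  ... | false = countB-filter p xs

  countB-≤-length : ∀ (p : X → Bool) xs → countB p xs ≤ length xs
  countB-≤-length p [] = z≤n
  countB-≤-length p (x ∷ xs) with p x
  ... | true = s≤s (countB-≤-length p xs)
  ... | false = ℕ.m≤n⇒m≤1+n (countB-≤-length p xs)

  countB-mono : ∀ {p q : X → Bool} → (∀ x → p x ≡ true → q x ≡ true) → ∀ xs → countB p xs ≤ countB q xs
  countB-mono h [] = z≤n
  countB-mono {p} {q} h (x ∷ xs) with p x | q x | h x
  ... | true | true | _ = s≤s (countB-mono h xs)
  ... | true | false | k = contradiction (k refl) (λ ())
  ... | false | true | _ = ℕ.m≤n⇒m≤1+n (countB-mono h xs)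
  ... | false | false | _ = countB-mono h xs

  countB-cong : ∀ {p q : X → Bool} → (∀ x → p x ≡ q x) → ∀ xs → countB p xs ≡ countB q xs
  countB-cong h [] = refl
  countB-cong h (x ∷ xs) rewrite h x | countB-cong h xs = refl

  countB-strict : ∀ {p q : X → Bool} → (∀ x → p x ≡ true → q x ≡ true) → ∀ {y xs} → y ∈ xs →
    p y ≡ false → q y ≡ true → suc (countB p xs) ≤ countB q xs
  countB-strict {p} {q} h {y} {.y ∷ xs} (here refl) py qy rewrite py | qy = s≤s (countB-mono h xs)
  countB-strict {p} {q} h {y} {x ∷ xs} (there i) py qy with p x | q x | h x
  ... | true | true | _ = s≤s (countB-strict h i py qy)
  ... | true | false | k = contradiction (k refl) (λ ())
  ... | false | true | _ = ℕ.m≤n⇒m≤1+n (countB-strict h i py qy)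
  ... | false | false | _ = countB-strict h i py qy

T⇒≡ : ∀ {b} → T b → b ≡ true
T⇒≡ = Equivalence.to Bool.T-≡

≡⇒T : ∀ {b} → b ≡ true → T b
≡⇒T = Equivalence.from Bool.T-≡

≢true⇒false : ∀ {b} → b ≢ true → b ≡ false
≢true⇒false = Bool.¬-not

∨-true : ∀ {a b} → a ∨ b ≡ true → a ≡ true ⊎ b ≡ true
∨-true {true} _ = inj₁ refl
∨-true {false} p = inj₂ p

∨-trueˡ : ∀ {a b} → a ≡ true → a ∨ b ≡ true
∨-trueˡ refl = refl

∨-trueʳ : ∀ {a b} → b ≡ true → a ∨ b ≡ true
∨-trueʳ {a} refl = Bool.∨-zeroʳ a

bool-≡ : ∀ {a b} → (a ≡ true → b ≡ true) → (b ≡ true → a ≡ true) → a ≡ b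
bool-≡ {true} f g = sym (f refl)
bool-≡ {false} {true} f g = g refl
bool-≡ {false} {false} f g = refl

true≢false : ∀ {a : Bool} → a ≡ true → a ≡ false → ⊥
true≢false refl ()

module _ {m : ℕ} where

  private X = Flag m

  infix 4 _≟F_ _∋_

  abstract
    _≟F_ : (x y : X) → Dec (x ≡ y)
    _≟F_ = ≡-dec Fin._≟_ (≡-dec Bool._≟_ Bool._≟_)

  _∋_ : (Fin m → Bool) → X → Set
  S ∋ x = S (edge x) ≡ true

  private
    low : Bool → Bool → ℕ
    low a b = (if a then 2 else 0) + (if b then 1 else 0)

    low<4 : ∀ a b → low a b < 4
    low<4 false false = s≤s z≤n
    low<4 false true = s≤s (s≤s z≤n)
    low<4 true false = s≤s (s≤s (s≤s z≤n))
    low<4 true true = s≤s (s≤s (s≤s (s≤s z≤n)))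

    code-low : ∀ e a b → code (e , a , b) ≡ low a b + toℕ {m} e * 4
    code-low e a b = trans (ℕ.+-assoc (4 * toℕ e) _ _) (trans (ℕ.+-comm (4 * toℕ e) (low a b)) (cong (low a b +_) (ℕ.*-comm 4 (toℕ e))))

    low-injective : ∀ a b a′ b′ → low a b ≡ low a′ b′ → a ≡ a′ × b ≡ b′
    low-injective false false false false _ = refl , refl
    low-injective false true false true _ = refl , refl
    low-injective true false true false _ = refl , refl
    low-injective true true true true _ = refl , refl
    low-injective true false false true ()
    low-injective true false true true ()
    low-injective true true false false ()
    low-injective true true true false ()

  code-injective : ∀ (x y : X) → code x ≡ code y → x ≡ y
  code-injective (e , a , b) (e′ , a′ , b′) p
    with low-injective a b a′ b′ (trans (sym (rem e a b)) (trans (cong (ℕ._% 4) p) (rem e′ a′ b′)))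
    where
    rem : ∀ e a b → code (e , a , b) ℕ.% 4 ≡ low a b
    rem e a b = trans (cong (ℕ._% 4) (code-low e a b))
      (trans (ℕ.[m+kn]%n≡m%n (low a b) (toℕ e) 4) (ℕ.m<n⇒m%n≡m (low<4 a b)))
  ... | refl , refl = cong (_, a , b) (Fin.toℕ-injective (ℕ.*-cancelʳ-≡ _ _ 4 (ℕ.+-cancelˡ-≡ (low a b) _ _
    (trans (sym (code-low e a b)) (trans p (code-low e′ a b))))))

  code< : ∀ (x : X) → code x < 4 * m
  code< (e , a , b) = subst₂ _<_ (sym (code-low e a b)) (ℕ.*-comm m 4)
    (ℕ.≤-trans (ℕ.+-monoˡ-< (toℕ e * 4) (low<4 a b)) (ℕ.*-monoˡ-≤ 4 (Fin.toℕ<n e)))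

  abstract
    index : X → Fin (4 * m)
    index x = Fin.fromℕ< (code< x)

    index-injective : ∀ {x y} → index x ≡ index y → x ≡ y
    index-injective e = code-injective _ _ (trans (sym (Fin.toℕ-fromℕ< _)) (trans (cong toℕ e) (Fin.toℕ-fromℕ< _)))

  flags : List X
  flags = allFlags m

  private
    quad : Fin m → List X
    quad e = (e , false , false) ∷ (e , false , true) ∷ (e , true , false) ∷ (e , true , true) ∷ []

  ∈-flags : ∀ (x : X) → x ∈ flags
  ∈-flags (e , a , b) = Mem.∈-concatMap⁺ _ (Any.map (λ { refl → pick a b }) (Mem.∈-allFin e))
    where
    pick : ∀ a b → (e , a , b) ∈ quad e
    pick false false = here refl
    pick false true = there (here refl)
    pick true false = there (there (here refl))
    pick true true = there (there (there (here refl)))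

  flags-unique : Unique flags
  flags-unique = Unique.concat⁺ (All.map⁺ (All.tabulate (λ {e} _ → four e)))
    (AllPairs.map⁺ (AllPairs.map (λ {e} {e′} ne {v} → λ { (i , j) → ne (trans (sym (on e i)) (on e′ j)) }) (Unique.allFin⁺ m)))
    where
    four : ∀ e → Unique (quad e)
    four e = ((λ ()) ∷ (λ ()) ∷ (λ ()) ∷ []) ∷ ((λ ()) ∷ (λ ()) ∷ []) ∷ ((λ ()) ∷ []) ∷ [] ∷ []
    on : ∀ {v} e → v ∈ quad e → edge v ≡ e
    on e (here refl) = refl
    on e (there (here refl)) = refl
    on e (there (there (here refl))) = refl
    on e (there (there (there (here refl)))) = refl

  length-flags : length flags ≡ 4 * m
  length-flags = go {m} (allFin m) (List.length-tabulate {n = m} id)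
    where
    go : ∀ {k : ℕ} (es : List (Fin m)) → length es ≡ k → length (concatMap quad es) ≡ 4 * k
    go [] refl = refl
    go (e ∷ es) refl = trans (cong (λ z → suc (suc (suc (suc z)))) (go es refl)) (sym (ℕ.*-distribˡ-+ 4 1 (length es)))

  elemB-∈ : ∀ {x : X} {R} → elemB x R ≡ true → x ∈ R
  elemB-∈ {x} {R} p = Any.map (λ {y} t → code-injective x y (ℕ.≡ᵇ⇒≡ _ _ t)) (Any.any⁻ (flagEq x) R (≡⇒T p))

  ∈-elemB : ∀ {x : X} {R} → x ∈ R → elemB x R ≡ true
  ∈-elemB {x} {R} i = T⇒≡ (Any.any⁺ (flagEq x) (Any.map (λ { refl → ℕ.≡⇒≡ᵇ (code x) _ refl }) i))

  some? : ∀ {P : X → Set} → (∀ x → Dec (P x)) → Dec (∃ P)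
  some? P? = map′ (λ a → let x , _ , p = find a in x , p) (λ { (x , p) → lose (∈-flags x) p }) (Any.any? P? flags)

  Gen : List (X → X) → X → X → Set
  Gen hs x y = Any (λ h → h x ≡ y) hs

  Orb : List (X → X) → X → X → Set
  Orb hs = Star (Gen hs)

  orb-⊆ : ∀ {hs} {R : X → X → Set} → (∀ {x} → R x x) → (∀ {x y z} → R x y → R y z → R x z) →
    All (λ h → ∀ x → R x (h x)) hs → ∀ {x y} → Orb hs x y → R x y
  orb-⊆ r t gs ε = r
  orb-⊆ {hs} {R} r t gs {x} (a ◅ p) = t (All.lookupWith (λ {h} g e → subst (R x) e (g x)) gs a) (orb-⊆ r t gs p)

  module _ (hs : List (X → X)) where

    private
      step⁺ : ∀ {R} {x : X} → x ∈ R → x ∈ step hs R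
      step⁺ {R} {x} i = Mem.∈-filter⁺ _ (∈-flags x) (≡⇒T (cong (_∨ any (λ y → any (λ h → flagEq (h y) x) hs) R) (∈-elemB i)))

      step-gen : ∀ {R x y} → x ∈ R → Gen hs x y → y ∈ step hs R
      step-gen {R} {x} {y} i g = Mem.∈-filter⁺ _ (∈-flags y) (Equivalence.from (Bool.T-∨ {elemB y R}) (inj₂
        (Any.any⁺ _ (Any.map (λ { refl → Any.any⁺ _ (Any.map (λ { refl → ℕ.≡⇒≡ᵇ (code y) _ refl }) g) }) i))))

      step⁻ : ∀ R {y} → y ∈ step hs R → y ∈ R ⊎ (∃ λ x → x ∈ R × Gen hs x y)
      step⁻ R {y} i with Equivalence.to (Bool.T-∨ {elemB y R}) (proj₂ (Mem.∈-filter⁻ _ {xs = flags} i))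
      ... | inj₁ t = inj₁ (elemB-∈ {y} {R} (T⇒≡ t))
      ... | inj₂ t with find (Any.any⁻ _ R t)
      ... | x , x∈R , u = inj₂ (x , x∈R , Any.map (λ {h} e → code-injective (h x) y (ℕ.≡ᵇ⇒≡ _ _ e)) (Any.any⁻ _ hs u))

      explore⁻ : ∀ k R {y} → y ∈ explore hs k R → ∃ λ x → x ∈ R × Orb hs x y
      explore⁻ zero R {y} i = y , i , ε
      explore⁻ (suc k) R i with explore⁻ k (step hs R) i
      ... | x , j , p with step⁻ R j
      ... | inj₁ x∈R = x , x∈R , p
      ... | inj₂ (z , z∈R , g) = z , z∈R , g ◅ p

      explore⁺ : ∀ k R {x} → x ∈ R → x ∈ explore hs k R
      explore⁺ zero R i = i
      explore⁺ (suc k) R i = explore⁺ k (step hs R) (step⁺ i)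

      Closed : List X → Set
      Closed R = ∀ {x y} → x ∈ R → Gen hs x y → y ∈ R

      size : List X → ℕ
      size R = countB (λ x → elemB x R) flags

      closed-explore : ∀ k R → Closed R → Closed (explore hs k R)
      closed-explore zero R c = c
      closed-explore (suc k) R c = closed-explore k (step hs R) λ i g → step⁺ (c (inR i) g)
        where
        inR : ∀ {x} → x ∈ step hs R → x ∈ R
        inR i with step⁻ R i
        ... | inj₁ j = j
        ... | inj₂ (z , z∈R , g) = c z∈R g

      -- A step that adds no flag shows that the set is closed, and it stays closed; any other step
      -- adds at least one. Starting from one flag, `4 * m` steps of the second kind would produce
      -- more flags than there are.
      grow : ∀ k R → Closed (explore hs k R) ⊎ (size R + k ≤ size (explore hs k R))
      grow zero R = inj₂ (ℕ.≤-reflexive (ℕ.+-identityʳ _))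
      grow (suc k) R with Any.any? (λ x → (elemB x (step hs R) Bool.≟ true) ×-dec (elemB x R Bool.≟ false)) flags
      ... | no none = inj₁ (closed-explore k (step hs R) (closed-step λ i g → old (step-gen i g)))
        where
        old : ∀ {y} → y ∈ step hs R → y ∈ R
        old {y} i with elemB y R in eq
        ... | true = elemB-∈ {y} {R} eq
        ... | false = ⊥-elim (none (lose (∈-flags y) (∈-elemB i , eq)))
        closed-step : Closed R → Closed (step hs R)
        closed-step c i g = step⁺ (c (old i) g)
      ... | yes new with grow k (step hs R)
      ... | inj₁ c = inj₁ c
      ... | inj₂ le with find new
      ... | x , x∈ , p , q = inj₂ (ℕ.≤-trans (ℕ.≤-reflexive (ℕ.+-suc (size R) k))
              (ℕ.≤-trans (ℕ.+-monoˡ-≤ k (countB-strict (λ z e → ∈-elemB (step⁺ (elemB-∈ {z} {R} e))) x∈ q p)) le))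

    sameOrbit⁻ : ∀ {x y} → sameOrbit hs x y ≡ true → Orb hs x y
    sameOrbit⁻ {x} {y} p with explore⁻ (4 * m) (x ∷ []) (elemB-∈ {y} {explore hs (4 * m) (x ∷ [])} p)
    ... | .x , here refl , q = q

    sameOrbit⁺ : ∀ {x y} → Orb hs x y → sameOrbit hs x y ≡ true
    sameOrbit⁺ {x} p with grow (4 * m) (x ∷ [])
    ... | inj₁ c = ∈-elemB (go p (explore⁺ (4 * m) (x ∷ []) (here refl)))
      where
      go : ∀ {a b} → Orb hs a b → a ∈ explore hs (4 * m) (x ∷ []) → b ∈ explore hs (4 * m) (x ∷ [])
      go ε i = i
      go (g ◅ q) i = go q (c i g)
    ... | inj₂ le = ⊥-elim (ℕ.<-irrefl refl (ℕ.≤-trans (ℕ.+-monoˡ-≤ (4 * m) one)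
            (ℕ.≤-trans le (ℕ.≤-trans (countB-≤-length _ flags) (ℕ.≤-reflexive length-flags)))))
      where
      one : 1 ≤ size (x ∷ [])
      one = ℕ.≤-trans (s≤s z≤n) (countB-strict {p = λ _ → false} (λ _ ()) (∈-flags x) refl (∈-elemB {x} {x ∷ []} (here refl)))

    abstract
      orb? : ∀ x y → Dec (Orb hs x y)
      orb? x y with sameOrbit hs x y in eq
      ... | true = yes (sameOrbit⁻ eq)
      ... | false = no λ p → contradiction (trans (sym eq) (sameOrbit⁺ p)) λ ()

  private
    kept-filter : ∀ B → keptFlags {m} B ≡ filterᵇ (λ x → B (edge x)) flags
    kept-filter B = go flags
      where
      go : ∀ xs → concatMap (λ f → if B (edge f) then f ∷ [] else []) xs ≡ filterᵇ (λ x → B (edge x)) xs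
      go [] = refl
      go (x ∷ xs) with B (edge x)
      ... | true = cong (x ∷_) (go xs)
      ... | false = go xs

  -- The representatives are the flags of least `code`: two in one class are equal because `code` is
  -- injective, and descent on `code` reaches one from any flag. Agreement of `R` with the orbits is
  -- asked for on `B` only, since `σ1↾` is meaningful only there.
  orbitCount-count : ∀ hs B {R : X → X → Set} → IsEquivalence R →
    (∀ {x y} → B ∋ x → B ∋ y → Orb hs x y → R x y) → (∀ {x y} → B ∋ x → B ∋ y → R x y → Orb hs x y) →
    Count R (B ∋_) (orbitCount hs B)
  orbitCount-count hs B {R} eq to from = record
    { reps = filterᵇ isRep kept
    ; len = sym (countB-filter isRep kept)
    ; inP = All.tabulate (λ i → proj₁ (rep⁻ i))
    ; indep = indep kept-unique
    ; cover = λ {x} b → lowest (4 * m) x b (code< x) }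
    where
    module E = IsEquivalence eq
    kept = keptFlags {m} B
    isRep : X → Bool
    isRep f = all (λ g → not (sameOrbit hs g f) ∨ (code f ℕ.≤ᵇ code g)) kept
    kept⁺ : ∀ {x} → B ∋ x → x ∈ kept
    kept⁺ {x} b = subst (x ∈_) (sym (kept-filter B)) (Mem.∈-filter⁺ _ (∈-flags x) (≡⇒T b))
    kept⁻ : ∀ {x} → x ∈ kept → B ∋ x
    kept⁻ {x} i = T⇒≡ (proj₂ (Mem.∈-filter⁻ _ {xs = flags} (subst (x ∈_) (kept-filter B) i)))
    kept-unique : Unique kept
    kept-unique = subst Unique (sym (kept-filter B)) (Unique.filter⁺ _ flags-unique)
    Min : X → Set
    Min f = ∀ {g} → B ∋ g → R g f → code f ≤ code g
    min⁻ : ∀ {f} → B ∋ f → isRep f ≡ true → Min f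
    min⁻ {f} bf t {g} bg r with Equivalence.to (Bool.T-∨ {not (sameOrbit hs g f)}) (All.lookup (All.all⁺ _ kept (≡⇒T t)) (kept⁺ bg))
    ... | inj₂ u = ℕ.≤ᵇ⇒≤ _ _ u
    ... | inj₁ u = contradiction (trans (sym (sameOrbit⁺ hs (from bg bf r))) (Equivalence.to Bool.T-not-≡ u)) λ ()
    min⁺ : ∀ {f} → B ∋ f → Min f → isRep f ≡ true
    min⁺ {f} bf mn = T⇒≡ (All.all⁻ _ (All.tabulate λ {g} i → ok g (kept⁻ i)))
      where
      ok : ∀ g → B ∋ g → T (not (sameOrbit hs g f) ∨ (code f ℕ.≤ᵇ code g))
      ok g bg with sameOrbit hs g f in e
      ... | false = tt
      ... | true = ℕ.≤⇒≤ᵇ (mn bg (to bg bf (sameOrbit⁻ hs e)))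
    rep⁻ : ∀ {f} → f ∈ filterᵇ isRep kept → B ∋ f × Min f
    rep⁻ i with Mem.∈-filter⁻ _ {xs = kept} i
    ... | j , t = kept⁻ j , min⁻ (kept⁻ j) (T⇒≡ t)
    indep : Unique kept → AllPairs (λ a b → ¬ R a b) (filterᵇ isRep kept)
    indep u = go (Unique.filter⁺ _ u) (All.tabulate rep⁻)
      where
      go : ∀ {xs} → Unique xs → All (λ f → B ∋ f × Min f) xs → AllPairs (λ a b → ¬ R a b) xs
      go [] [] = []
      go (n ∷ ns) ((b , mn) ∷ as) = All.zipWith (λ { {y} (ne , b′ , mn′) r → ne (code-injective _ y
        (ℕ.≤-antisym (mn b′ (E.sym r)) (mn′ b r))) }) (n , as) ∷ go ns as
    lowest : ∀ k x → B ∋ x → code x < k → Any (R x) (filterᵇ isRep kept)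
    lowest (suc k) x b (s≤s lt) with Any.any? (λ g → orb? hs g x ×-dec (code g ℕ.<? code x)) kept
    ... | yes a with find a
    ... | g , i , p , l = Any.map (E.trans (E.sym (to (kept⁻ i) b p))) (lowest k g (kept⁻ i) (ℕ.≤-trans l lt))
    lowest (suc k) x b (s≤s lt) | no n = lose (Mem.∈-filter⁺ _ (kept⁺ b)
      (≡⇒T (min⁺ b λ {g} bg r → ℕ.≮⇒≥ λ l → n (lose (kept⁺ bg) (from bg b r , l))))) E.refl

-- Matchings of flags, alternating walks and ribbon subgraphs

record Matching (m : ℕ) : Set where
  no-eta-equality
  field
    fn    : Flag m → Flag m
    invol : ∀ x → fn (fn x) ≡ x
    fpf   : ∀ x → fn x ≢ x

infix 20 _⟨_⟩
_⟨_⟩ : ∀ {m} → Matching m → Flag m → Flag m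
_⟨_⟩ = Matching.fn

open Matching public using (invol; fpf)

full none : ∀ {m} → Fin m → Bool
full _ = true
none _ = false

∁ : ∀ {m} → (Fin m → Bool) → Fin m → Bool
∁ S e = not (S e)

module _ {m : ℕ} where

  private
    X = Flag m
    ES = Fin m → Bool

  σ0-invol : ∀ (x : X) → σ0 (σ0 x) ≡ x
  σ0-invol (e , a , b) = cong (λ c → e , c , b) (Bool.not-involutive a)

  σ2-invol : ∀ (x : X) → σ2 (σ2 x) ≡ x
  σ2-invol (e , a , b) = cong (λ c → e , a , c) (Bool.not-involutive b)

  σ0-fpf : ∀ (x : X) → σ0 x ≢ x
  σ0-fpf (e , false , b) ()
  σ0-fpf (e , true , b) ()

  σ2-fpf : ∀ (x : X) → σ2 x ≢ x
  σ2-fpf (e , a , false) ()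
  σ2-fpf (e , a , true) ()

  on : ES → (X → X) → X → X
  on S h x = if S (edge x) then h x else x

  -- The classes are the vertices for (`none`, `full`), the faces for (`full`, `none`) and the
  -- components for (`full`, `full`). For the spanning subgraph with edges `S` they are its
  -- components for (`S`, `full`) and its boundary components for (`S`, `∁ S`).
  data Conn (s : Matching m) (S₀ S₂ : ES) : X → X → Set where
    ε    : ∀ {x} → Conn s S₀ S₂ x x
    by-s : ∀ {x y} → Conn s S₀ S₂ (s ⟨ x ⟩) y → Conn s S₀ S₂ x y
    by-0 : ∀ {x y} → S₀ ∋ x → Conn s S₀ S₂ (σ0 x) y → Conn s S₀ S₂ x y
    by-2 : ∀ {x y} → S₂ ∋ x → Conn s S₀ S₂ (σ2 x) y → Conn s S₀ S₂ x y

  infixr 5 _◅◅_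

  _◅◅_ : ∀ {s S₀ S₂ x y z} → Conn s S₀ S₂ x y → Conn s S₀ S₂ y z → Conn s S₀ S₂ x z
  ε ◅◅ q = q
  by-s p ◅◅ q = by-s (p ◅◅ q)
  by-0 i p ◅◅ q = by-0 i (p ◅◅ q)
  by-2 i p ◅◅ q = by-2 i (p ◅◅ q)

  module _ {s : Matching m} {S₀ S₂ : ES} where

    conn-s : ∀ x → Conn s S₀ S₂ x (s ⟨ x ⟩)
    conn-s x = by-s ε

    conn-0 : ∀ x → S₀ ∋ x → Conn s S₀ S₂ x (σ0 x)
    conn-0 x p = by-0 p ε

    conn-2 : ∀ x → S₂ ∋ x → Conn s S₀ S₂ x (σ2 x)
    conn-2 x p = by-2 p ε

    conn-⊆ : ∀ {R : X → X → Set} → (∀ {x} → R x x) → (∀ {x y z} → R x y → R y z → R x z) →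
      (∀ x → R x (s ⟨ x ⟩)) → (∀ x → S₀ ∋ x → R x (σ0 x)) → (∀ x → S₂ ∋ x → R x (σ2 x)) →
      ∀ {x y} → Conn s S₀ S₂ x y → R x y
    conn-⊆ r t g g₀ g₂ ε = r
    conn-⊆ r t g g₀ g₂ (by-s p) = t (g _) (conn-⊆ r t g g₀ g₂ p)
    conn-⊆ r t g g₀ g₂ (by-0 i p) = t (g₀ _ i) (conn-⊆ r t g g₀ g₂ p)
    conn-⊆ r t g g₀ g₂ (by-2 i p) = t (g₂ _ i) (conn-⊆ r t g g₀ g₂ p)

    conn-closed : ∀ (Q : X → Set) → (∀ x → Q x → Q (s ⟨ x ⟩)) → (∀ x → S₀ ∋ x → Q x → Q (σ0 x)) →
      (∀ x → S₂ ∋ x → Q x → Q (σ2 x)) → ∀ {x y} → Conn s S₀ S₂ x y → Q x → Q y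
    conn-closed Q = conn-⊆ {λ x y → Q x → Q y} id (λ f g → g ∘ f)

    conn-equivalence : IsEquivalence (Conn s S₀ S₂)
    conn-equivalence = record { refl = ε ; trans = _◅◅_ ; sym = conn-⊆ {λ x y → Conn s S₀ S₂ y x} ε (λ p q → q ◅◅ p)
      (λ x → subst (Conn s S₀ S₂ _) (invol s x) (conn-s _))
      (λ x p → subst (Conn s S₀ S₂ _) (σ0-invol x) (conn-0 _ p))
      (λ x p → subst (Conn s S₀ S₂ _) (σ2-invol x) (conn-2 _ p)) }

    conn-sym : ∀ {x y} → Conn s S₀ S₂ x y → Conn s S₀ S₂ y x
    conn-sym = IsEquivalence.sym conn-equivalence

    private
      hs : List (X → X)
      hs = (s ⟨_⟩) ∷ on S₀ σ0 ∷ on S₂ σ2 ∷ []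

      on-eq : ∀ S (h : X → X) {x} → S ∋ x → on S h x ≡ h x
      on-eq S h p rewrite p = refl

      conn-orb : ∀ {x y} → Conn s S₀ S₂ x y → Orb hs x y
      conn-orb ε = ε
      conn-orb (by-s p) = here refl ◅ conn-orb p
      conn-orb (by-0 i p) = there (here (on-eq S₀ σ0 i)) ◅ conn-orb p
      conn-orb (by-2 i p) = there (there (here (on-eq S₂ σ2 i))) ◅ conn-orb p

      orb-conn : ∀ {x y} → Orb hs x y → Conn s S₀ S₂ x y
      orb-conn = orb-⊆ ε _◅◅_ (conn-s ∷ at S₀ conn-0 ∷ at S₂ conn-2 ∷ [])
        where
        at : ∀ S {h} → (∀ x → S ∋ x → Conn s S₀ S₂ x (h x)) → ∀ x → Conn s S₀ S₂ x (on S h x)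
        at S k x with S (edge x) in eq
        ... | true = k x eq
        ... | false = ε

    conn? : ∀ x y → Dec (Conn s S₀ S₂ x y)
    conn? x y = map′ orb-conn conn-orb (orb? hs x y)

  conn-mono : ∀ {s S₀ S₂ S₀′ S₂′} → (∀ e → S₀ e ≡ true → S₀′ e ≡ true) → (∀ e → S₂ e ≡ true → S₂′ e ≡ true) →
    ∀ {x y} → Conn s S₀ S₂ x y → Conn s S₀′ S₂′ x y
  conn-mono h₀ h₂ = conn-⊆ ε _◅◅_ conn-s (λ x p → conn-0 x (h₀ _ p)) (λ x p → conn-2 x (h₂ _ p))

  private
    cnt-exists : ∀ s S₀ S₂ → ∃ λ n → Count (Conn s S₀ S₂) (λ _ → ⊤) n
    cnt-exists s S₀ S₂ = count-exists conn-equivalence conn? flags ∈-flags (λ _ → yes tt)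

  abstract
    cnt : Matching m → ES → ES → ℕ
    cnt s S₀ S₂ = proj₁ (cnt-exists s S₀ S₂)

    cnt-count : ∀ s S₀ S₂ → Count (Conn s S₀ S₂) (λ _ → ⊤) (cnt s S₀ S₂)
    cnt-count s S₀ S₂ = proj₂ (cnt-exists s S₀ S₂)

  cnt-≤ : ∀ {s S₀ S₂ s′ S₀′ S₂′} → (∀ {x y} → Conn s S₀ S₂ x y → Conn s′ S₀′ S₂′ x y) → cnt s′ S₀′ S₂′ ≤ cnt s S₀ S₂
  cnt-≤ h = count-≤ conn-equivalence conn-equivalence id (λ _ _ → h) (cnt-count _ _ _) (cnt-count _ _ _)

  cnt-≡ : ∀ {s S₀ S₂ s′ S₀′ S₂′} → (∀ {x y} → Conn s S₀ S₂ x y → Conn s′ S₀′ S₂′ x y) →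
    (∀ {x y} → Conn s′ S₀′ S₂′ x y → Conn s S₀ S₂ x y) → cnt s S₀ S₂ ≡ cnt s′ S₀′ S₂′
  cnt-≡ h k = ℕ.≤-antisym (cnt-≤ k) (cnt-≤ h)

  cnt-plus : ∀ {s S₀ S₂ s′ S₀′ S₂′} x y → (∀ {a b} → Conn s′ S₀′ S₂′ a b → Plus (Conn s S₀ S₂) x y a b) →
    cnt s S₀ S₂ ≤ suc (cnt s′ S₀′ S₂′)
  cnt-plus x y h = count-plus conn-equivalence conn-equivalence tt tt (conn? x y) h (cnt-count _ _ _) (cnt-count _ _ _)

  -- With a = σ1, b = σ2 and P the edges kept this is skip; with a = σ0, b = σ1 it follows a face.
  module Walks (a b : X → X) (P : X → Bool) where

    data Walk : X → X → Set where
      stop : ∀ {x} → P (a x) ≡ true → Walk x (a x)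
      go   : ∀ {x y} → P (a x) ≡ false → Walk (b (a x)) y → Walk x y

    run : ℕ → X → X
    run zero x = a x
    run (suc k) x = if P (a x) then a x else run k (b (a x))

    walk-end : ∀ {x y} → Walk x y → P y ≡ true
    walk-end (stop p) = p
    walk-end (go _ w) = walk-end w

    walk-unique : ∀ {x y z} → Walk x y → Walk x z → y ≡ z
    walk-unique (stop p) (stop q) = refl
    walk-unique (stop p) (go q _) = contradiction (trans (sym p) q) λ ()
    walk-unique (go p _) (stop q) = contradiction (trans (sym q) p) λ ()
    walk-unique (go p w) (go q v) = walk-unique w v

    walk-⊆ : ∀ {R : X → X → Set} (Q : X → Set) → (∀ {x} → R x x) → (∀ {x y z} → R x y → R y z → R x z) →
      (∀ x → Q x → R x (a x) × Q (a x)) → (∀ x → P x ≡ false → Q x → R x (b x) × Q (b x)) →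
      ∀ {x y} → Walk x y → Q x → R x y × Q y
    walk-⊆ Q r t ga gb (stop p) q = ga _ q
    walk-⊆ Q r t ga gb (go p w) q =
      let s , q₁ = ga _ q ; u , q₂ = gb _ p q₁ ; v , q₃ = walk-⊆ Q r t ga gb w q₂ in t s (t u v) , q₃

    module _ (a-invol : ∀ x → a (a x) ≡ x) (b-invol : ∀ x → b (b x) ≡ x) where

      -- `Z` is the set of flags passed by the walk, closed under `a`, and under `b` except at the
      -- two ends. The last component is induction along the walk.
      walk-support : ∀ {x y} → Walk x y → Σ (X → Set) λ Z → Z x × Z y × (∀ z → Z z → Z (a z))
        × (∀ z → Z z → z ≡ x ⊎ (z ≡ y ⊎ Z (b z)))
        × (∀ (Q : X → Set) → (∀ x → Q x → Q (a x)) → (∀ x → P x ≡ false → Q x → Q (b x)) → Q x → ∀ z → Z z → Q z)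
      walk-support {x} (stop p) = (λ z → z ≡ x ⊎ z ≡ a x) , inj₁ refl , inj₂ refl
        , (λ { z (inj₁ refl) → inj₂ refl ; z (inj₂ refl) → inj₁ (a-invol x) })
        , (λ { z (inj₁ e) → inj₁ e ; z (inj₂ e) → inj₂ (inj₁ e) })
        , λ { Q qa qb q z (inj₁ refl) → q ; Q qa qb q z (inj₂ refl) → qa _ q }
      walk-support {x} {y} (go p w) with walk-support w
      ... | Z , zx , zy , za , zb , ind = (λ z → z ≡ x ⊎ (z ≡ a x ⊎ Z z)) , inj₁ refl , inj₂ (inj₂ zy)
        , (λ { z (inj₁ refl) → inj₂ (inj₁ refl) ; z (inj₂ (inj₁ refl)) → inj₁ (a-invol x) ; z (inj₂ (inj₂ q)) → inj₂ (inj₂ (za z q)) })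
        , (λ { z (inj₁ e) → inj₁ e ; z (inj₂ (inj₁ refl)) → inj₂ (inj₂ (inj₂ (inj₂ zx))) ; z (inj₂ (inj₂ q)) → next z q (zb z q) })
        , λ { Q qa qb q z (inj₁ refl) → q ; Q qa qb q z (inj₂ (inj₁ refl)) → qa _ q
            ; Q qa qb q z (inj₂ (inj₂ r)) → ind Q qa qb (qb _ p (qa _ q)) z r }
        where
        next : ∀ z → Z z → z ≡ b (a x) ⊎ (z ≡ y ⊎ Z (b z)) → z ≡ x ⊎ (z ≡ y ⊎ (b z ≡ x ⊎ (b z ≡ a x ⊎ Z (b z))))
        next z q (inj₁ refl) = inj₂ (inj₂ (inj₂ (inj₁ (b-invol (a x)))))
        next z q (inj₂ (inj₁ e)) = inj₂ (inj₁ e)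
        next z q (inj₂ (inj₂ r)) = inj₂ (inj₂ (inj₂ (inj₂ r)))

      -- t is where the walk arrives when it is continued backwards from x.
      walk-reverse-from : ∀ {x y t} → (P x ≡ true → t ≡ x) → (P x ≡ false → Walk (b x) t) →
        (∀ z → P (b z) ≡ P z) → Walk x y → Walk y t
      private
        back : ∀ {x t} → (P x ≡ true → t ≡ x) → (P x ≡ false → Walk (b x) t) → Walk (a x) t
        back {x} {t} h k with P x in eq
        ... | true = subst₂ Walk refl (trans (a-invol x) (sym (h refl))) (stop (trans (cong P (a-invol x)) eq))
        ... | false = go (trans (cong P (a-invol x)) eq) (subst (λ z → Walk (b z) t) (sym (a-invol x)) (k refl))
      walk-reverse-from h k Pb (stop p) = back h k
      walk-reverse-from {x} {t = t} h k Pb (go p w) = walk-reverse-from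
        (λ q → contradiction (trans (sym q) (trans (Pb (a x)) p)) λ ())
        (λ _ → subst (λ z → Walk z t) (sym (b-invol (a x))) (back h k)) Pb w

      walk-reverse : ∀ {x y} → (∀ z → P (b z) ≡ P z) → P x ≡ true → Walk x y → Walk y x
      walk-reverse Pb px = walk-reverse-from (λ _ → refl) (λ q → contradiction (trans (sym px) q) λ ()) Pb

      private
        it : ℕ → X → X
        it zero x = x
        it (suc k) x = it k (b (a x))

        it-+ : ∀ i d x → it i (it d x) ≡ it (i + d) x
        it-+ i zero x = cong (λ k → it k x) (sym (ℕ.+-identityʳ i))
        it-+ i (suc d) x = trans (it-+ i d (b (a x))) (cong (λ k → it k x) (sym (ℕ.+-suc i d)))

        it-injective : ∀ i {x y} → it i x ≡ it i y → x ≡ y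
        it-injective zero e = e
        it-injective (suc i) {x} {y} e = trans (sym (a-invol x)) (trans (cong a (trans (sym (b-invol (a x)))
          (trans (cong b (it-injective i e)) (b-invol (a y))))) (a-invol y))

        -- Each step is injective, so a repetition found by the pigeonhole principle can be shifted
        -- back to the start.
        period : ∀ x → ∃ λ d → suc d ≤ 4 * m × it (suc d) x ≡ x
        period x = from (Fin.pigeonhole ℕ.≤-refl (λ i → index (it (toℕ i) x)))
          where
          from : (∃ λ (i : Fin (suc (4 * m))) → ∃ λ j → toℕ i < toℕ j × index (it (toℕ i) x) ≡ index (it (toℕ j) x)) →
            ∃ λ d → suc d ≤ 4 * m × it (suc d) x ≡ x
          from (i , j , i<j , e) = d , le , sym (it-injective (toℕ i) (trans (index-injective e)
              (sym (trans (it-+ (toℕ i) (suc d) x) (cong (λ k → it k x) (trans (ℕ.+-suc (toℕ i) d) (ℕ.m+[n∸m]≡n i<j)))))))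
            where
            d = toℕ j ∸ suc (toℕ i)
            le : suc d ≤ 4 * m
            le = ℕ.≤-trans (ℕ.≤-reflexive (sym (ℕ.+-∸-assoc 1 i<j))) (ℕ.≤-trans (ℕ.m∸n≤m (toℕ j) (toℕ i)) (ℕ.≤-pred (Fin.toℕ<n j)))

        run-walk : (∀ z → P (b z) ≡ P z) → ∀ n k x → n < k → P (it (suc n) x) ≡ true → Walk x (run k x)
        run-walk Pb n (suc k) x lt p with P (a x) in eq
        run-walk Pb n (suc k) x lt p | true = stop eq
        run-walk Pb zero (suc k) x lt p | false = contradiction (trans (sym p) (trans (Pb (a x)) eq)) λ ()
        run-walk Pb (suc n) (suc k) x (s≤s lt) p | false = go eq (run-walk Pb n k (b (a x)) lt p)

      -- After one period the iteration is back at `x`, where `P` holds. As `P` is invariant under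
      -- `b`, the walk has stopped before that, within the `4 * m` steps granted.
      walk-run : (∀ z → P (b z) ≡ P z) → ∀ {x} → P x ≡ true → Walk x (run (4 * m) x)
      walk-run Pb {x} px with period x
      ... | d , le , e = run-walk Pb d (4 * m) x le (trans (cong P e) px)

  -- a (b a)ⁿ is conjugate to a or to b, so it has no fixed point either.
  private
    alt : (X → X) → (X → X) → ℕ → X → X
    alt a b zero x = a x
    alt a b (suc n) x = alt a b n (b (a x))

    alt-swap : ∀ a b n x → alt a b (suc n) x ≡ a (alt b a n (a x))
    alt-swap a b zero x = refl
    alt-swap a b (suc n) x = alt-swap a b n (b (a x))

    alt-fpf : ∀ (a b : X → X) n → (∀ x → a (a x) ≡ x) → (∀ x → b (b x) ≡ x) → (∀ x → a x ≢ x) → (∀ x → b x ≢ x) → ∀ x → alt a b n x ≢ x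
    alt-fpf a b zero ai bi af bf x = af x
    alt-fpf a b (suc n) ai bi af bf x e = alt-fpf b a n bi ai bf af (a x)
      (trans (sym (ai _)) (cong a (trans (sym (alt-swap a b n x)) e)))

  walk-fpf : ∀ {a b : X → X} {P : X → Bool} → (∀ x → a (a x) ≡ x) → (∀ x → b (b x) ≡ x) → (∀ x → a x ≢ x) → (∀ x → b x ≢ x) →
    ∀ {x y} → Walks.Walk a b P x y → y ≢ x
  walk-fpf {a} {b} {P} ai bi af bf {x} w e = let n , p = len w in alt-fpf a b n ai bi af bf x (trans (sym p) e)
    where
    len : ∀ {x y} → Walks.Walk a b P x y → ∃ λ n → y ≡ alt a b n x
    len (Walks.stop p) = 0 , refl
    len (Walks.go p w) = let n , e = len w in suc n , e

  -- A cycle of two matchings stays connected when one edge is removed.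
  cycle : ∀ {a b : X → X} → (∀ x → a (a x) ≡ x) → (∀ x → b (b x) ≡ x) → (∀ x → a x ≢ x) → (∀ x → b x ≢ x) →
    ∀ {R : X → X → Set} (Q : X → Set) → (∀ {x} → R x x) → (∀ {x y z} → R x y → R y z → R x z) → ∀ x →
    (∀ z → Q z → R z (a z) × Q (a z)) → (∀ z → z ≢ x → z ≢ b x → Q z → R z (b z) × Q (b z)) →
    Q x → R x (b x)
  cycle {a} {b} ai bi af bf {R} Q r t x ga gb q = subst (R x) end (proj₁ (walk-⊆ Q r t ga gb′ w q))
    where
    ends : X → Bool
    ends z = does (z ≟F x) ∨ does (z ≟F b x)
    ends-b : ∀ z → ends (b z) ≡ ends z
    ends-b z with z ≟F x | z ≟F b x | b z ≟F x | b z ≟F b x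
    ... | yes _ | _ | yes _ | _ = refl
    ... | yes _ | _ | no _ | yes _ = refl
    ... | yes refl | _ | no _ | no n = contradiction refl n
    ... | no _ | yes _ | yes _ | _ = refl
    ... | no _ | yes refl | no n | _ = contradiction (bi x) n
    ... | no _ | no n | yes refl | _ = contradiction (sym (bi z)) n
    ... | no n | no _ | no _ | yes e = contradiction (trans (sym (bi z)) (trans (cong b e) (bi x))) n
    ... | no _ | no _ | no _ | no _ = refl
    open Walks a b ends
    ends-x : ends x ≡ true
    ends-x with x ≟F x
    ... | yes _ = refl
    ... | no n = contradiction refl n
    w : Walk x (run (4 * m) x)
    w = walk-run ai bi ends-b ends-x
    -- The walk stops at an end of the removed `b`-edge. It begins and ends with an `a`-step, so it
    -- cannot return to its own start.
    end : run (4 * m) x ≡ b x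
    end with run (4 * m) x ≟F x | run (4 * m) x ≟F b x | walk-end w
    ... | yes e | _ | _ = contradiction e (walk-fpf ai bi af bf w)
    ... | no _ | yes e | _ = e
    ... | no _ | no _ | ()
    gb′ : ∀ z → ends z ≡ false → Q z → R z (b z) × Q (b z)
    gb′ z p with z ≟F x | z ≟F b x
    gb′ z () | yes _ | _
    gb′ z () | no _ | yes _
    ... | no n | no k = gb z n k

-- Restriction of a matching to a ribbon subgraph

module _ {m : ℕ} where

  private
    X = Flag m
    ES = Fin m → Bool

  module _ (s : Matching m) (B : ES) where

    open Walks (s ⟨_⟩) σ2 (λ x → B (edge x)) public using () renaming (Walk to SubWalk)
    private module W = Walks (s ⟨_⟩) σ2 (λ x → B (edge x))

    private
      skip-run : ∀ k x → skip (s ⟨_⟩) B k x ≡ W.run k x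
      skip-run zero x = refl
      skip-run (suc k) x = cong (λ z → if B (edge (s ⟨ x ⟩)) then s ⟨ x ⟩ else z) (skip-run k _)

    subwalk : ∀ {x} → B ∋ x → SubWalk x (σ1↾ (s ⟨_⟩) B x)
    subwalk {x} p = subst (SubWalk x) (sym (skip-run (4 * m) x)) (W.walk-run (invol s) σ2-invol (λ _ → refl) p)

    private
      abstract
        restr-fn : X → X
        restr-fn x = if B (edge x) then σ1↾ (s ⟨_⟩) B x else σ2 x

        fn-∋ : ∀ {x} → B ∋ x → restr-fn x ≡ σ1↾ (s ⟨_⟩) B x
        fn-∋ p rewrite p = refl

        fn-∌ : ∀ {x} → B (edge x) ≡ false → restr-fn x ≡ σ2 x
        fn-∌ p rewrite p = refl

      fn-walk : ∀ {x} → B ∋ x → SubWalk x (restr-fn x)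
      fn-walk {x} p = subst (SubWalk x) (sym (fn-∋ p)) (subwalk p)

      abstract
        fn-invol : ∀ x → restr-fn (restr-fn x) ≡ x
        fn-invol x with B (edge x) Bool.≟ true
        ... | yes p = W.walk-unique (fn-walk (W.walk-end (fn-walk p))) (W.walk-reverse (invol s) σ2-invol (λ _ → refl) p (fn-walk p))
        ... | no n = trans (cong restr-fn (fn-∌ (≢true⇒false n))) (trans (fn-∌ (≢true⇒false n)) (σ2-invol x))

        fn-fpf : ∀ x → restr-fn x ≢ x
        fn-fpf x with B (edge x) Bool.≟ true
        ... | yes p = walk-fpf (invol s) σ2-invol (fpf s) σ2-fpf (fn-walk p)
        ... | no n = λ e → σ2-fpf x (trans (sym (fn-∌ (≢true⇒false n))) e)

    -- The edges outside B become isolated edges.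
    restr : Matching m
    restr = record { fn = restr-fn ; invol = fn-invol ; fpf = fn-fpf }

    restr-walk : ∀ {x} → B ∋ x → SubWalk x (restr ⟨ x ⟩)
    restr-walk = fn-walk

    restr-on : ∀ {x} → B ∋ x → restr ⟨ x ⟩ ≡ σ1↾ (s ⟨_⟩) B x
    restr-on = fn-∋

    restr-∋ : ∀ {x} → B ∋ x → B ∋ restr ⟨ x ⟩
    restr-∋ p = W.walk-end (restr-walk p)

    restr-unique : ∀ {x y} → B ∋ x → SubWalk x y → restr ⟨ x ⟩ ≡ y
    restr-unique p = W.walk-unique (restr-walk p)

    restr-id : ∀ {x} → B ∋ x → B ∋ s ⟨ x ⟩ → restr ⟨ x ⟩ ≡ s ⟨ x ⟩
    restr-id p q = restr-unique p (Walks.stop q)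

    restr-∌ : ∀ {x} → B (edge x) ≡ false → restr ⟨ x ⟩ ≡ σ2 x
    restr-∌ = fn-∌

    -- The partner of `q₁` exits too: otherwise `restr` would pair it with its neighbour under `s`,
    -- that neighbour would be `q₁`, and `s ⟨ q₁ ⟩` would lie in `B`. Being different from `q₁`, the
    -- partner is `q₂`.
    restr-exit : ∀ {q₁ q₂} → B ∋ q₁ → B (edge (s ⟨ q₁ ⟩)) ≡ false →
      (∀ {x} → B ∋ x → B (edge (s ⟨ x ⟩)) ≡ false → x ≡ q₁ ⊎ x ≡ q₂) → restr ⟨ q₁ ⟩ ≡ q₂
    restr-exit {q₁} {q₂} p out only with B (edge (s ⟨ restr ⟨ q₁ ⟩ ⟩)) in eq
    ... | true = contradiction (trans (sym (restr-∋ p)) (trans (cong (B ∘ edge)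
      (trans (sym (invol s _)) (cong (s ⟨_⟩) (trans (sym (restr-id (restr-∋ p) eq)) (invol restr q₁))))) out)) λ ()
    ... | false with only (restr-∋ p) eq
    ... | inj₁ e = contradiction e (fpf restr q₁)
    ... | inj₂ e = e

    restr-exits : ∀ {q} → B ∋ q → B (edge (s ⟨ q ⟩)) ≡ false → B (edge (s ⟨ restr ⟨ q ⟩ ⟩)) ≡ false
    restr-exits {q} p out with B (edge (s ⟨ restr ⟨ q ⟩ ⟩)) in eq
    ... | false = refl
    ... | true = contradiction (trans (sym (restr-∋ p)) (trans (cong (B ∘ edge)
      (trans (sym (invol s _)) (cong (s ⟨_⟩) (trans (sym (restr-id (restr-∋ p) eq)) (invol restr q))))) out)) λ ()

    private
      data Partial (w : X) : X → Set where
        base : B (edge (s ⟨ w ⟩)) ≡ false → Partial w (s ⟨ w ⟩)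
        next : ∀ {z} → Partial w z → B (edge (s ⟨ σ2 z ⟩)) ≡ false → Partial w (s ⟨ σ2 z ⟩)

      complete : ∀ {w z y} → Partial w z → SubWalk (σ2 z) y → SubWalk w y
      complete (base p) v = Walks.go p v
      complete (next q p) v = complete q (Walks.go p v)

    -- For flags in B, the σ2-moves on edges outside B do what the restriction of s does.
    module _ {S₀ S₂ S₀′ S₂′ : ES} (on₀ : ∀ e → B e ≡ true → S₀ e ≡ S₀′ e) (on₂ : ∀ e → B e ≡ true → S₂ e ≡ S₂′ e)
      (off₀ : ∀ e → B e ≡ false → S₀′ e ≡ false) (off₂ : ∀ e → B e ≡ false → S₂′ e ≡ true) where

      restr-span : ∀ {x y} → B ∋ x → Conn restr S₀ S₂ x y → B ∋ y × Conn s S₀′ S₂′ x y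
      restr-span p c = conn-⊆ {R = λ x y → B ∋ x → B ∋ y × Conn s S₀′ S₂′ x y} (λ p → p , ε)
        (λ f g p → let q , c = f p ; r , d = g q in r , c ◅◅ d)
        (λ x p → restr-∋ p , via p)
        (λ x q p → p , conn-0 x (trans (sym (on₀ _ p)) q))
        (λ x q p → p , conn-2 x (trans (sym (on₂ _ p)) q)) c p
        where
        via : ∀ {x} → B ∋ x → Conn s S₀′ S₂′ x (restr ⟨ x ⟩)
        via p = proj₁ (W.walk-⊆ (λ _ → ⊤) ε _◅◅_ (λ x _ → conn-s x , tt)
          (λ x q _ → conn-2 x (off₂ _ q) , tt) (restr-walk p) tt)

      span-restr : ∀ {x y} → B ∋ x → B ∋ y → Conn s S₀′ S₂′ x y → Conn restr S₀ S₂ x y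
      span-restr {x} {y} p q c = proj₁ (conn-closed Inv fs f0 f2 c ((λ _ → ε) , λ n → contradiction (trans (sym p) n) λ ())) q
        where
        -- In `B` the flag has been reached by `restr`. Outside `B` it lies on an unfinished walk
        -- from a flag of `B` already reached, and this walk has arrived at `z` or at `σ2 z`.
        Inv : X → Set
        Inv z = (B ∋ z → Conn restr S₀ S₂ x z)
          × (B (edge z) ≡ false → ∃ λ w → B ∋ w × Conn restr S₀ S₂ x w × (Partial w z ⊎ Partial w (σ2 z)))
        fs : ∀ z → Inv z → Inv (s ⟨ z ⟩)
        fs z (h , k) with B (edge z) in eq
        ... | true = (λ i → h refl ◅◅ subst (Conn restr S₀ S₂ z) (restr-id eq i) (conn-s z))
                   , (λ n → z , eq , h refl , inj₁ (base n))
        ... | false with k refl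
        ... | w , bw , d , inj₁ (base n) = (λ i → subst (Conn restr S₀ S₂ x) (sym (invol s w)) d)
                   , (λ i → contradiction (trans (sym bw) (trans (cong (B ∘ edge) (sym (invol s w))) i)) λ ())
        ... | w , bw , d , inj₁ (next {z′} v n) = (λ i → contradiction (trans (sym i) (trans (cong (B ∘ edge) (invol s _)) (partial-∌ v))) λ ())
                   , (λ i → w , bw , d , inj₂ (subst (Partial w) (sym (trans (cong σ2 (invol s (σ2 z′))) (σ2-invol z′))) v))
          where
          partial-∌ : ∀ {z} → Partial w z → B (edge z) ≡ false
          partial-∌ (base n) = n
          partial-∌ (next _ n) = n
        ... | w , bw , d , inj₂ v = (λ i → d ◅◅ subst (Conn restr S₀ S₂ w) (restr-unique bw (complete v (subst (λ u → SubWalk u (s ⟨ z ⟩)) (sym (σ2-invol z)) (Walks.stop i)))) (conn-s w))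
                   , (λ n → w , bw , d , inj₁ (subst (λ u → Partial w (s ⟨ u ⟩)) (σ2-invol z)
                        (next v (trans (cong (λ u → B (edge (s ⟨ u ⟩))) (σ2-invol z)) n))))
        f0 : ∀ z → S₀′ ∋ z → Inv z → Inv (σ0 z)
        f0 z t (h , k) = (λ i → h i ◅◅ conn-0 z (trans (on₀ _ i) t)) , (λ n → contradiction (trans (sym t) (off₀ _ n)) λ ())
        f2 : ∀ z → S₂′ ∋ z → Inv z → Inv (σ2 z)
        f2 z t (h , k) = (λ i → h i ◅◅ conn-2 z (trans (on₂ _ i) t))
          , (λ n → let w , bw , d , v = k n in w , bw , d , [ (λ v → inj₂ (subst (Partial w) (sym (σ2-invol z)) v)) , inj₁ ]′ v)

  restr-restr : ∀ (s : Matching m) B B′ → (∀ e → B′ e ≡ true → B e ≡ true) → ∀ x →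
    restr (restr s B) B′ ⟨ x ⟩ ≡ restr s B′ ⟨ x ⟩
  restr-restr s B B′ sub x with B′ (edge x) Bool.≟ true
  ... | no n = trans (restr-∌ (restr s B) B′ (≢true⇒false n)) (sym (restr-∌ s B′ (≢true⇒false n)))
  ... | yes p = sym (restr-unique s B′ p (expand (restr-walk (restr s B) B′ p) (sub _ p)))
    where
    prefix : ∀ {x z} → SubWalk s B x z → B′ ∋ z → SubWalk s B′ x z
    prefix (Walks.stop q) i = Walks.stop i
    prefix (Walks.go q w) i = Walks.go (≢true⇒false λ t → contradiction (trans (sym (sub _ t)) q) λ ()) (prefix w i)
    append : ∀ {x z y} → SubWalk s B x z → B′ (edge z) ≡ false → SubWalk s B′ (σ2 z) y → SubWalk s B′ x y
    append (Walks.stop q) i v = Walks.go i v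
    append (Walks.go q w) i v = Walks.go (≢true⇒false λ t → contradiction (trans (sym (sub _ t)) q) λ ()) (append w i v)
    expand : ∀ {x y} → SubWalk (restr s B) B′ x y → B ∋ x → SubWalk s B′ x y
    expand (Walks.stop q) i = prefix (restr-walk s B i) q
    expand (Walks.go q w) i = append (restr-walk s B i) q (expand w (restr-∋ s B i))

  restr-cong : ∀ (s : Matching m) {B B′} → (∀ e → B e ≡ B′ e) → ∀ x → restr s B ⟨ x ⟩ ≡ restr s B′ ⟨ x ⟩
  restr-cong s {B} {B′} h x with B (edge x) Bool.≟ true
  ... | no n = trans (restr-∌ s B (≢true⇒false n)) (sym (restr-∌ s B′ (trans (sym (h _)) (≢true⇒false n))))
  ... | yes p = restr-unique s B p (copy (restr-walk s B′ (trans (sym (h _)) p)))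
    where
    copy : ∀ {x y} → SubWalk s B′ x y → SubWalk s B x y
    copy (Walks.stop i) = Walks.stop (trans (h _) i)
    copy (Walks.go i w) = Walks.go (trans (h _) i) (copy w)

-- Euler's inequality

module _ {m : ℕ} where

  private
    X = Flag m
    ES = Fin m → Bool

  #E : ES → ℕ
  #E B = countB B (allFin m)

  σ0-on-edge : ∀ {R : X → X → Set} → IsEquivalence R → ∀ {e} → R (e , false , false) (e , true , false) →
    (∀ a b → R (e , a , b) (e , a , not b)) → ∀ a b → R (e , a , b) (e , not a , b)
  σ0-on-edge eq {e} r h = λ
    { false false → r ; true false → E.sym r ; false true → r′ ; true true → E.sym r′ }
    where
    module E = IsEquivalence eq
    r′ = E.trans (h false true) (E.trans r (h true false))

  σ2-on-edge : ∀ {R : X → X → Set} → IsEquivalence R → ∀ {e} → R (e , false , false) (e , false , true) →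
    (∀ a b → R (e , a , b) (e , not a , b)) → ∀ a b → R (e , a , b) (e , a , not b)
  σ2-on-edge eq {e} r h = λ
    { false false → r ; false true → E.sym r ; true false → r′ ; true true → E.sym r′ }
    where
    module E = IsEquivalence eq
    r′ = E.trans (h true false) (E.trans r (h false true))

  private
    mem : List (Fin m) → ES
    mem [] e = false
    mem (e₀ ∷ es) e = does (e Fin.≟ e₀) ∨ mem es e

    mem⁺ : ∀ {es e} → e ∈ es → mem es e ≡ true
    mem⁺ {e₀ ∷ es} {e} i with e Fin.≟ e₀
    ... | yes _ = refl
    mem⁺ (here p) | no n = contradiction p n
    mem⁺ (there i) | no n = mem⁺ i

    mem⁻ : ∀ {es e} → mem es e ≡ true → e ∈ es
    mem⁻ {e₀ ∷ es} {e} p with e Fin.≟ e₀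
    ... | yes q = here q
    ... | no n = there (mem⁻ p)

  module _ (s : Matching m) (B : ES) where

    private
      -- `V` counts the components of the spanning subgraph with edges `es`. `K` leads from the
      -- components of the spanning subgraph with edges `B`, for `es` empty, to its boundary
      -- components, for `es` all of `B`.
      V K : List (Fin m) → ℕ
      V es = cnt s (mem es) full
      K es = cnt s B (∁ (mem es))

      -- Growing a ribbon subgraph by the edge e either merges two components of the
      -- graph or splits a component of the complementary dual graph, but not both.
      grow-edge : ∀ e es → (∀ e′ → mem (e ∷ es) e′ ≡ true → B e′ ≡ true) → mem es e ≡ false →
        V es + K (e ∷ es) ≤ suc (V (e ∷ es) + K es)
      grow-edge e es sub new with conn? {s = s} {mem es} {full} (e , false , false) (e , true , false)
      ... | yes c = ℕ.≤-trans (ℕ.+-mono-≤ (cnt-≤ VV) (cnt-plus x (σ2 x) KK)) (ℕ.≤-reflexive (ℕ.+-suc _ _))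
        where
        x : X
        x = e , false , false
        VV : ∀ {a b} → Conn s (mem (e ∷ es)) full a b → Conn s (mem es) full a b
        VV = conn-⊆ ε _◅◅_ conn-s via0 conn-2
          where
          via0 : ∀ z → mem (e ∷ es) ∋ z → Conn s (mem es) full z (σ0 z)
          via0 (e′ , a , b) p with e′ Fin.≟ e
          ... | yes refl = σ0-on-edge conn-equivalence c (λ a b → conn-2 _ refl) a b
          ... | no _ = conn-0 _ p
        KK : ∀ {a b} → Conn s B (∁ (mem es)) a b → Plus (Conn s B (∁ (mem (e ∷ es)))) x (σ2 x) a b
        KK = conn-⊆ P.refl P.trans (λ z → inj₁ (conn-s z)) (λ z p → inj₁ (conn-0 z p)) via2
          where
          module P = IsEquivalence (plus-equivalence (conn-equivalence {s = s} {B} {∁ (mem (e ∷ es))}) x (σ2 x))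
          via2 : ∀ z → ∁ (mem es) ∋ z → Plus (Conn s B (∁ (mem (e ∷ es)))) x (σ2 x) z (σ2 z)
          via2 (e′ , a , b) p with e′ Fin.≟ e in eq
          ... | yes refl = σ2-on-edge (plus-equivalence conn-equivalence x (σ2 x)) (inj₂ (inj₁ (ε , ε)))
                  (λ a b → inj₁ (conn-0 _ (sub e (cong (λ d → does d ∨ mem es e) eq)))) a b
          ... | no _ = inj₁ (conn-2 _ (trans (cong (λ d → not (does d ∨ mem es e′)) eq) p))
      ... | no ¬c = ℕ.+-mono-≤ (cnt-plus x (σ0 x) VV) (cnt-≤ KK)
        where
        x : X
        x = e , false , false
        VV : ∀ {a b} → Conn s (mem (e ∷ es)) full a b → Plus (Conn s (mem es) full) x (σ0 x) a b
        VV = conn-⊆ P.refl P.trans (λ z → inj₁ (conn-s z)) via0 (λ z p → inj₁ (conn-2 z p))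
          where
          module P = IsEquivalence (plus-equivalence (conn-equivalence {s = s} {mem es} {full}) x (σ0 x))
          via0 : ∀ z → mem (e ∷ es) ∋ z → Plus (Conn s (mem es) full) x (σ0 x) z (σ0 z)
          via0 (e′ , a , b) p with e′ Fin.≟ e
          ... | yes refl = σ0-on-edge (plus-equivalence conn-equivalence x (σ0 x)) (inj₂ (inj₁ (ε , ε)))
                  (λ a b → inj₁ (conn-2 _ refl)) a b
          ... | no _ = inj₁ (conn-0 _ p)
        -- The boundary component of the spanning subgraph `es` through `x` stays in the component
        -- of `x`, which misses the other end of `e`. So it passes `e` only from `x` to `σ2 x`, and
        -- the rest of this cycle still connects the two when `σ2` is dropped on `e`.
        τ : X → X
        τ z = if mem es (edge z) then σ0 z else σ2 z
        τ-invol : ∀ z → τ (τ z) ≡ z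
        τ-invol z with mem es (edge z) in p
        ... | true rewrite p = σ0-invol z
        ... | false rewrite p = σ2-invol z
        τ-fpf : ∀ z → τ z ≢ z
        τ-fpf z with mem es (edge z)
        ... | true = σ0-fpf z
        ... | false = σ2-fpf z
        τx : τ x ≡ σ2 x
        τx rewrite new = refl
        other : ∀ z → edge z ≡ e → z ≢ x → z ≢ τ x → Conn s (mem es) full x z → ⊥
        other (.e , false , false) refl n k c = n refl
        other (.e , false , true) refl n k c = k (sym τx)
        other (.e , true , false) refl n k c = ¬c c
        other (.e , true , true) refl n k c = ¬c (c ◅◅ conn-2 _ refl)
        along : ∀ z → z ≢ x → z ≢ τ x → Conn s (mem es) full x z →
          Conn s B (∁ (mem (e ∷ es))) z (τ z) × Conn s (mem es) full x (τ z)
        along z n k c with mem es (edge z) in p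
        ... | true = conn-0 z (sub _ (mem⁺ {e ∷ es} (there (mem⁻ p)))) , c ◅◅ conn-0 z p
        ... | false with edge z Fin.≟ e in q
        ... | yes r = ⊥-elim (other z r n k c)
        ... | no _ = conn-2 z (cong not (trans (cong (λ d → does d ∨ mem es (edge z)) q) p)) , c ◅◅ conn-2 z refl
        redundant : Conn s B (∁ (mem (e ∷ es))) x (σ2 x)
        redundant = subst (Conn s B (∁ (mem (e ∷ es))) x) τx (cycle (invol s) τ-invol (fpf s) τ-fpf
          (Conn s (mem es) full x) ε _◅◅_ x (λ z c → conn-s z , c ◅◅ conn-s z) along ε)
        KK : ∀ {a b} → Conn s B (∁ (mem es)) a b → Conn s B (∁ (mem (e ∷ es))) a b
        KK = conn-⊆ ε _◅◅_ conn-s conn-0 via2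
          where
          via2 : ∀ z → ∁ (mem es) ∋ z → Conn s B (∁ (mem (e ∷ es))) z (σ2 z)
          via2 (e′ , a , b) p with e′ Fin.≟ e in eq
          ... | yes refl = σ2-on-edge conn-equivalence redundant
                  (λ a b → conn-0 _ (sub e (cong (λ d → does d ∨ mem es e) eq))) a b
          ... | no _ = conn-2 _ (trans (cong (λ d → not (does d ∨ mem es e′)) eq) p)

      grow-edges : ∀ es → Unique es → (∀ e → mem es e ≡ true → B e ≡ true) →
        V [] + K es ≤ V es + K [] + length es
      grow-edges [] u sub = ℕ.m≤m+n _ 0
      grow-edges (e ∷ es) (n ∷ u) sub = ℕ.+-cancelʳ-≤ (V es) _ _ (begin
        V [] + K (e ∷ es) + V es ≡⟨ reorder (V []) (K (e ∷ es)) (V es) ⟩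
        V [] + (V es + K (e ∷ es)) ≤⟨ ℕ.+-monoʳ-≤ (V []) (grow-edge e es sub (≢true⇒false λ p → All.lookup n (mem⁻ p) refl)) ⟩
        V [] + suc (V (e ∷ es) + K es) ≡⟨ reorder₂ (V []) (V (e ∷ es)) (K es) ⟩
        (V [] + K es) + suc (V (e ∷ es)) ≤⟨ ℕ.+-monoˡ-≤ _ (grow-edges es u (λ e p → sub e (mem⁺ {_ ∷ es} (there (mem⁻ p))))) ⟩
        (V es + K [] + length es) + suc (V (e ∷ es)) ≡⟨ reorder₃ (V es) (K []) (length es) (V (e ∷ es)) ⟩
        V (e ∷ es) + K [] + suc (length es) + V es ∎)
        where
        open ℕ.≤-Reasoning
        reorder : ∀ a b c → a + b + c ≡ a + (c + b)
        reorder = solve-∀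
        reorder₂ : ∀ a b c → a + suc (b + c) ≡ (a + c) + suc b
        reorder₂ = solve-∀
        reorder₃ : ∀ a b c d → (a + b + c) + suc d ≡ d + b + suc c + a
        reorder₃ = solve-∀

    -- Euler's inequality for the spanning subgraph with edges `B`: summing `grow-edge` over `B`
    -- takes `K` from components to boundary components. The complement is a separate argument
    -- because `A` is the complement of `∁ A` only up to a double negation.
    genus-≥0 : ∀ B′ → (∀ e → B′ e ≡ not (B e)) → cnt s none full + cnt s B B′ ≤ 2 * cnt s B full + #E B
    genus-≥0 B′ comp = ℕ.≤-trans (ℕ.+-monoʳ-≤ (V []) (cnt-≤ (conn-mono (λ _ → id) λ e p → trans (comp e) (trans (cong not (sym (es-B e))) p))))
      (ℕ.≤-trans (grow-edges es (Unique.filter⁺ _ (Unique.allFin⁺ m)) (λ e p → trans (sym (es-B e)) p)) (ℕ.≤-reflexive (begin-equality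
        V es + K [] + length es ≡⟨ cong₂ (λ a b → a + K [] + b) (cnt-≡ (conn-mono (λ e p → trans (sym (es-B e)) p) λ _ → id) (conn-mono (λ e p → trans (es-B e) p) λ _ → id)) (sym (countB-filter B (allFin m))) ⟩
        cnt s B full + cnt s B full + #E B ≡⟨ cong (λ z → cnt s B full + z + #E B) (sym (ℕ.+-identityʳ _)) ⟩
        2 * cnt s B full + #E B ∎)))
      where
      open ℕ.≤-Reasoning
      es : List (Fin m)
      es = filterᵇ B (allFin m)
      es-B : ∀ e → mem es e ≡ B e
      es-B e with B e in p
      ... | true = mem⁺ (Mem.∈-filter⁺ _ (Mem.∈-allFin e) (≡⇒T p))
      ... | false = ≢true⇒false λ q → contradiction (trans (sym (T⇒≡ (proj₂ (Mem.∈-filter⁻ _ {xs = allFin m} (mem⁻ {es} q))))) p) λ ()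

-- Counts of ribbon subgraphs

module _ {m : ℕ} where

  private
    X = Flag m
    ES = Fin m → Bool

  conn-agree : ∀ {v w : Matching m} (B : ES) → (∀ {x} → B ∋ x → v ⟨ x ⟩ ≡ w ⟨ x ⟩) → (∀ {x} → B ∋ x → B ∋ v ⟨ x ⟩) →
    ∀ {S₀ S₂ S₀′ S₂′ : ES} → (∀ e → B e ≡ true → S₀ e ≡ true → S₀′ e ≡ true) → (∀ e → B e ≡ true → S₂ e ≡ true → S₂′ e ≡ true) →
    ∀ {x y} → B ∋ x → Conn v S₀ S₂ x y → B ∋ y × Conn w S₀′ S₂′ x y
  conn-agree {v} {w} B vw cl {S₀′ = S₀′} {S₂′} h₀ h₂ bx c = conn-⊆ {R = λ x y → B ∋ x → B ∋ y × Conn w S₀′ S₂′ x y}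
    (λ b → b , ε) (λ f g b → let b₁ , c₁ = f b ; b₂ , c₂ = g b₁ in b₂ , c₁ ◅◅ c₂)
    (λ x b → cl {x} b , subst (Conn w S₀′ S₂′ x) (sym (vw {x} b)) (conn-s x))
    (λ x i b → b , conn-0 x (h₀ _ b i)) (λ x i b → b , conn-2 x (h₂ _ b i)) c bx

  abstract
    -- The count on the subgraph alone; `cnt` of the restricted matching would include the isolated
    -- edges outside `B`.
    nn : Matching m → ES → ES → ES → ℕ
    nn s B S₀ S₂ = proj₁ (count-exists (conn-equivalence {s = restr s B} {S₀} {S₂}) conn? flags ∈-flags (λ x → B (edge x) Bool.≟ true))

    nn-count : ∀ s B S₀ S₂ → Count (Conn (restr s B) S₀ S₂) (B ∋_) (nn s B S₀ S₂)
    nn-count s B S₀ S₂ = proj₂ (count-exists (conn-equivalence {s = restr s B} {S₀} {S₂}) conn? flags ∈-flags (λ x → B (edge x) Bool.≟ true))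

  nn-unique : ∀ {s w : Matching m} {B S₀ S₂ n} → (∀ {x} → B ∋ x → restr s B ⟨ x ⟩ ≡ w ⟨ x ⟩) →
    Count (Conn w S₀ S₂) (B ∋_) n → n ≡ nn s B S₀ S₂
  nn-unique {s} {w} {B} {S₀} {S₂} e c = count-≡ conn-equivalence conn-equivalence id id
    (λ bx _ d → proj₂ (conn-agree B (λ {x} b → sym (e {x} b)) (λ {x} b → subst (λ z → B ∋ z) (e {x} b) (restr-∋ s B b)) (λ _ _ → id) (λ _ _ → id) bx d))
    (λ bx _ d → proj₂ (conn-agree B (λ {x} → e {x}) (λ {x} b → restr-∋ s B b) (λ _ _ → id) (λ _ _ → id) bx d)) c (nn-count s B S₀ S₂)

  nn-agree : ∀ {s : Matching m} {B S₀ S₂ S₀′ S₂′} → (∀ e → B e ≡ true → S₀ e ≡ S₀′ e) → (∀ e → B e ≡ true → S₂ e ≡ S₂′ e) →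
    nn s B S₀ S₂ ≡ nn s B S₀′ S₂′
  nn-agree {s} {B} h₀ h₂ = count-≡ conn-equivalence conn-equivalence id id
    (λ bx _ d → proj₂ (conn-agree B (λ _ → refl) (λ {x} → restr-∋ s B {x}) (λ e b p → trans (sym (h₀ e b)) p) (λ e b p → trans (sym (h₂ e b)) p) bx d))
    (λ bx _ d → proj₂ (conn-agree B (λ _ → refl) (λ {x} → restr-∋ s B {x}) (λ e b p → trans (h₀ e b) p) (λ e b p → trans (h₂ e b) p) bx d))
    (nn-count _ _ _ _) (nn-count _ _ _ _)

  nn-cong : ∀ {s : Matching m} {B B′ S₀ S₂} → (∀ e → B e ≡ B′ e) → nn s B S₀ S₂ ≡ nn s B′ S₀ S₂
  nn-cong {s} {B} {B′} {S₀} {S₂} h = nn-unique {s} {restr s B} {B′} (λ {x} _ → sym (restr-cong s h x))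
    (record { Count c ; inP = All.map (λ p → trans (sym (h _)) p) (Count.inP c) ; cover = λ p → Count.cover c (trans (h _) p) })
    where c = nn-count s B S₀ S₂

  nn-full : ∀ s S₀ S₂ → nn s full S₀ S₂ ≡ cnt s S₀ S₂
  nn-full s S₀ S₂ = sym (nn-unique {s} {s} {full} (λ _ → restr-id s full refl refl)
    (record { Count c ; inP = All.map (λ _ → refl) (Count.inP c) ; cover = λ _ → Count.cover c tt }))
    where c = cnt-count s S₀ S₂

  module _ (s : Matching m) (B : ES) where

    private
      Vertex : X → X → Set
      Vertex = Conn s none full

    Meets : X → Set
    Meets x = ∃ λ y → B ∋ y × Vertex x y

    meets? : ∀ x → Dec (Meets x)
    meets? x = some? (λ y → (B (edge y) Bool.≟ true) ×-dec conn? x y)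

    bare : ∃ λ n → Count Vertex (λ x → ¬ Meets x) n
    bare = count-exists conn-equivalence conn? flags ∈-flags (λ x → ¬? (meets? x))

    module _ {S₀ S₂ S₀′ S₂′ : ES} (on₀ : ∀ e → B e ≡ true → S₀ e ≡ S₀′ e) (on₂ : ∀ e → B e ≡ true → S₂ e ≡ S₂′ e)
      (off₀ : ∀ e → B e ≡ false → S₀′ e ≡ false) (off₂ : ∀ e → B e ≡ false → S₂′ e ≡ true) where

      span-count : Count (Conn s S₀′ S₂′) (B ∋_) (nn s B S₀ S₂)
      span-count = record { Count c ; indep = indep′ (Count.inP c) (Count.indep c)
                    ; cover = λ {x} p → Any.map (λ d → proj₂ (restr-span s B on₀ on₂ off₀ off₂ p d)) (Count.cover c p) }
        where
        c = nn-count s B S₀ S₂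
        indep′ : ∀ {L} → All (B ∋_) L → AllPairs (λ a b → ¬ Conn (restr s B) S₀ S₂ a b) L → AllPairs (λ a b → ¬ Conn s S₀′ S₂′ a b) L
        indep′ [] [] = []
        indep′ (p ∷ ps) (i ∷ is) = All.zipWith (λ { (q , n) d → n (span-restr s B on₀ on₂ off₀ off₂ p q d) }) (ps , i) ∷ indep′ ps is

      -- The vertices without edges in B count the same in all these relations.
      spanning : cnt s S₀′ S₂′ ≡ nn s B S₀ S₂ + proj₁ bare
      spanning = count-≡ conn-equivalence conn-equivalence id id (λ _ _ → id) (λ _ _ → id) (cnt-count s S₀′ S₂′)
        (count-++ conn-equivalence _ _ cover (λ {x} {y} p n d → n (x , p , lonely n (conn-sym d))) span-count off-B)
        where
        lonely : ∀ {x y} → ¬ Meets x → Conn s S₀′ S₂′ x y → Vertex x y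
        lonely {x} n d = conn-closed (Vertex x) (λ z v → v ◅◅ conn-s z) at-0 (λ z _ v → v ◅◅ conn-2 z refl) d ε
          where
          at-0 : ∀ z → S₀′ ∋ z → Vertex x z → Vertex x (σ0 z)
          at-0 z i v with B (edge z) in b
          ... | true = ⊥-elim (n (z , b , v))
          ... | false = ⊥-elim (true≢false i (off₀ _ b))
        off-B : Count (Conn s S₀′ S₂′) (λ x → ¬ Meets x) (proj₁ bare)
        off-B = record { Count c ; indep = indep′ (Count.inP c) (Count.indep c)
                       ; cover = λ {x} n → Any.map (λ v → back n v) (Count.cover c n) }
          where
          c = proj₂ bare
          back : ∀ {x y} → ¬ Meets x → Vertex x y → Conn s S₀′ S₂′ x y
          back {x} n v = proj₂ (conn-closed (λ z → Vertex x z × Conn s S₀′ S₂′ x z) (λ z (w , d) → w ◅◅ conn-s z , d ◅◅ conn-s z) (λ z ())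
            (λ z _ (w , d) → w ◅◅ conn-2 z refl , d ◅◅ conn-2 z (off₂ _ (≢true⇒false λ b → n (z , b , w)))) v (ε , ε))
          indep′ : ∀ {L} → All (λ x → ¬ Meets x) L → AllPairs (λ a b → ¬ Vertex a b) L → AllPairs (λ a b → ¬ Conn s S₀′ S₂′ a b) L
          indep′ [] [] = []
          indep′ (p ∷ ps) (i ∷ is) = All.map (λ n d → n (lonely p d)) i ∷ indep′ ps is
        cover : ∀ {x} → ⊤ → (∃ λ y → B ∋ y × Conn s S₀′ S₂′ x y) ⊎ (∃ λ y → ¬ Meets y × Conn s S₀′ S₂′ x y)
        cover {x} _ with meets? x
        ... | no n = inj₂ (x , n , ε)
        ... | yes (y , b , v) with conn-closed Inv via-s (λ z ()) via-2 v (inj₂ ε)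
          where
          Inv : X → Set
          Inv z = (∃ λ y → B ∋ y × Conn s S₀′ S₂′ x y) ⊎ Conn s S₀′ S₂′ x z
          via-s : ∀ z → Inv z → Inv (s ⟨ z ⟩)
          via-s z (inj₁ h) = inj₁ h
          via-s z (inj₂ d) = inj₂ (d ◅◅ conn-s z)
          via-2 : ∀ z → full ∋ z → Inv z → Inv (σ2 z)
          via-2 z _ (inj₁ h) = inj₁ h
          via-2 z _ (inj₂ d) with B (edge z) Bool.≟ true
          ... | yes b = inj₁ (z , b , d)
          ... | no n = inj₂ (d ◅◅ conn-2 z (off₂ _ (≢true⇒false n)))
        ... | inj₁ h = inj₁ h
        ... | inj₂ d = inj₁ (y , b , d)

    -- A vertex without edges in `B` counts once as a vertex, once as a boundary component and once
    -- as a component of the spanning subgraph, so removing it takes 2 from both sides of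
    -- `genus-≥0`.
    sub-genus-≥0 : nn s B none full + nn s B full none ≤ 2 * nn s B full full + #E B
    sub-genus-≥0 = ℕ.+-cancelʳ-≤ (proj₁ bare + proj₁ bare) _ _ (subst₂ _≤_
        (trans (cong₂ _+_ (spanning (λ _ _ → refl) (λ _ _ → refl) (λ _ _ → refl) (λ _ _ → refl))
                          (spanning (λ _ b → sym b) (λ _ b → cong not (sym b)) (λ _ b → b) (λ _ b → cong not b)))
               (e₁ (nn s B none full) (nn s B full none) (proj₁ bare)))
        (trans (cong (λ z → 2 * z + #E B) (spanning {full} {full} (λ _ b → sym b) (λ _ _ → refl) (λ _ b → b) (λ _ _ → refl)))
               (e₂ (nn s B full full) (#E B) (proj₁ bare)))
        (genus-≥0 s B (∁ B) (λ _ → refl)))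
      where
      e₁ : ∀ a b i → (a + i) + (b + i) ≡ a + b + (i + i)
      e₁ = solve-∀
      e₂ : ∀ k n i → 2 * (k + i) + n ≡ 2 * k + n + (i + i)
      e₂ = solve-∀

    orbitCount-nn : ∀ hs {S₀ S₂} → All (λ h → ∀ x → B ∋ x → B ∋ h x × Conn (restr s B) S₀ S₂ x (h x)) hs →
      (∀ x → B ∋ x → Orb hs x (σ1↾ (s ⟨_⟩) B x)) → (∀ x → S₀ ∋ x → Orb hs x (σ0 x)) → (∀ x → S₂ ∋ x → Orb hs x (σ2 x)) →
      orbitCount hs B ≡ nn s B S₀ S₂
    orbitCount-nn hs {S₀} {S₂} sound hs-s hs-0 hs-2 = nn-unique {s} {restr s B} {B} (λ _ → refl) (orbitCount-count hs B conn-equivalence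
      (λ {x} {y} bx _ o → proj₂ (orb-⊆ {R = λ x y → B ∋ x → B ∋ y × Conn (restr s B) S₀ S₂ x y} (λ b → b , ε)
        (λ f g b → let b₁ , c₁ = f b ; b₂ , c₂ = g b₁ in b₂ , c₁ ◅◅ c₂) sound o bx))
      (λ {x} {y} bx _ c → proj₂ (conn-⊆ {R = λ x y → B ∋ x → B ∋ y × Orb hs x y} (λ b → b , ε)
        (λ f g b → let b₁ , c₁ = f b ; b₂ , c₂ = g b₁ in b₂ , orb-trans c₁ c₂)
        (λ x b → restr-∋ s B b , subst (Orb hs x) (sym (restr-on s B b)) (hs-s x b))
        (λ x i b → b , hs-0 x i) (λ x i b → b , hs-2 x i) c bx)))
      where
      orb-trans : ∀ {x y z} → Orb hs x y → Orb hs y z → Orb hs x z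
      orb-trans ε q = q
      orb-trans (g ◅ p) q = g ◅ orb-trans p q

-- Surgery at two corners

module Surgery {m : ℕ} (s : Matching m) (f g : Flag m) (f≢g : f ≢ g) (sf≢g : s ⟨ f ⟩ ≢ g) where

  private
    X = Flag m
    ES = Fin m → Bool
    f′ g′ : X
    f′ = s ⟨ f ⟩
    g′ = s ⟨ g ⟩

    f≢g′ : f ≢ g′
    f≢g′ e = sf≢g (trans (cong (s ⟨_⟩) e) (invol s g))

    f′≢g′ : f′ ≢ g′
    f′≢g′ e = f≢g (trans (sym (invol s f)) (trans (cong (s ⟨_⟩) e) (invol s g)))

    abstract
      surg-fn : X → X
      surg-fn x with x ≟F f | x ≟F g | x ≟F f′ | x ≟F g′
      ... | yes _ | _ | _ | _ = g
      ... | no _ | yes _ | _ | _ = f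
      ... | no _ | no _ | yes _ | _ = g′
      ... | no _ | no _ | no _ | yes _ = f′
      ... | no _ | no _ | no _ | no _ = s ⟨ x ⟩

      fn-f : surg-fn f ≡ g
      fn-f with f ≟F f
      ... | yes _ = refl
      ... | no n = contradiction refl n

      fn-g : surg-fn g ≡ f
      fn-g with g ≟F f | g ≟F g
      ... | yes e | _ = contradiction (sym e) f≢g
      ... | no _ | yes _ = refl
      ... | no _ | no n = contradiction refl n

      fn-f′ : surg-fn f′ ≡ g′
      fn-f′ with f′ ≟F f | f′ ≟F g | f′ ≟F f′
      ... | yes e | _ | _ = contradiction e (fpf s f)
      ... | no _ | yes e | _ = contradiction e sf≢g
      ... | no _ | no _ | yes _ = refl
      ... | no _ | no _ | no n = contradiction refl n

      fn-g′ : surg-fn g′ ≡ f′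
      fn-g′ with g′ ≟F f | g′ ≟F g | g′ ≟F f′ | g′ ≟F g′
      ... | yes e | _ | _ | _ = contradiction (sym e) f≢g′
      ... | no _ | yes e | _ | _ = contradiction e (fpf s g)
      ... | no _ | no _ | yes e | _ = contradiction (sym e) f′≢g′
      ... | no _ | no _ | no _ | yes _ = refl
      ... | no _ | no _ | no _ | no n = contradiction refl n

      fn-else : ∀ {x} → x ≢ f → x ≢ g → x ≢ f′ → x ≢ g′ → surg-fn x ≡ s ⟨ x ⟩
      fn-else {x} a b c d with x ≟F f | x ≟F g | x ≟F f′ | x ≟F g′
      ... | yes e | _ | _ | _ = contradiction e a
      ... | no _ | yes e | _ | _ = contradiction e b
      ... | no _ | no _ | yes e | _ = contradiction e c
      ... | no _ | no _ | no _ | yes e = contradiction e d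
      ... | no _ | no _ | no _ | no _ = refl

  data SurgView (x : X) : Set where
    at-f  : x ≡ f → SurgView x
    at-g  : x ≡ g → SurgView x
    at-f′ : x ≡ s ⟨ f ⟩ → SurgView x
    at-g′ : x ≡ s ⟨ g ⟩ → SurgView x
    away  : x ≢ f → x ≢ g → x ≢ s ⟨ f ⟩ → x ≢ s ⟨ g ⟩ → SurgView x

  surg-view : ∀ x → SurgView x
  surg-view x with x ≟F f | x ≟F g | x ≟F f′ | x ≟F g′
  ... | yes e | _ | _ | _ = at-f e
  ... | no _ | yes e | _ | _ = at-g e
  ... | no _ | no _ | yes e | _ = at-f′ e
  ... | no _ | no _ | no _ | yes e = at-g′ e
  ... | no a | no b | no c | no d = away a b c d

  private
    fn-invol : ∀ x → surg-fn (surg-fn x) ≡ x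
    fn-invol x with surg-view x
    ... | at-f refl = trans (cong surg-fn fn-f) fn-g
    ... | at-g refl = trans (cong surg-fn fn-g) fn-f
    ... | at-f′ refl = trans (cong surg-fn fn-f′) fn-g′
    ... | at-g′ refl = trans (cong surg-fn fn-g′) fn-f′
    ... | away a b c d = trans (cong surg-fn (fn-else a b c d)) (trans (fn-else
            (λ e → c (swap e)) (λ e → d (swap e)) (λ e → a (inj e)) (λ e → b (inj e))) (invol s x))
      where
      swap : ∀ {y} → s ⟨ x ⟩ ≡ y → x ≡ s ⟨ y ⟩
      swap e = trans (sym (invol s x)) (cong (s ⟨_⟩) e)
      inj : ∀ {y} → s ⟨ x ⟩ ≡ s ⟨ y ⟩ → x ≡ y
      inj {y} e = trans (swap e) (invol s y)

    fn-fpf : ∀ x → surg-fn x ≢ x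
    fn-fpf x e with surg-view x
    ... | at-f refl = f≢g (trans (sym e) fn-f)
    ... | at-g refl = f≢g (trans (sym fn-g) e)
    ... | at-f′ refl = f′≢g′ (trans (sym e) fn-f′)
    ... | at-g′ refl = f′≢g′ (trans (sym fn-g′) e)
    ... | away a b c d = fpf s x (trans (sym (fn-else a b c d)) e)

  surg : Matching m
  surg = record { fn = surg-fn ; invol = fn-invol ; fpf = fn-fpf }

  surg-f : surg ⟨ f ⟩ ≡ g
  surg-f = fn-f

  surg-g : surg ⟨ g ⟩ ≡ f
  surg-g = fn-g

  surg-f′ : surg ⟨ s ⟨ f ⟩ ⟩ ≡ s ⟨ g ⟩
  surg-f′ = fn-f′

  surg-g′ : surg ⟨ s ⟨ g ⟩ ⟩ ≡ s ⟨ f ⟩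
  surg-g′ = fn-g′

  surg-away : ∀ {x} → x ≢ f → x ≢ g → x ≢ s ⟨ f ⟩ → x ≢ s ⟨ g ⟩ → surg ⟨ x ⟩ ≡ s ⟨ x ⟩
  surg-away = fn-else

  module _ {S₀ S₂ : ES} where

    -- One pair undoes the surgery: `surg` links `g` to `f` and `s ⟨ g ⟩` to `s ⟨ f ⟩`, so joining
    -- `f` to `s ⟨ f ⟩` restores the other corner as well.
    surg-plus : ∀ {x y} → Conn s S₀ S₂ x y → Plus (Conn surg S₀ S₂) f (s ⟨ f ⟩) x y
    surg-plus = conn-⊆ P.refl P.trans via-s (λ x p → inj₁ (conn-0 x p)) (λ x p → inj₁ (conn-2 x p))
      where
      module P = IsEquivalence (plus-equivalence (conn-equivalence {s = surg} {S₀} {S₂}) f f′)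
      link : ∀ {x y} → surg ⟨ x ⟩ ≡ y → Conn surg S₀ S₂ x y
      link {x} e = subst (Conn surg S₀ S₂ x) e (conn-s x)
      via-s : ∀ x → Plus (Conn surg S₀ S₂) f f′ x (s ⟨ x ⟩)
      via-s x with surg-view x
      ... | at-f refl = inj₂ (inj₁ (ε , ε))
      ... | at-g refl = inj₂ (inj₁ (link fn-g , link fn-f′))
      ... | at-f′ refl = inj₂ (inj₂ (ε , subst (Conn surg S₀ S₂ f) (sym (invol s f)) ε))
      ... | at-g′ refl = inj₂ (inj₂ (link fn-g′ , subst (Conn surg S₀ S₂ f) (sym (invol s g)) (link fn-f)))
      ... | away a b c d = inj₁ (link (fn-else a b c d))

    surg-⊆ : Conn s S₀ S₂ f g → ∀ {x y} → Conn surg S₀ S₂ x y → Conn s S₀ S₂ x y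
    surg-⊆ fg = conn-⊆ ε _◅◅_ via-s conn-0 conn-2
      where
      f′g′ : Conn s S₀ S₂ f′ g′
      f′g′ = conn-sym (conn-s f) ◅◅ fg ◅◅ conn-s g
      via-s : ∀ x → Conn s S₀ S₂ x (surg ⟨ x ⟩)
      via-s x with surg-view x
      ... | at-f refl = subst (Conn s S₀ S₂ f) (sym fn-f) fg
      ... | at-g refl = subst (Conn s S₀ S₂ g) (sym fn-g) (conn-sym fg)
      ... | at-f′ refl = subst (Conn s S₀ S₂ f′) (sym fn-f′) f′g′
      ... | at-g′ refl = subst (Conn s S₀ S₂ g′) (sym fn-g′) (conn-sym f′g′)
      ... | away a b c d = subst (Conn s S₀ S₂ x) (sym (fn-else a b c d)) (conn-s x)

    surg-⊇ : Conn surg S₀ S₂ f (s ⟨ f ⟩) → ∀ {x y} → Conn s S₀ S₂ x y → Conn surg S₀ S₂ x y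
    surg-⊇ ff′ c with surg-plus c
    ... | inj₁ d = d
    ... | inj₂ (inj₁ (p , q)) = p ◅◅ ff′ ◅◅ q
    ... | inj₂ (inj₂ (p , q)) = p ◅◅ conn-sym ff′ ◅◅ q

    surg-same : Conn surg S₀ S₂ f (s ⟨ f ⟩) → Conn s S₀ S₂ f g → cnt surg S₀ S₂ ≡ cnt s S₀ S₂
    surg-same ff′ fg = cnt-≡ (surg-⊆ fg) (surg-⊇ ff′)

    surg-splits : ¬ Conn surg S₀ S₂ f (s ⟨ f ⟩) → Conn s S₀ S₂ f g → cnt surg S₀ S₂ ≡ suc (cnt s S₀ S₂)
    surg-splits ¬ff′ fg with count-merge conn-equivalence tt tt ¬ff′ (cnt-count surg S₀ S₂)
    ... | k , e , c = trans e (cong suc (count-≡ (plus-equivalence conn-equivalence f f′) conn-equivalence id id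
      (λ _ _ → merged) (λ _ _ → surg-plus) c (cnt-count s S₀ S₂)))
      where
      merged : ∀ {x y} → Plus (Conn surg S₀ S₂) f f′ x y → Conn s S₀ S₂ x y
      merged (inj₁ p) = surg-⊆ fg p
      merged (inj₂ (inj₁ (p , q))) = surg-⊆ fg p ◅◅ conn-s f ◅◅ surg-⊆ fg q
      merged (inj₂ (inj₂ (p , q))) = surg-⊆ fg p ◅◅ conn-sym (conn-s f) ◅◅ surg-⊆ fg q

  -- The classes are cycles here. The one through `f` after surgery avoids the new edge between
  -- `s ⟨ f ⟩` and `s ⟨ g ⟩`; removing its edge between `f` and `g` leaves a path that exists for
  -- `s` too.
  surg-cycle : ∀ {S S′ : ES} → (∀ e → S′ e ≡ not (S e)) → ¬ Conn surg S S′ f (s ⟨ f ⟩) → Conn s S S′ f g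
  surg-cycle {S} {S′} comp ¬ff′ = subst (Conn s S S′ f) fn-f (cycle τ-invol fn-invol τ-fpf fn-fpf
    (Conn surg S S′ f) ε _◅◅_ f along-τ along-s ε)
    where
    τ : X → X
    τ z = if S (edge z) then σ0 z else σ2 z
    τ-invol : ∀ z → τ (τ z) ≡ z
    τ-invol z with S (edge z) in p
    ... | true rewrite p = σ0-invol z
    ... | false rewrite p = σ2-invol z
    τ-fpf : ∀ z → τ z ≢ z
    τ-fpf z with S (edge z)
    ... | true = σ0-fpf z
    ... | false = σ2-fpf z
    along-τ : ∀ z → Conn surg S S′ f z → Conn s S S′ z (τ z) × Conn surg S S′ f (τ z)
    along-τ z c with S (edge z) in p
    ... | true = conn-0 z p , c ◅◅ conn-0 z p
    ... | false = conn-2 z (trans (comp _) (cong not p)) , c ◅◅ conn-2 z (trans (comp _) (cong not p))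
    along-s : ∀ z → z ≢ f → z ≢ surg ⟨ f ⟩ → Conn surg S S′ f z → Conn s S S′ z (surg ⟨ z ⟩) × Conn surg S S′ f (surg ⟨ z ⟩)
    along-s z n k c with surg-view z
    ... | at-f e = contradiction e n
    ... | at-g e = contradiction (trans e (sym fn-f)) k
    ... | at-f′ refl = contradiction c ¬ff′
    ... | at-g′ refl = contradiction (c ◅◅ subst (Conn surg S S′ g′) fn-g′ (conn-s g′)) ¬ff′
    ... | away a b p d = subst (Conn s S S′ z) (sym (fn-else a b p d)) (conn-s z) , c ◅◅ conn-s z

  surg-splits-cycle : ∀ {S S′ : ES} → (∀ e → S′ e ≡ not (S e)) → ¬ Conn surg S S′ f (s ⟨ f ⟩) →
    cnt surg S S′ ≡ suc (cnt s S S′)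
  surg-splits-cycle comp ¬ff′ = surg-splits ¬ff′ (surg-cycle comp ¬ff′)

-- Coloured edges: corners, leaves and the splitting lemma

parity-bound : ∀ V K a b k l d e n → V + a ≤ 2 * k + d → V + b ≤ 2 * l + e → d + e ≡ n →
  2 * K + n ≤ suc (a + b) → V + K ≤ k + l
parity-bound V K a b k l d e n p q refl r with V + K ℕ.≤? k + l
... | yes h = h
... | no ¬h = ⊥-elim (ℕ.1+n≰n {2 * (V + K) + (d + e)} (ℕ.≤-trans (ℕ.≤-reflexive (cong suc (E₀ V K d e))) (begin
  suc (2 * V + (2 * K + (d + e))) ≤⟨ s≤s (ℕ.+-monoʳ-≤ (2 * V) r) ⟩
  suc (2 * V + suc (a + b)) ≡⟨ E₁ V a b ⟩
  2 + ((V + a) + (V + b)) ≤⟨ ℕ.+-monoʳ-≤ 2 (ℕ.+-mono-≤ p q) ⟩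
  2 + ((2 * k + d) + (2 * l + e)) ≡⟨ E₂ k l d e ⟩
  2 * suc (k + l) + (d + e) ≤⟨ ℕ.+-monoˡ-≤ (d + e) (ℕ.*-monoʳ-≤ 2 (ℕ.≰⇒> ¬h)) ⟩
  2 * (V + K) + (d + e) ∎)))
  where
  open ℕ.≤-Reasoning
  E₀ : ∀ V K d e → 2 * (V + K) + (d + e) ≡ 2 * V + (2 * K + (d + e))
  E₀ = solve-∀
  E₁ : ∀ V a b → suc (2 * V + suc (a + b)) ≡ 2 + ((V + a) + (V + b))
  E₁ = solve-∀
  E₂ : ∀ k l d e → 2 + ((2 * k + d) + (2 * l + e)) ≡ 2 * suc (k + l) + (d + e)
  E₂ = solve-∀

-- Here both Euler inequalities of `parity-bound` are sharper by one; together with the upper bound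
-- on `k + l` they force `a + b + 2 ≤ 2 * K + n`, one more than the genus admits.
genus-clash : ∀ V K a b k l d e n → V + suc a ≤ 2 * k + d → V + suc b ≤ 2 * l + e → d + e ≡ n →
  k + l ≤ V + K → 2 * K + n ≤ suc (a + b) → ⊥
genus-clash V K a b k l d e n p q refl h r = ℕ.1+n≰n (ℕ.+-cancelˡ-≤ (2 * V) _ _ (begin
  2 * V + suc (suc (a + b)) ≡⟨ E₁ V a b ⟩
  (V + suc a) + (V + suc b) ≤⟨ ℕ.+-mono-≤ p q ⟩
  (2 * k + d) + (2 * l + e) ≡⟨ E₂ k l d e ⟩
  2 * (k + l) + (d + e) ≤⟨ ℕ.+-monoˡ-≤ (d + e) (ℕ.*-monoʳ-≤ 2 h) ⟩
  2 * (V + K) + (d + e) ≡⟨ E₃ V K d e ⟩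
  2 * V + (2 * K + (d + e)) ≤⟨ ℕ.+-monoʳ-≤ (2 * V) r ⟩
  2 * V + suc (a + b) ∎))
  where
  open ℕ.≤-Reasoning
  E₁ : ∀ V a b → 2 * V + suc (suc (a + b)) ≡ (V + suc a) + (V + suc b)
  E₁ = solve-∀
  E₂ : ∀ k l d e → (2 * k + d) + (2 * l + e) ≡ 2 * (k + l) + (d + e)
  E₂ = solve-∀
  E₃ : ∀ V K d e → 2 * (V + K) + (d + e) ≡ 2 * V + (2 * K + (d + e))
  E₃ = solve-∀

count-positive : ∀ {X : Set} {R : X → X → Set} {P n x} → P x → Count R P n → 1 ≤ n
count-positive {x = x} p c with Count.reps c | Count.len c | Count.cover c p
... | _ ∷ _ | refl | _ = s≤s z≤n

one-of : ∀ {X : Set} (d : X → ℕ) L → All (λ r → 1 ≤ d r) L → suc (sum (map d L)) ≤ 2 * length L →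
  ∃ λ r → r ∈ L × d r ≡ 1
one-of d [] [] ()
one-of d (r ∷ L) (p ∷ ps) h with d r in eq
... | suc zero = r , here refl , eq
... | suc (suc k) with one-of d L ps (ℕ.+-cancelˡ-≤ 2 _ _ (ℕ.≤-trans (s≤s (s≤s (s≤s (ℕ.m≤n+m _ k)))) (ℕ.≤-trans h (ℕ.≤-reflexive (ℕ.*-distribˡ-+ 2 1 (length L))))))
... | r′ , i , e = r′ , there i , e

two-of : ∀ {X : Set} {Q : X → X → Set} (d : X → ℕ) L → AllPairs Q L → All (λ r → 1 ≤ d r) L →
  suc (suc (sum (map d L))) ≤ 2 * length L → ∃ λ r → ∃ λ t → Q r t × (r ∈ L × d r ≡ 1) × (t ∈ L × d t ≡ 1)
two-of d [] [] [] ()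
two-of d (r ∷ L) (q ∷ qs) (p ∷ ps) h with d r in eq
... | suc zero with one-of d L ps (ℕ.+-cancelˡ-≤ 2 _ _ (ℕ.≤-trans h (ℕ.≤-reflexive (ℕ.*-distribˡ-+ 2 1 (length L)))))
... | t , i , e = r , t , All.lookup q i , (here refl , eq) , (there i , e)
two-of d (r ∷ L) (q ∷ qs) (p ∷ ps) h | suc (suc k)
  with two-of d L qs ps (ℕ.+-cancelˡ-≤ 2 _ _ (ℕ.≤-trans (s≤s (s≤s (s≤s (s≤s (ℕ.m≤n+m _ k))))) (ℕ.≤-trans h (ℕ.≤-reflexive (ℕ.*-distribˡ-+ 2 1 (length L))))))
... | a , b , ab , (i , ea) , (j , eb) = a , b , ab , (there i , ea) , (there j , eb)

zip-any : ∀ {X : Set} {P Q : X → Set} {xs} → All P xs → Any Q xs → Any (λ x → P x × Q x) xs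
zip-any (p ∷ ps) (here q) = here (p , q)
zip-any (p ∷ ps) (there a) = there (zip-any ps a)

singleton-unique : ∀ {X : Set} {xs : List X} {x y} → length xs ≡ 1 → x ∈ xs → y ∈ xs → x ≡ y
singleton-unique {xs = _ ∷ []} _ (here refl) (here refl) = refl

module _ {m : ℕ} where

  #E-full : #E {m} full ≡ m
  #E-full = trans (all-true (allFin m)) (List.length-tabulate {n = m} id)
    where
    all-true : ∀ (es : List (Fin m)) → countB full es ≡ length es
    all-true [] = refl
    all-true (e ∷ es) = cong suc (all-true es)

  #E-∁ : ∀ B → #E {m} B + #E (∁ B) ≡ m
  #E-∁ B = trans (both (allFin m)) (List.length-tabulate {n = m} id)
    where
    both : ∀ (es : List (Fin m)) → countB B es + countB (∁ B) es ≡ length es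
    both [] = refl
    both (e ∷ es) with B e
    ... | true = cong suc (both es)
    ... | false = trans (ℕ.+-suc _ _) (cong suc (both es))

module Colour {m : ℕ} (A : Fin m → Bool) where

  private
    X = Flag m
    ES = Fin m → Bool

  colour : X → Bool
  colour x = A (edge x)

  col : Bool → ES
  col c e = if c then A e else not (A e)

  col⁺ : ∀ {c x} → colour x ≡ c → col c ∋ x
  col⁺ {true} p = p
  col⁺ {false} p = cong not p

  col⁻ : ∀ {c x} → col c ∋ x → colour x ≡ c
  col⁻ {true} p = p
  col⁻ {false} {x} p = trans (sym (Bool.not-involutive _)) (cong not p)

  col-not : ∀ c e → col (not c) e ≡ not (col c e)
  col-not true e = refl
  col-not false e = sym (Bool.not-involutive _)

  module Leaves (s : Matching m) where

    Mixed : X → Set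
    Mixed x = colour (s ⟨ x ⟩) ≡ not (colour x)

    mixed? : ∀ x → Dec (Mixed x)
    mixed? x = colour (s ⟨ x ⟩) Bool.≟ not (colour x)

    mixed-s : ∀ {x} → Mixed x → Mixed (s ⟨ x ⟩)
    mixed-s {x} p = trans (cong colour (invol s x)) (trans (sym (Bool.not-involutive _)) (cong not (sym p)))

    unmixed : ∀ {x} → ¬ Mixed x → colour x ≡ colour (s ⟨ x ⟩)
    unmixed n = sym (trans (Bool.¬-not n) (Bool.not-involutive _))

    Vertex : X → X → Set
    Vertex = Conn s none full

    vertex-⊆ : ∀ {S x y} → Vertex x y → Conn s S full x y
    vertex-⊆ = conn-mono (λ _ ()) (λ _ → id)

    -- x and y belong to the same component of A, or to the same component of its complement.
    Piece : X → X → Set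
    Piece x y = colour x ≡ colour y × Conn s (col (colour x)) full x y

    piece-equivalence : IsEquivalence Piece
    piece-equivalence = record
      { refl = refl , ε
      ; sym = λ { {x} {y} (p , c) → sym p , subst (λ b → Conn s (col b) full y x) p (conn-sym c) }
      ; trans = λ { {x} {y} {z} (p , c) (q , d) → trans p q , c ◅◅ subst (λ b → Conn s (col b) full y z) (sym p) d } }

    private module Pc = IsEquivalence piece-equivalence

    piece? : ∀ x y → Dec (Piece x y)
    piece? x y = (colour x Bool.≟ colour y) ×-dec conn? x y

    vertex-piece : ∀ {x y} → colour x ≡ colour y → Vertex x y → Piece x y
    vertex-piece p v = p , vertex-⊆ v

    -- `σ0` and `σ2` keep the edge, so the colour first changes at a corner. The lemma is used again
    -- with other edge sets in the role of a colour.
    crossing : ∀ {S₀ S₂ x y} → Conn s S₀ S₂ x y → colour y ≡ not (colour x) →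
      ∃ λ z → Conn s S₀ S₂ x z × colour z ≡ colour x × Mixed z
    crossing {S₀} {S₂} {x} {y} c p = [ id , (λ { (q , _) → contradiction p (Bool.not-¬ q) }) ]′
        (conn-closed Inv via-s (λ z i → keep refl (conn-0 z i)) (λ z i → keep refl (conn-2 z i)) c (inj₂ (refl , ε)))
      where
      Inv : X → Set
      Inv z = (∃ λ z → Conn s S₀ S₂ x z × colour z ≡ colour x × Mixed z) ⊎ (colour z ≡ colour x × Conn s S₀ S₂ x z)
      via-s : ∀ z → Inv z → Inv (s ⟨ z ⟩)
      via-s z (inj₁ h) = inj₁ h
      via-s z (inj₂ (q , d)) with mixed? z
      ... | yes mx = inj₁ (z , d , q , mx)
      ... | no n = inj₂ (trans (sym (unmixed n)) q , d ◅◅ conn-s z)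
      keep : ∀ {z w} → edge w ≡ edge z → Conn s S₀ S₂ z w → Inv z → Inv w
      keep e c (inj₁ h) = inj₁ h
      keep e c (inj₂ (q , d)) = inj₂ (trans (cong A e) q , d ◅◅ c)

    private
      MixedA : X → Set
      MixedA x = colour x ≡ true × Mixed x

      mixedA? : ∀ x → Dec (MixedA x)
      mixedA? x = (colour x Bool.≟ true) ×-dec mixed? x

      vertex-count : ∀ {P : X → Set} → (∀ x → Dec (P x)) → ∃ λ n → Count Vertex P n
      vertex-count = count-exists conn-equivalence conn? flags ∈-flags

      n-count : ∀ c → Count (Conn s (col c) full) (col c ∋_) (nn s (col c) full full)
      n-count c = span-count s (col c) (λ _ b → sym b) (λ _ _ → refl) (λ _ b → b) (λ _ _ → refl)

      v-count : ∀ c → Count Vertex (col c ∋_) (nn s (col c) none full)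
      v-count c = span-count s (col c) (λ _ _ → refl) (λ _ _ → refl) (λ _ _ → refl) (λ _ _ → refl)

      M-count : ∃ λ n → Count Vertex MixedA n
      M-count = vertex-count mixedA?

      N-count : ∃ λ n → Count Piece (λ _ → ⊤) n
      N-count = count-exists piece-equivalence piece? flags ∈-flags (λ _ → yes tt)

    V F K M N : ℕ
    V = cnt s none full
    F = cnt s full none
    K = cnt s full full
    M = proj₁ M-count
    N = proj₁ N-count

    k : Bool → ℕ
    k c = cnt s (col c) full

    private
      k-split : ∀ c → k c ≡ nn s (col c) full full + proj₁ (bare s (col c))
      k-split c = spanning s (col c) (λ _ b → sym b) (λ _ _ → refl) (λ _ b → b) (λ _ _ → refl)

      V-split : ∀ c → V ≡ nn s (col c) none full + proj₁ (bare s (col c))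
      V-split c = spanning s (col c) (λ _ _ → refl) (λ _ _ → refl) (λ _ _ → refl) (λ _ _ → refl)

      v-split : nn s A none full ≡ M + proj₁ (bare s (∁ A))
      v-split = count-≡ conn-equivalence conn-equivalence id id (λ _ _ → id) (λ _ _ → id) (v-count true)
        (count-++ conn-equivalence proj₁ (λ {x} n → Bool.¬-not (λ p → n (x , cong not p , ε))) cover
          (λ { {x} (p , mx) n v → n (s ⟨ x ⟩ , cong not (trans mx (cong not p)) , conn-sym v ◅◅ conn-s x) }) (proj₂ M-count) (proj₂ (bare s (∁ A))))
        where
        cover : ∀ {x} → colour x ≡ true → (∃ λ y → MixedA y × Vertex x y) ⊎ (∃ λ y → ¬ Meets s (∁ A) y × Vertex x y)
        cover {x} p with meets? s (∁ A) x
        ... | no n = inj₂ (x , n , ε)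
        ... | yes (y , q , v) with crossing v (trans (col⁻ {false} {y} q) (cong not (sym p)))
        ... | z , w , r , mx = inj₁ (z , (trans r p , mx) , w)

      N-split : N ≡ nn s (col true) full full + nn s (col false) full full
      N-split = count-≡ piece-equivalence piece-equivalence id id (λ _ _ → id) (λ _ _ → id) (proj₂ N-count)
        (count-++ piece-equivalence _ _ cover (λ {x} {y} p q r → contradiction (trans (sym p) (trans (proj₁ r) (col⁻ {false} {y} q))) λ ())
          (side true) (side false))
        where
        side : ∀ c → Count Piece (col c ∋_) (nn s (col c) full full)
        side c = record { Count nc ; indep = indep′ (Count.inP nc) (Count.indep nc)
                        ; cover = λ {x} p → Any.map (λ { {y} (q , d) → trans (col⁻ {c} {x} p) (sym (col⁻ {c} {y} q))
                            , subst (λ b → Conn s (col b) full x _) (sym (col⁻ {c} {x} p)) d }) (zip-any (Count.inP nc) (Count.cover nc p)) }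
          where
          nc = n-count c
          indep′ : ∀ {L} → All (col c ∋_) L → AllPairs (λ a b → ¬ Conn s (col c) full a b) L → AllPairs (λ a b → ¬ Piece a b) L
          indep′ [] [] = []
          indep′ {x ∷ _} (p ∷ ps) (i ∷ is) = All.map (λ { n (_ , d) → n (subst (λ b → Conn s (col b) full _ _) (col⁻ {c} {x} p) d) }) i ∷ indep′ ps is
        cover : ∀ {x} → ⊤ → (∃ λ y → col true ∋ y × Piece x y) ⊎ (∃ λ y → col false ∋ y × Piece x y)
        cover {x} _ with colour x Bool.≟ true
        ... | yes p = inj₁ (x , p , Pc.refl)
        ... | no n = inj₂ (x , cong not (Bool.¬-not n) , Pc.refl)

    -- The components of a colour's spanning subgraph are its pieces and the vertices without edges
    -- of that colour. A vertex that meets both colours has a mixed corner, so sorting the vertices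
    -- by the colours they meet eliminates the bare ones.
    N+V : N + V ≡ (k true + k false) + M
    N+V = trans (cong₂ _+_ N-split (trans (V-split true) (cong (_+ proj₁ (bare s A)) v-split)))
      (trans (reorder (nn s (col true) full full) (nn s (col false) full full) M (proj₁ (bare s (∁ A))) (proj₁ (bare s A)))
        (cong (_+ M) (cong₂ _+_ (sym (k-split true)) (sym (k-split false)))))
      where
      reorder : ∀ a b c d e → a + b + (c + d + e) ≡ (a + e + (b + d)) + c
      reorder = solve-∀

    private
      LV : List X
      LV = Count.reps (proj₂ M-count)

      -- Connection in the graph whose nodes are the pieces and whose edges are the mixed vertices
      -- in the list. A vertex meets at most one piece of each colour, so each mixed vertex is a
      -- single edge.
      Link : List X → X → X → Set
      Link [] = Piece
      Link (x ∷ L) = Plus (Link L) x (s ⟨ x ⟩)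

      link-equivalence : ∀ L → IsEquivalence (Link L)
      link-equivalence [] = piece-equivalence
      link-equivalence (x ∷ L) = plus-equivalence (link-equivalence L) x _

      link? : ∀ L x y → Dec (Link L x y)
      link? [] = piece?
      link? (x ∷ L) a b = link? L a b ⊎-dec ((link? L a x ×-dec link? L _ b) ⊎-dec (link? L a _ ×-dec link? L x b))

      link-piece : ∀ L {x y} → Piece x y → Link L x y
      link-piece [] p = p
      link-piece (x ∷ L) p = inj₁ (link-piece L p)

      link-∈ : ∀ {L x} → x ∈ L → Link L x (s ⟨ x ⟩)
      link-∈ {L = x ∷ L} (here refl) = inj₂ (inj₁ (IsEquivalence.refl (link-equivalence L) , IsEquivalence.refl (link-equivalence L)))
      link-∈ (there i) = inj₁ (link-∈ i)

      link-≤ : ∀ L {R : X → X → Set} {n} → IsEquivalence R → (∀ {x y} → R x y → Link L x y) → Count R (λ _ → ⊤) n → N ≤ length L + n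
      link-≤ [] eq h c = count-≤ eq piece-equivalence id (λ _ _ → h) c (proj₂ N-count)
      link-≤ (x ∷ L) eq h c with count-exists (link-equivalence L) (link? L) flags ∈-flags (λ _ → yes tt)
      ... | n₁ , c₁ = ℕ.≤-trans (link-≤ L (link-equivalence L) id c₁) (ℕ.≤-trans
        (ℕ.+-monoʳ-≤ (length L) (count-plus (link-equivalence L) eq tt tt (link? L _ _) h c₁ c)) (ℕ.≤-reflexive (ℕ.+-suc _ _)))

      rep : ∀ {x} → MixedA x → ∃ λ y → y ∈ LV × MixedA y × Vertex x y
      rep mx with find (zip-any (Count.inP (proj₂ M-count)) (Count.cover (proj₂ M-count) mx))
      ... | y , i , my , v = y , i , my , v

      conn-link : ∀ {x y} → Conn s full full x y → Link LV x y
      conn-link = conn-⊆ L.refl L.trans via-s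
        (λ z _ → link-piece LV (refl , conn-0 z (col⁺ {colour z} {z} refl))) (λ z _ → link-piece LV (refl , conn-2 z refl))
        where
        module L = IsEquivalence (link-equivalence LV)
        cross : ∀ {z} → MixedA z → Link LV z (s ⟨ z ⟩)
        cross {z} (p , mz) with rep (p , mz)
        ... | y , i , (q , my) , v = L.trans (link-piece LV (vertex-piece (trans p (sym q)) v)) (L.trans (link-∈ i)
                (link-piece LV (vertex-piece (trans my (trans (cong not (trans q (sym p))) (sym mz))) (conn-sym (conn-s y) ◅◅ conn-sym v ◅◅ conn-s z))))
        via-s : ∀ z → Link LV z (s ⟨ z ⟩)
        via-s z with mixed? z | colour z Bool.≟ true
        ... | no n | _ = link-piece LV (vertex-piece (unmixed n) (conn-s z))
        ... | yes mz | yes p = cross (p , mz)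
        ... | yes mz | no n = L.sym (subst (Link LV _) (invol s z) (cross (trans mz (cong not (Bool.¬-not n)) , mixed-s mz)))

    -- An edge of the graph of pieces lowers its number of components by at most one; equality would
    -- mean a forest.
    N≤M+K : N ≤ M + K
    N≤M+K = ℕ.≤-trans (link-≤ LV conn-equivalence conn-link (cnt-count s full full))
      (ℕ.≤-reflexive (cong (_+ K) (Count.len (proj₂ M-count))))

    k-upper : k true + k false ≤ V + K
    k-upper = ℕ.+-cancelʳ-≤ M _ _ (ℕ.≤-trans (ℕ.≤-reflexive (sym N+V)) (ℕ.≤-trans (ℕ.+-monoˡ-≤ V N≤M+K) (ℕ.≤-reflexive (reorder M K V))))
      where
      reorder : ∀ a b c → a + b + c ≡ c + b + a
      reorder = solve-∀

    record Leaf (r : X) : Set where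
      field
        corner : X
        mixed  : Mixed corner
        inside : Piece corner r
        single : ∀ {f g} → Mixed f → Mixed g → Piece f r → Piece g r → Vertex f g

    -- The pieces and the mixed vertices form a forest with K components, so the piece
    -- degrees add up to at most 2N - 2K; two pieces of degree one remain.
    two-leaves : V + K ≤ k true + k false → ∀ {x₀} → Mixed x₀ → ∃ λ r → ∃ λ t → ¬ Piece r t × Leaf r × Leaf t
    two-leaves lower {x₀} mx₀ = pick (two-of deg L₁ (Count.indep c₁) (All.map positive (Count.inP c₁)) bound)
      where
      Near : X → Set
      Near x = ∃ λ y → Mixed y × Piece x y
      near? : ∀ x → Dec (Near x)
      near? x = some? (λ y → mixed? y ×-dec piece? x y)
      HasMixed : X → Set
      HasMixed x = ∃ λ y → Mixed y × Conn s full full x y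
      hasMixed? : ∀ x → Dec (HasMixed x)
      hasMixed? x = some? (λ y → mixed? y ×-dec conn? x y)
      N₁ = count-exists piece-equivalence piece? flags ∈-flags near?
      N₀ = count-exists piece-equivalence piece? flags ∈-flags (λ x → ¬? (near? x))
      K₁ = count-exists (conn-equivalence {s = s} {full} {full}) conn? flags ∈-flags hasMixed?
      K₀ = count-exists (conn-equivalence {s = s} {full} {full}) conn? flags ∈-flags (λ x → ¬? (hasMixed? x))
      c₁ = proj₂ N₁
      L₁ = Count.reps c₁
      -- Both ends of every link, so that `deg` is the degree in the graph of pieces.
      xs = LV ++ map (s ⟨_⟩) LV
      deg : X → ℕ
      deg = degree piece-equivalence piece? xs
      pure-conn : ∀ {x y} → ¬ Near x → Conn s full full x y → Piece x y
      pure-conn {x} n c = conn-closed (Piece x) via-s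
        (λ z _ p → Pc.trans p (refl , conn-0 z (col⁺ {colour z} {z} refl))) (λ z _ p → Pc.trans p (refl , conn-2 z refl)) c Pc.refl
        where
        via-s : ∀ z → Piece x z → Piece x (s ⟨ z ⟩)
        via-s z p with mixed? z
        ... | yes mz = ⊥-elim (n (z , mz , p))
        ... | no nz = Pc.trans p (vertex-piece (unmixed nz) (conn-s z))
      piece-conn : ∀ {x y} → Piece x y → Conn s full full x y
      piece-conn (_ , c) = conn-mono (λ _ _ → refl) (λ _ → id) c
      N≡ : N ≡ proj₁ N₁ + proj₁ N₀
      N≡ = count-split piece-equivalence near? (λ { q (y , my , p) → y , my , Pc.trans (Pc.sym q) p }) (proj₂ N₁) (proj₂ N₀) (proj₂ N-count)
      K≡ : K ≡ proj₁ K₁ + proj₁ K₀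
      K≡ = count-split conn-equivalence hasMixed? (λ { q (y , my , p) → y , my , conn-sym q ◅◅ p }) (proj₂ K₁) (proj₂ K₀) (cnt-count s full full)
      N₀≡K₀ : proj₁ N₀ ≡ proj₁ K₀
      N₀≡K₀ = count-≡ piece-equivalence conn-equivalence
        (λ { n (y , my , c) → n (y , my , pure-conn n c) }) (λ { n (y , my , p) → n (y , my , piece-conn p) })
        (λ _ _ → piece-conn) (λ n _ → pure-conn n) (proj₂ N₀) (proj₂ K₀)
      K₁≥1 : 1 ≤ proj₁ K₁
      K₁≥1 = count-positive (x₀ , mx₀ , ε) (proj₂ K₁)
      M+K≤N : M + K ≤ N
      M+K≤N = ℕ.+-cancelʳ-≤ V _ _ (ℕ.≤-trans (ℕ.≤-reflexive (reorder M K V)) (ℕ.≤-trans (ℕ.+-monoˡ-≤ M lower) (ℕ.≤-reflexive (sym N+V))))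
        where
        reorder : ∀ a b c → a + b + c ≡ c + b + a
        reorder = solve-∀
      -- A piece without mixed corners is a whole component. When these are left out, the component
      -- of `x₀` still remains, so the rest of the forest has more nodes than edges.
      M<N₁ : suc M ≤ proj₁ N₁
      M<N₁ = ℕ.+-cancelʳ-≤ (proj₁ N₀) _ _ (begin
        suc M + proj₁ N₀ ≡⟨ cong (suc M +_) N₀≡K₀ ⟩
        suc M + proj₁ K₀ ≡⟨ sym (ℕ.+-suc M (proj₁ K₀)) ⟩
        M + suc (proj₁ K₀) ≤⟨ ℕ.+-monoʳ-≤ M (ℕ.+-monoˡ-≤ (proj₁ K₀) K₁≥1) ⟩
        M + (proj₁ K₁ + proj₁ K₀) ≡⟨ cong (M +_) (sym K≡) ⟩
        M + K ≤⟨ M+K≤N ⟩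
        N ≡⟨ N≡ ⟩
        proj₁ N₁ + proj₁ N₀ ∎)
        where open ℕ.≤-Reasoning
      xs-near : All (λ x → Any (Piece x) L₁) xs
      xs-near = All.++⁺ (All.map (λ { {x} (_ , mx) → Count.cover c₁ (x , mx , Pc.refl) }) (Count.inP (proj₂ M-count)))
        (All.map⁺ (All.map (λ { {x} (_ , mx) → Count.cover c₁ (s ⟨ x ⟩ , mixed-s mx , Pc.refl) }) (Count.inP (proj₂ M-count))))
      length-xs : length xs ≡ M + M
      length-xs = trans (List.length-++ LV) (cong₂ _+_ (Count.len (proj₂ M-count)) (trans (List.length-map _ LV) (Count.len (proj₂ M-count))))
      bound : suc (suc (sum (map deg L₁))) ≤ 2 * length L₁
      bound = ℕ.≤-trans (ℕ.≤-reflexive (trans (cong (λ z → suc (suc z)) (trans (sum-degree piece-equivalence piece? xs (Count.indep c₁) xs-near) length-xs)) (reorder M)))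
        (ℕ.*-monoʳ-≤ 2 (ℕ.≤-trans M<N₁ (ℕ.≤-reflexive (sym (Count.len c₁)))))
        where
        reorder : ∀ a → suc (suc (a + a)) ≡ 2 * suc a
        reorder = solve-∀
      site : ∀ {f} → Mixed f → ∃ λ y → y ∈ xs × colour f ≡ colour y × Vertex f y
      site {f} mf with colour f Bool.≟ true
      ... | yes p = let y , i , (q , _) , v = rep (p , mf) in y , Mem.∈-++⁺ˡ i , trans p (sym q) , v
      ... | no n = let y , i , (q , my) , v = rep (trans mf (cong not (Bool.¬-not n)) , mixed-s mf)
                   in s ⟨ y ⟩ , Mem.∈-++⁺ʳ LV (Mem.∈-map⁺ (s ⟨_⟩) i) , trans (Bool.¬-not n) (sym (trans my (cong not q)))
                      , conn-s f ◅◅ v ◅◅ conn-s y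
      listed : ∀ {f r} → Mixed f → Piece f r → ∃ λ y → y ∈ filter (λ x → piece? x r) xs × Vertex f y
      listed {f} {r} mf p with site mf
      ... | y , i , e , v = y , Mem.∈-filter⁺ (λ x → piece? x r) i (Pc.trans (Pc.sym (vertex-piece e v)) p) , v
      positive : ∀ {r} → Near r → 1 ≤ deg r
      positive {r} (y , my , p) = nonempty (proj₁ (proj₂ (listed my (Pc.sym p))))
        where
        nonempty : ∀ {z} {zs : List X} → z ∈ zs → 1 ≤ length zs
        nonempty (here _) = s≤s z≤n
        nonempty (there _) = s≤s z≤n
      leaf : ∀ {r} → r ∈ L₁ → deg r ≡ 1 → Leaf r
      leaf {r} i e with All.lookup (Count.inP c₁) i
      ... | y , my , p = record { corner = y ; mixed = my ; inside = Pc.sym p ; single = λ mf mg pf pg →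
              same (listed mf pf) (listed mg pg) }
        where
        same : ∀ {f g} → (∃ λ y → y ∈ filter (λ x → piece? x r) xs × Vertex f y) →
          (∃ λ y → y ∈ filter (λ x → piece? x r) xs × Vertex g y) → Vertex f g
        same (a , ia , va) (b , ib , vb) with singleton-unique e ia ib
        ... | refl = va ◅◅ conn-sym vb
      pick : (∃ λ r → ∃ λ t → ¬ Piece r t × (r ∈ L₁ × deg r ≡ 1) × (t ∈ L₁ × deg t ≡ 1)) →
        ∃ λ r → ∃ λ t → ¬ Piece r t × Leaf r × Leaf t
      pick (r , t , ¬rt , (i , er) , (j , et)) = r , t , ¬rt , leaf i er , leaf j et

does⁻ : ∀ {P : Set} (d : Dec P) → does d ≡ true → P
does⁻ (yes p) _ = p

does⁻-false : ∀ {P : Set} (d : Dec P) → does d ≡ false → ¬ P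
does⁻-false (no n) _ = n

does⁺ : ∀ {P : Set} (d : Dec P) → P → does d ≡ true
does⁺ (yes _) _ = refl
does⁺ (no n) p = contradiction p n

does-⇔ : ∀ {P Q : Set} (d : Dec P) (e : Dec Q) → (P → Q) → (Q → P) → does d ≡ does e
does-⇔ (yes p) (yes q) f g = refl
does-⇔ (yes p) (no n) f g = contradiction (f p) n
does-⇔ (no n) (yes q) f g = contradiction (g q) n
does-⇔ (no _) (no _) f g = refl

-- Surgery at a leaf, and the genus consumed by one-sided leaves

module Splitting {m : ℕ} (A : Fin m → Bool) (s : Matching m) where

  open Colour A
  open Leaves s

  private
    X = Flag m
    ES = Fin m → Bool
    module Pc = IsEquivalence piece-equivalence

  -- `Z` is the set of flags on the face walk from `f` to `g`. Recording its closure properties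
  -- instead of the walk makes `closed-off` applicable to a matching changed by a second surgery
  -- elsewhere.
  record Cut (r : X) : Set₁ where
    field
      f g      : X
      mixed-f  : Mixed f
      mixed-g  : Mixed g
      piece-f  : Piece f r
      piece-g  : Piece g r
      f≢g      : f ≢ g
      vertex   : Vertex f g
      Z        : X → Set
      Z-f      : Z f
      Z-g      : Z g
      Z-σ0     : ∀ z → Z z → Z (σ0 z)
      Z-s      : ∀ z → Z z → z ≡ f ⊎ (z ≡ g ⊎ Z (s ⟨ z ⟩))
      Z-piece  : ∀ z → Z z → Piece z r

    same-colour : colour f ≡ colour g
    same-colour = trans (proj₁ piece-f) (sym (proj₁ piece-g))

    sf≢g : s ⟨ f ⟩ ≢ g
    sf≢g e = Bool.not-¬ (trans (sym same-colour) refl) (trans (cong colour (sym e)) mixed-f)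

    open Surgery s f g f≢g sf≢g public renaming (surg to s′)

    not-piece : ∀ {z} → Mixed z → Piece z r → ¬ Piece (s ⟨ z ⟩) r
    not-piece mz p q = Bool.not-¬ (trans (proj₁ q) (sym (proj₁ p))) mz

    -- The face walk from f to g stays in its own piece, hence is closed off by joining f to g.
    closed-off : ∀ (t : Matching m) {S₀ S₂} → t ⟨ f ⟩ ≡ g → t ⟨ g ⟩ ≡ f → (∀ z → Z z → z ≢ f → z ≢ g → t ⟨ z ⟩ ≡ s ⟨ z ⟩) →
      (∀ e → col (colour r) e ≡ true → S₂ e ≡ false) → ¬ Conn t S₀ S₂ f (s ⟨ f ⟩)
    closed-off t tf tg t≡s off c = not-piece mixed-f piece-f (Z-piece _ (conn-closed Z via-s (λ z _ → Z-σ0 z) via-2 c Z-f))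
      where
      via-s : ∀ z → Z z → Z (t ⟨ z ⟩)
      via-s z zz with z ≟F f | z ≟F g
      ... | yes refl | _ = subst Z (sym tf) Z-g
      ... | no _ | yes refl = subst Z (sym tg) Z-f
      ... | no a | no b = subst Z (sym (t≡s z zz a b)) ([ (λ e → contradiction e a) , [ (λ e → contradiction e b) , id ]′ ]′ (Z-s z zz))
      via-2 : ∀ z → _ → Z z → Z (σ2 z)
      via-2 z i zz = contradiction (trans (sym i) (off _ (col⁺ {colour r} {z} (proj₁ (Z-piece z zz))))) λ ()

    away-Z : ∀ z → Z z → z ≢ f → z ≢ g → s′ ⟨ z ⟩ ≡ s ⟨ z ⟩
    away-Z z zz a b = surg-away a b
      (λ { refl → not-piece mixed-f piece-f (Z-piece _ zz) }) (λ { refl → not-piece mixed-g piece-g (Z-piece _ zz) })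

    face-split : cnt s′ full none ≡ suc F
    face-split = surg-splits-cycle (λ _ → refl)
      (closed-off s′ (surg-f) (surg-g) away-Z (λ _ _ → refl))

    -- The face walk meets edges of the leaf's colour only, so it is also part of a boundary
    -- component of the spanning subgraph of that colour.
    colour-split : cnt s′ (col (colour r)) (col (not (colour r))) ≡ suc (cnt s (col (colour r)) (col (not (colour r))))
    colour-split = surg-splits-cycle (col-not (colour r))
      (closed-off s′ (surg-f) (surg-g) away-Z (λ e p → trans (col-not (colour r) e) (cong not p)))

    -- The vertex survives the surgery. Then no count with `σ2` on all edges changes, although a
    -- face is gained.
    OneSided : Set
    OneSided = Conn s′ none full f (s ⟨ f ⟩)

    one-sided-cnt : OneSided → ∀ S → cnt s′ S full ≡ cnt s S full
    one-sided-cnt o S = surg-same (conn-mono (λ _ ()) (λ _ → id) o) (vertex-⊆ vertex)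

  cut : ∀ {r} → Leaf r → Cut r
  cut {r} l = make (W.walk-support σ0-invol (invol s) w)
    where
    open Leaf l
    P : X → Bool
    P z = does (mixed? z)
    module W = Walks σ0 (s ⟨_⟩) P
    -- `σ0` comes first, so the walk sets out into the leaf and not across its mixed corner.
    w : W.Walk corner (W.run (4 * m) corner)
    w = W.walk-run σ0-invol (invol s) (λ z → does-⇔ (mixed? (s ⟨ z ⟩)) (mixed? z) (λ p → subst Mixed (invol s z) (mixed-s p)) mixed-s) (does⁺ (mixed? corner) mixed)
    g : X
    g = W.run (4 * m) corner
    mixed-g : Mixed g
    mixed-g = does⁻ (mixed? g) (W.walk-end w)
    make : (Σ (X → Set) λ Z → Z corner × Z g × (∀ z → Z z → Z (σ0 z))
        × (∀ z → Z z → z ≡ corner ⊎ (z ≡ g ⊎ Z (s ⟨ z ⟩)))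
        × (∀ (Q : X → Set) → (∀ x → Q x → Q (σ0 x)) → (∀ x → P x ≡ false → Q x → Q (s ⟨ x ⟩)) → Q corner → ∀ z → Z z → Q z)) → Cut r
    make (Z , zf , zg , z0 , zs , ind) = record
      { f = corner ; g = g ; mixed-f = mixed ; mixed-g = mixed-g ; piece-f = inside ; piece-g = in-piece g zg
      ; f≢g = λ e → walk-fpf σ0-invol (invol s) σ0-fpf (fpf s) w (sym e)
      ; vertex = single mixed mixed-g inside (in-piece g zg)
      ; Z = Z ; Z-f = zf ; Z-g = zg ; Z-σ0 = z0 ; Z-s = zs ; Z-piece = in-piece }
      where
      in-piece : ∀ z → Z z → Piece z r
      in-piece = ind (λ z → Piece z r) (λ z p → Pc.trans (refl , conn-sym (conn-0 z (col⁺ {colour z} {z} refl))) p)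
        (λ z u p → Pc.trans (Pc.sym (vertex-piece (unmixed (does⁻-false (mixed? z) u)) (conn-s z))) p) inside

  record Split : Set where
    field
      f g     : X
      mixed-f : Mixed f
      mixed-g : Mixed g
      same    : colour f ≡ colour g
      f≢g     : f ≢ g
      sf≢g    : s ⟨ f ⟩ ≢ g
      splits  : ¬ Conn (Surgery.surg s f g f≢g sf≢g) full full f (s ⟨ f ⟩)

  module _ (h₁ : 2 * K + m ≤ suc (V + F)) (h₂ : 2 * K + m ≤ suc (cnt s A (∁ A) + cnt s (∁ A) A)) where

    private
      euler : ∀ (t : Matching m) → cnt t none full + cnt t full none ≤ 2 * cnt t full full + m
      euler t = ℕ.≤-trans (genus-≥0 t full none (λ _ → refl)) (ℕ.≤-reflexive (cong (2 * cnt t full full +_) (#E-full {m})))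

      -- Raising `V + F` by two without a new component takes two units of genus, and `h₁` provides
      -- one.
      too-many : ∀ (t : Matching m) → suc (suc (V + F)) ≤ cnt t none full + cnt t full none → cnt t full full ≡ K → ⊥
      too-many t le e = ℕ.1+n≰n (ℕ.≤-trans le (ℕ.≤-trans (euler t) (ℕ.≤-trans (ℕ.≤-reflexive (cong (λ z → 2 * z + m) e)) h₁)))

      -- When vertex and face are both separated, `V + F` rises by two and `too-many` forces a new
      -- component.
      decide : ∀ {r} (c : Cut r) → Split ⊎ Cut.OneSided c
      decide c with conn? {s = Cut.s′ c} {none} {full} (Cut.f c) (s ⟨ Cut.f c ⟩)
      ... | yes o = inj₂ o
      ... | no ¬o = inj₁ (record { f = f ; g = g ; mixed-f = mixed-f ; mixed-g = mixed-g ; same = same-colour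
            ; f≢g = f≢g ; sf≢g = sf≢g ; splits = λ c → too-many s′ (ℕ.≤-reflexive (sym (trans (cong₂ _+_ vertex-split face-split)
                (cong suc (ℕ.+-suc V F))))) (surg-same c (vertex-⊆ vertex)) })
        where
        open Cut c
        vertex-split : cnt s′ none full ≡ suc V
        vertex-split = surg-splits-cycle (λ _ → refl) ¬o

      #col : #E (col true) + #E (col false) ≡ m
      #col = #E-∁ A

      -- Euler's inequality after the surgery: one more boundary component, with vertices and
      -- components of the leaf's colour unchanged.
      one-sided-genus : ∀ {r} (c : Cut r) → Cut.OneSided c →
        V + suc (cnt s (col (colour r)) (col (not (colour r)))) ≤ 2 * k (colour r) + #E (col (colour r))
      one-sided-genus {r} c o = subst₂ _≤_ (cong₂ _+_ (one-sided-cnt o none) colour-split)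
        (cong (λ z → 2 * z + #E (col (colour r))) (one-sided-cnt o (col (colour r))))
        (genus-≥0 s′ (col (colour r)) (col (not (colour r))) (col-not (colour r)))
        where open Cut c

      -- Each leaf sharpens the inequality of its own colour, and the two together contradict the
      -- genus of the dual, `h₂`.
      different : ∀ {r t} (c : Cut r) (d : Cut t) → colour r ≡ true → colour t ≡ false → Cut.OneSided c → Cut.OneSided d → ⊥
      different {r} {t} c d er et o q = genus-clash V K (cnt s A (∁ A)) (cnt s (∁ A) A) (k true) (k false) (#E (col true)) (#E (col false)) m
        (subst (λ b → V + suc (cnt s (col b) (col (not b))) ≤ 2 * k b + #E (col b)) er (one-sided-genus c o))
        (subst (λ b → V + suc (cnt s (col b) (col (not b))) ≤ 2 * k b + #E (col b)) et (one-sided-genus d q))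
        #col k-upper h₂

      -- Distinct pieces of one colour share no vertex, so both surgeries can be made. They add two
      -- faces without changing vertices or components, against the genus of the graph itself, `h₁`.
      alike : ∀ {r t} (c : Cut r) (d : Cut t) → ¬ Piece r t → colour r ≡ colour t → Cut.OneSided c → Cut.OneSided d → ⊥
      alike {r} {t} c d ¬rt e o q = too-many t₂ (ℕ.≤-reflexive (sym (trans (cong₂ _+_ (trans V₂ (C.one-sided-cnt o none)) (trans F₂ (cong suc C.face-split)))
          (trans (ℕ.+-suc V (suc F)) (cong suc (ℕ.+-suc V F))))))
          (trans K₂ (C.one-sided-cnt o full))
        where
        module C = Cut c
        module D = Cut d
        t₁ : Matching m
        t₁ = C.s′
        far : ∀ {x y} → Piece x r → Piece y t → ¬ Vertex x y
        far p p′ v = ¬rt (Pc.trans (Pc.sym p) (Pc.trans (vertex-piece (trans (proj₁ p) (trans e (sym (proj₁ p′)))) v) p′))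
        away₁ : ∀ {z} → Vertex D.f z → t₁ ⟨ z ⟩ ≡ s ⟨ z ⟩
        away₁ v = C.surg-away
          (λ { refl → far C.piece-f D.piece-f (conn-sym v) }) (λ { refl → far C.piece-g D.piece-f (conn-sym v) })
          (λ { refl → far C.piece-f D.piece-f (conn-s C.f ◅◅ conn-sym v) }) (λ { refl → far C.piece-g D.piece-f (conn-s C.g ◅◅ conn-sym v) })
        t₁f : t₁ ⟨ D.f ⟩ ≡ s ⟨ D.f ⟩
        t₁f = away₁ ε
        t₁g : t₁ ⟨ D.g ⟩ ≡ s ⟨ D.g ⟩
        t₁g = away₁ D.vertex
        t₁f≢g : t₁ ⟨ D.f ⟩ ≢ D.g
        t₁f≢g p = D.sf≢g (trans (sym t₁f) p)
        module S = Surgery t₁ D.f D.g D.f≢g t₁f≢g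
        t₂ : Matching m
        t₂ = S.surg
        t₂-away : ∀ {z} → t₁ ⟨ z ⟩ ≡ s ⟨ z ⟩ → z ≢ D.f → z ≢ D.g → z ≢ s ⟨ D.f ⟩ → z ≢ s ⟨ D.g ⟩ → t₂ ⟨ z ⟩ ≡ s ⟨ z ⟩
        t₂-away p a b c d = trans (S.surg-away a b (λ h → c (trans h t₁f)) (λ h → d (trans h t₁g))) p
        Z-away : ∀ z → D.Z z → z ≢ D.f → z ≢ D.g → t₂ ⟨ z ⟩ ≡ s ⟨ z ⟩
        Z-away z zz a b = t₂-away (C.surg-away
            (λ { refl → ¬rt (Pc.trans (Pc.sym C.piece-f) p) }) (λ { refl → ¬rt (Pc.trans (Pc.sym C.piece-g) p) })
            (λ { refl → Bool.not-¬ (trans (proj₁ p) (trans (sym e) (sym (proj₁ C.piece-f)))) C.mixed-f })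
            (λ { refl → Bool.not-¬ (trans (proj₁ p) (trans (sym e) (sym (proj₁ C.piece-g)))) C.mixed-g })) a b
          (λ { refl → D.not-piece D.mixed-f D.piece-f p }) (λ { refl → D.not-piece D.mixed-g D.piece-g p })
          where
          p : Piece z t
          p = D.Z-piece z zz
        F₂ : cnt t₂ full none ≡ suc (cnt t₁ full none)
        F₂ = S.surg-splits-cycle (λ _ → refl) (λ c → D.closed-off t₂
          (S.surg-f) (S.surg-g) Z-away (λ _ _ → refl) (subst (Conn t₂ full none D.f) t₁f c))
        -- One-sidedness of the second leaf is witnessed at its own vertex, where the first surgery
        -- changed nothing.
        q₂ : Conn t₂ none full D.f (t₁ ⟨ D.f ⟩)
        q₂ = subst (Conn t₂ none full D.f) (sym t₁f) (proj₂ (conn-⊆ {R = R} (λ v → v , ε) (λ f g v → let v₁ , c₁ = f v ; v₂ , c₂ = g v₁ in v₂ , c₁ ◅◅ c₂)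
            via-s (λ z ()) (λ z i v → v ◅◅ conn-2 z i , conn-2 z i) q ε))
          where
          R : X → X → Set
          R x y = Vertex D.f x → Vertex D.f y × Conn t₂ none full x y
          link : ∀ {x y} → t₂ ⟨ x ⟩ ≡ y → Conn t₂ none full x y
          link {x} p = subst (Conn t₂ none full x) p (conn-s x)
          via-s : ∀ z → R z (D.s′ ⟨ z ⟩)
          via-s z v with D.surg-view z
          ... | D.at-f refl rewrite D.surg-f = D.vertex , link (S.surg-f)
          ... | D.at-g refl rewrite D.surg-g = ε , link (S.surg-g)
          ... | D.at-f′ refl rewrite D.surg-f′ = D.vertex ◅◅ conn-s D.g
                , link (trans (cong (t₂ ⟨_⟩) (sym t₁f)) (trans (S.surg-f′) t₁g))
          ... | D.at-g′ refl rewrite D.surg-g′ = conn-s D.f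
                , link (trans (cong (t₂ ⟨_⟩) (sym t₁g)) (trans (S.surg-g′) t₁f))
          ... | D.away a b c d rewrite D.surg-away a b c d = v ◅◅ conn-s z , link (t₂-away (away₁ v) a b c d)
        V₂ : cnt t₂ none full ≡ cnt t₁ none full
        V₂ = S.surg-same q₂ (C.surg-⊇ o D.vertex)
        K₂ : cnt t₂ full full ≡ cnt t₁ full full
        K₂ = S.surg-same (conn-mono (λ _ ()) (λ _ → id) q₂)
          (conn-mono (λ _ ()) (λ _ → id) (C.surg-⊇ o D.vertex))

      clash : ∀ {r t} (c : Cut r) (d : Cut t) → ¬ Piece r t → Cut.OneSided c → Cut.OneSided d → ⊥
      clash {r} {t} c d ¬rt o q with colour r Bool.≟ true | colour t Bool.≟ true
      ... | yes p | yes p′ = alike c d ¬rt (trans p (sym p′)) o q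
      ... | yes p | no n = different c d p (Bool.¬-not n) o q
      ... | no n | yes p = different d c p (Bool.¬-not n) q o
      ... | no n | no n′ = alike c d ¬rt (trans (Bool.¬-not n) (sym (Bool.¬-not n′))) o q

    split : ∀ {x} → Mixed x → Split
    split mx = from (two-leaves (parity-bound V K (cnt s A (∁ A)) (cnt s (∁ A) A) (k true) (k false) (#E (col true)) (#E (col false)) m
        (genus-≥0 s (col true) (∁ A) (λ _ → refl)) (genus-≥0 s (col false) A (λ e → sym (Bool.not-involutive _))) #col h₂) mx)
      where
      from : (∃ λ r → ∃ λ t → ¬ Piece r t × Leaf r × Leaf t) → Split
      from (r , t , ¬rt , lr , lt) = either (decide (cut lr)) (decide (cut lt))
        where
        either : Split ⊎ Cut.OneSided (cut lr) → Split ⊎ Cut.OneSided (cut lt) → Split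
        either (inj₁ sp) _ = sp
        either (inj₂ _) (inj₁ sp) = sp
        either (inj₂ o) (inj₂ q) = ⊥-elim (clash (cut lr) (cut lt) ¬rt o q)

-- Resolving all mixed corners

countB-∨ : ∀ {X : Set} {p q r : X → Bool} → (∀ x → p x ≡ true → q x ≡ true ⊎ r x ≡ true) → ∀ xs →
  countB p xs ≤ countB q xs + countB r xs
countB-∨ h [] = z≤n
countB-∨ {p = p} {q} {r} h (x ∷ xs) with p x | q x | r x | h x | countB-∨ h xs
... | false | false | false | _ | ih = ih
... | false | true | false | _ | ih = ℕ.m≤n⇒m≤1+n ih
... | false | false | true | _ | ih = ℕ.≤-trans ih (ℕ.+-monoʳ-≤ _ (ℕ.n≤1+n _))
... | false | true | true | _ | ih = ℕ.m≤n⇒m≤1+n (ℕ.≤-trans ih (ℕ.+-monoʳ-≤ _ (ℕ.n≤1+n _)))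
... | true | true | false | _ | ih = s≤s ih
... | true | true | true | _ | ih = s≤s (ℕ.≤-trans ih (ℕ.+-monoʳ-≤ _ (ℕ.n≤1+n _)))
... | true | false | true | _ | ih = ℕ.≤-trans (s≤s ih) (ℕ.≤-reflexive (sym (ℕ.+-suc _ _)))
... | true | false | false | k | ih = ⊥-elim ([ (λ ()) , (λ ()) ]′ (k refl))

module _ {m : ℕ} where

  private X = Flag m

  countB-≡ : ∀ (y : X) {xs} → Unique xs → countB (λ x → does (x ≟F y)) xs ≤ 1
  countB-≡ y [] = z≤n
  countB-≡ y {x ∷ xs} (n ∷ u) with x ≟F y
  ... | no _ = countB-≡ y u
  ... | yes refl = s≤s (ℕ.≤-reflexive (none-of xs n))
    where
    none-of : ∀ xs → All (y ≢_) xs → countB (λ x → does (x ≟F y)) xs ≡ 0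
    none-of [] [] = refl
    none-of (x ∷ xs) (n ∷ ns) with x ≟F y
    ... | yes e = contradiction (sym e) n
    ... | no _ = none-of xs ns

  countB-∈ : ∀ ys → countB (λ x → elemB x ys) flags ≤ length ys
  countB-∈ [] = ℕ.≤-reflexive (never flags)
    where
    never : ∀ xs → countB {X} (λ x → false) xs ≡ 0
    never [] = refl
    never (x ∷ xs) = never xs
  countB-∈ (y ∷ ys) = ℕ.≤-trans (countB-∨ {q = λ x → does (x ≟F y)} {λ x → elemB x ys} cases flags)
    (ℕ.+-mono-≤ (countB-≡ y flags-unique) (countB-∈ ys))
    where
    cases : ∀ x → elemB x (y ∷ ys) ≡ true → does (x ≟F y) ≡ true ⊎ elemB x ys ≡ true
    cases x p with elemB-∈ {x = x} {y ∷ ys} p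
    ... | here e = inj₁ (does⁺ (x ≟F y) e)
    ... | there i = inj₂ (∈-elemB i)

  differ : Matching m → Matching m → X → Bool
  differ s t x = not (does (t ⟨ x ⟩ ≟F s ⟨ x ⟩))

  differ⁺ : ∀ {s t x} → t ⟨ x ⟩ ≢ s ⟨ x ⟩ → differ s t x ≡ true
  differ⁺ {s} {t} {x} n with t ⟨ x ⟩ ≟F s ⟨ x ⟩
  ... | yes e = contradiction e n
  ... | no _ = refl

  differ⁻ : ∀ {s t x} → differ s t x ≡ true → t ⟨ x ⟩ ≢ s ⟨ x ⟩
  differ⁻ {s} {t} {x} p with t ⟨ x ⟩ ≟F s ⟨ x ⟩
  ... | no n = n

module Resolve {m : ℕ} (A : Fin m → Bool) (s : Matching m) where

  open Colour A
  open Leaves using (Mixed; mixed?; unmixed)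

  private X = Flag m

  -- By `comm`, `t` carries corners of `s` to corners of `s`. In `bound`, a surgery changes at most
  -- four flags and adds one component; at the start no flag differs and there is one component,
  -- hence the summand 4.
  record Resolution : Set where
    field
      t     : Matching m
      comm  : ∀ x → t ⟨ s ⟨ x ⟩ ⟩ ≡ s ⟨ t ⟨ x ⟩ ⟩
      pure  : ∀ x → colour (t ⟨ x ⟩) ≡ colour x
      bound : countB (differ s t) flags + 4 ≤ 4 * cnt t full full

  private
    record State (t : Matching m) : Set where
      field
        comm  : ∀ x → t ⟨ s ⟨ x ⟩ ⟩ ≡ s ⟨ t ⟨ x ⟩ ⟩
        -- A mixed corner has not been touched yet, so it is still a corner of `s`; this makes the
        -- next surgery commute with `s`.
        old   : ∀ x → Mixed t x → t ⟨ x ⟩ ≡ s ⟨ x ⟩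
        bound : countB (differ s t) flags + 4 ≤ 4 * cnt t full full
        h₁    : 2 * cnt t full full + m ≤ suc (cnt t none full + cnt t full none)
        h₂    : 2 * cnt t full full + m ≤ suc (cnt t A (∁ A) + cnt t (∁ A) A)

    mixed# : Matching m → ℕ
    mixed# t = countB (λ x → does (mixed? t x)) flags

    resolve : ∀ n t → mixed# t ≤ n → State t → Resolution
    resolve n t le st with Any.any? (mixed? t) flags
    ... | no none = record { t = t ; comm = State.comm st ; bound = State.bound st
                           ; pure = λ x → sym (unmixed t λ mx → none (lose (∈-flags x) mx)) }
    ... | yes a = next n le (Splitting.split A t (State.h₁ st) (State.h₂ st) (proj₂ (proj₂ (find a))))
      where
      open State st
      next : ∀ n → mixed# t ≤ n → Splitting.Split A t → Resolution
      next n le sp = go n le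
        where
        open Splitting.Split sp
        open Surgery t f g f≢g sf≢g renaming (surg to u)
        tf : t ⟨ f ⟩ ≡ s ⟨ f ⟩
        tf = old f mixed-f
        tg : t ⟨ g ⟩ ≡ s ⟨ g ⟩
        tg = old g mixed-g
        same′ : colour (t ⟨ f ⟩) ≡ colour (t ⟨ g ⟩)
        same′ = trans mixed-f (trans (cong not same) (sym mixed-g))
        mixed-u : ∀ x → Mixed u x → Mixed t x × u ⟨ x ⟩ ≡ t ⟨ x ⟩
        mixed-u x mx with surg-view x
        ... | at-f refl = contradiction mx (Bool.not-¬ (trans (cong colour (surg-f)) (sym same)))
        ... | at-g refl = contradiction mx (Bool.not-¬ (trans (cong colour (surg-g)) same))
        ... | at-f′ refl = contradiction mx (Bool.not-¬ (trans (cong colour (surg-f′)) (sym same′)))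
        ... | at-g′ refl = contradiction mx (Bool.not-¬ (trans (cong colour (surg-g′)) same′))
        ... | away a b c d = trans (cong colour (sym e)) mx , e
          where e = surg-away a b c d
        f-pure : ¬ Mixed u f
        f-pure mx = contradiction mx (Bool.not-¬ (trans (cong colour (surg-f)) (sym same)))
        fewer : suc (mixed# u) ≤ mixed# t
        fewer = countB-strict (λ x p → does⁺ (mixed? t x) (proj₁ (mixed-u x (does⁻ (mixed? u x) p)))) (∈-flags f)
          (≢true⇒false λ p → f-pure (does⁻ (mixed? u f) p)) (does⁺ (mixed? t f) mixed-f)
        s-inj : ∀ {x y} → s ⟨ x ⟩ ≡ s ⟨ y ⟩ → x ≡ y
        s-inj {x} {y} e = trans (sym (invol s x)) (trans (cong (s ⟨_⟩) e) (invol s y))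
        comm′ : ∀ x → u ⟨ s ⟨ x ⟩ ⟩ ≡ s ⟨ u ⟨ x ⟩ ⟩
        comm′ x with surg-view x
        ... | at-f refl = trans (cong (u ⟨_⟩) (sym tf)) (trans (surg-f′) (trans tg (cong (s ⟨_⟩) (sym (surg-f)))))
        ... | at-g refl = trans (cong (u ⟨_⟩) (sym tg)) (trans (surg-g′) (trans tf (cong (s ⟨_⟩) (sym (surg-g)))))
        ... | at-f′ refl = trans (cong (u ⟨_⟩) (trans (cong (s ⟨_⟩) tf) (invol s f))) (trans (surg-f)
                (sym (trans (cong (s ⟨_⟩) (trans (surg-f′) tg)) (invol s g))))
        ... | at-g′ refl = trans (cong (u ⟨_⟩) (trans (cong (s ⟨_⟩) tg) (invol s g))) (trans (surg-g)
                (sym (trans (cong (s ⟨_⟩) (trans (surg-g′) tf)) (invol s f))))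
        ... | away a b c d = trans (surg-away
                (λ e → c (trans (s-inj (trans e (sym (invol s f)))) (sym tf))) (λ e → d (trans (s-inj (trans e (sym (invol s g)))) (sym tg)))
                (λ e → a (s-inj (trans e tf))) (λ e → b (s-inj (trans e tg))))
                (trans (comm x) (cong (s ⟨_⟩) (sym (surg-away a b c d))))
        -- A surgery that disconnects the graph separates `f` from `t ⟨ f ⟩` in every finer relation
        -- too. So the counts in `h₁` and `h₂` all rise by one along with the components, and both
        -- bounds persist.
        cyc : ∀ {S S′} → (∀ e → S′ e ≡ not (S e)) → cnt u S S′ ≡ suc (cnt t S S′)
        cyc comp = surg-splits-cycle comp (λ c → splits (conn-mono (λ _ _ → refl) (λ _ _ → refl) c))
        K′ : cnt u full full ≡ suc (cnt t full full)
        K′ = surg-splits splits (conn-mono (λ _ ()) (λ _ → id) (surg-cycle {S = none} {S′ = full} (λ _ → refl)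
          (λ c → splits (conn-mono (λ _ ()) (λ _ → id) c))))
        shift : ∀ {v w} → 2 * cnt t full full + m ≤ suc (v + w) → 2 * suc (cnt t full full) + m ≤ suc (suc v + suc w)
        shift {v} {w} h = ℕ.≤-trans (ℕ.≤-reflexive (e₁ (cnt t full full) m)) (ℕ.≤-trans (s≤s (s≤s h)) (ℕ.≤-reflexive (e₂ v w)))
          where
          e₁ : ∀ a b → 2 * suc a + b ≡ suc (suc (2 * a + b))
          e₁ = solve-∀
          e₂ : ∀ a b → suc (suc (suc (a + b))) ≡ suc (suc a + suc b)
          e₂ = solve-∀
        changed : List X
        changed = f ∷ g ∷ t ⟨ f ⟩ ∷ t ⟨ g ⟩ ∷ []
        differ′ : ∀ x → differ s u x ≡ true → differ s t x ≡ true ⊎ elemB x changed ≡ true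
        differ′ x p with surg-view x
        ... | at-f e = inj₂ (∈-elemB {x = x} {changed} (here e))
        ... | at-g e = inj₂ (∈-elemB {x = x} {changed} (there (here e)))
        ... | at-f′ e = inj₂ (∈-elemB {x = x} {changed} (there (there (here e))))
        ... | at-g′ e = inj₂ (∈-elemB {x = x} {changed} (there (there (there (here e)))))
        ... | away a b c d = inj₁ (differ⁺ {s = s} {t} λ e → differ⁻ {s = s} {u} p (trans (surg-away a b c d) e))
        bound′ : countB (differ s u) flags + 4 ≤ 4 * suc (cnt t full full)
        bound′ = ℕ.≤-trans (ℕ.+-monoˡ-≤ 4 (ℕ.≤-trans (countB-∨ differ′ flags) (ℕ.+-monoʳ-≤ _ (countB-∈ changed))))
          (ℕ.≤-trans (ℕ.+-monoˡ-≤ 4 bound) (ℕ.≤-reflexive (trans (ℕ.+-comm _ 4) (sym (ℕ.*-suc 4 _)))))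
        state : State u
        state = record
          { comm = comm′
          ; old = λ x mx → let mt , e = mixed-u x mx in trans e (old x mt)
          ; bound = subst (λ z → countB (differ s u) flags + 4 ≤ 4 * z) (sym K′) bound′
          ; h₁ = subst₂ (λ a b → 2 * a + m ≤ suc b) (sym K′) (sym (cong₂ _+_ (cyc (λ _ → refl)) (cyc (λ _ → refl)))) (shift h₁)
          ; h₂ = subst₂ (λ a b → 2 * a + m ≤ suc b) (sym K′) (sym (cong₂ _+_ (cyc (λ _ → refl)) (cyc (λ e → sym (Bool.not-involutive _))))) (shift h₂) }
        go : ∀ n → mixed# t ≤ n → Resolution
        go zero le = ⊥-elim (ℕ.n≮0 (ℕ.≤-trans fewer le))
        go (suc n) le = resolve n u (ℕ.≤-pred (ℕ.≤-trans fewer le)) state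

  resolution : cnt s full full ≡ 1 → 2 + m ≤ suc (cnt s none full + cnt s full none) →
    2 + m ≤ suc (cnt s A (∁ A) + cnt s (∁ A) A) → Resolution
  resolution K h₁ h₂ = resolve (mixed# s) s ℕ.≤-refl (record
    { comm = λ _ → refl ; old = λ _ _ → refl
    ; bound = subst (λ z → countB (differ s s) flags + 4 ≤ 4 * z) (sym K) (ℕ.≤-reflexive (cong (_+ 4) (agree flags)))
    ; h₁ = subst (λ z → 2 * z + m ≤ suc (cnt s none full + cnt s full none)) (sym K) h₁
    ; h₂ = subst (λ z → 2 * z + m ≤ suc (cnt s A (∁ A) + cnt s (∁ A) A)) (sym K) h₂ })
    where
    agree : ∀ xs → countB (differ s s) xs ≡ 0
    agree [] = refl
    agree (x ∷ xs) with s ⟨ x ⟩ ≟F s ⟨ x ⟩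
    ... | yes _ = agree xs
    ... | no n = contradiction refl n

-- Joins, and the order in which the components of a resolution are joined

unique-⊆-length : ∀ {X : Set} {xs ys : List X} → Unique xs → All (_∈ ys) xs → length xs ≤ length ys
unique-⊆-length {X} {xs} {ys} u sub = Fin.injective⇒≤ {f = ix} inj
  where
  equ : IsEquivalence (_≡_ {A = X})
  equ = record { refl = refl ; sym = sym ; trans = trans }
  at : ∀ i → lookup xs i ∈ ys
  at i = All.lookup sub (Mem.∈-lookup i)
  ix : Fin (length xs) → Fin (length ys)
  ix i = Any.index (at i)
  inj : ∀ {i j} → ix i ≡ ix j → i ≡ j
  inj {i} {j} e = indep-injective equ u i j (trans (Any.lookup-result (at i)) (trans (cong (lookup ys) e) (sym (Any.lookup-result (at j)))))

small-of : ∀ {X : Set} (d : X → ℕ) L → sum (map d L) + 4 ≤ 4 * length L → ∃ λ r → r ∈ L × d r ≤ 3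
small-of d [] ()
small-of d (r ∷ L) h with d r ℕ.≤? 3
... | yes p = r , here refl , p
... | no n with small-of d L (ℕ.+-cancelˡ-≤ 4 _ _ (ℕ.≤-trans (ℕ.≤-reflexive (sym (ℕ.+-assoc 4 _ 4))) (ℕ.≤-trans (ℕ.+-monoˡ-≤ 4 (ℕ.+-monoˡ-≤ (sum (map d L)) (ℕ.≰⇒> n))) (ℕ.≤-trans h (ℕ.≤-reflexive (ℕ.*-suc 4 _))))))
... | t , i , q = t , there i , q

infixr 6 _∪_
_∪_ : ∀ {m} → (Fin m → Bool) → (Fin m → Bool) → Fin m → Bool
(P ∪ Q) e = P e ∨ Q e

-- A join read off at its corners: in the subgraph with edges `P ∪ Q` exactly two of them lead from
-- `P` to `Q`. That both lie at one vertex follows from `joined-p₁p₂`.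
record Joined {m : ℕ} (s : Matching m) (P Q : Fin m → Bool) : Set where
  field
    disjoint : ∀ e → P e ≡ true → Q e ≡ false
    p₁ p₂    : Flag m
    p₁∈P     : P ∋ p₁
    p₂∈P     : P ∋ p₂
    p₁→Q     : Q ∋ restr s (P ∪ Q) ⟨ p₁ ⟩
    p₂→Q     : Q ∋ restr s (P ∪ Q) ⟨ p₂ ⟩
    p₁≢p₂    : p₁ ≢ p₂
    only     : ∀ {x} → P ∋ x → Q ∋ restr s (P ∪ Q) ⟨ x ⟩ → x ≡ p₁ ⊎ x ≡ p₂

module Peel {m : ℕ} (s t : Matching m) where

  private
    X = Flag m
    ES = Fin m → Bool

  infix 4 _~_
  _~_ : X → X → Set
  _~_ = Conn t full full

  base-conn : ∀ {u : Matching m} (x : X) → Conn u full full x (edge x , false , false)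
  base-conn (e , false , false) = ε
  base-conn (e , false , true) = conn-2 _ refl
  base-conn (e , true , false) = conn-0 _ refl
  base-conn (e , true , true) = conn-0 _ refl ◅◅ conn-2 _ refl

  abstract
    cls : X → ES
    cls r e = does (conn? {s = t} {full} {full} (e , false , false) r)

    cls⁻ : ∀ {r x} → cls r ∋ x → x ~ r
    cls⁻ {r} {x} p = base-conn x ◅◅ does⁻ (conn? _ _) p

    cls⁺ : ∀ {r x} → x ~ r → cls r ∋ x
    cls⁺ {r} {x} c = does⁺ (conn? _ _) (conn-sym (base-conn x) ◅◅ c)

    ⋃ : List X → ES
    ⋃ [] e = false
    ⋃ (r ∷ L) e = ⋃ L e ∨ cls r e

    ⋃⁻ : ∀ {L x} → ⋃ L ∋ x → Any (x ~_) L
    ⋃⁻ {r ∷ L} {x} p with ∨-true {⋃ L (edge x)} p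
    ... | inj₁ q = there (⋃⁻ {L} {x} q)
    ... | inj₂ q = here (cls⁻ {r} {x} q)

    ⋃⁺ : ∀ {L x} → Any (x ~_) L → ⋃ L ∋ x
    ⋃⁺ {r ∷ L} {x} (here c) = ∨-trueʳ {⋃ L (edge x)} (cls⁺ {r} {x} c)
    ⋃⁺ {r ∷ L} {x} (there a) = ∨-trueˡ (⋃⁺ {L} {x} a)

  ⋃-∷⁻ : ∀ {r L e} → ⋃ (r ∷ L) e ≡ true → ⋃ L e ≡ true ⊎ cls r e ≡ true
  ⋃-∷⁻ {r} {L} {e} p with ⋃⁻ {r ∷ L} {e , false , false} p
  ... | here c = inj₂ (cls⁺ {r} {e , false , false} c)
  ... | there a = inj₁ (⋃⁺ {L} {e , false , false} a)

  ⋃-∷ˡ : ∀ {r L e} → ⋃ L e ≡ true → ⋃ (r ∷ L) e ≡ true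
  ⋃-∷ˡ {r} {L} {e} p = ⋃⁺ {r ∷ L} {e , false , false} (there (⋃⁻ {L} {e , false , false} p))

  ⋃-∷ʳ : ∀ {r L e} → cls r e ≡ true → ⋃ (r ∷ L) e ≡ true
  ⋃-∷ʳ {r} {L} {e} p = ⋃⁺ {r ∷ L} {e , false , false} (here (cls⁻ {r} {e , false , false} p))

  -- The component of `r` in `t`, though produced by surgeries, is then the ribbon subgraph of `s`
  -- with the same edges.
  Good : X → Set
  Good r = ∀ {x} → cls r ∋ x → restr s (cls r) ⟨ x ⟩ ≡ t ⟨ x ⟩

  -- The head of the list is the part joined last.
  data Ordered : List X → Set where
    one  : ∀ {r} → Good r → Ordered (r ∷ [])
    more : ∀ {q L} → Good q → Joined s (⋃ L) (cls q) → Ordered L → Ordered (q ∷ L)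

  private
    Indep : List X → Set
    Indep = AllPairs (λ a b → ¬ (a ~ b))

    bad : List X → X → Bool
    bad L x = ⋃ L (edge x) ∧ differ (restr s (⋃ L)) t x

    bad⁺ : ∀ {L x} → ⋃ L ∋ x → t ⟨ x ⟩ ≢ restr s (⋃ L) ⟨ x ⟩ → bad L x ≡ true
    bad⁺ {L} {x} p n = cong₂ _∧_ p (differ⁺ {s = restr s (⋃ L)} {t} {x} n)

    bad⁻ : ∀ {L x} → bad L x ≡ true → ⋃ L ∋ x × t ⟨ x ⟩ ≢ restr s (⋃ L) ⟨ x ⟩
    bad⁻ {L} {x} p with Equivalence.to (Bool.T-∧ {⋃ L (edge x)}) (≡⇒T p)
    ... | a , b = T⇒≡ a , differ⁻ {s = restr s (⋃ L)} {t} {x} (T⇒≡ b)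

    -- `bound` keeps the average number of bad flags below four per class. Hence some class has at
    -- most three, and this class plays the leaf of the tree.
    record Stage (L : List X) : Set where
      field
        indep : Indep L
        conn  : ∀ {x y} → ⋃ L ∋ x → ⋃ L ∋ y → Conn (restr s (⋃ L)) full full x y
        comm  : ∀ {x} → ⋃ L ∋ x → t ⟨ restr s (⋃ L) ⟨ x ⟩ ⟩ ≡ restr s (⋃ L) ⟨ t ⟨ x ⟩ ⟩
        bound : countB (bad L) flags + 4 ≤ 4 * length L

    -- r has at most three bad flags; t pairs them up, so they are q₁ and q₂ = t q₁.
    module Step {L : List X} (st : Stage L) {r : X} (r∈L : r ∈ L)
      (few : length (filter (λ x → conn? {s = t} {full} {full} x r) (filterᵇ (bad L) flags)) ≤ 3)
      {L′ : List X} (len : length L ≡ suc (length L′)) (indep′ : Indep L′) (far : All (λ z → ¬ (r ~ z)) L′)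
      (sub : ∀ {Q : X → Set} → All Q L → All Q L′) (cov : ∀ {z} → Any (z ~_) L → Any (z ~_) L′ ⊎ z ~ r)
      {y : X} (y∈L′ : y ∈ L′) where

      open Stage st

      u : Matching m
      u = restr s (⋃ L)

      P Q : ES
      P = ⋃ L′
      Q = cls r

      P⊆ : ∀ {x} → P ∋ x → ⋃ L ∋ x
      P⊆ {x} p with find (⋃⁻ {L′} {x} p)
      ... | z , z∈ , c = ⋃⁺ {L} {x} (lose (All.lookup (sub (All.tabulate id)) z∈) c)

      Q⊆ : ∀ {x} → Q ∋ x → ⋃ L ∋ x
      Q⊆ {x} q = ⋃⁺ {L} {x} (lose r∈L (cls⁻ {r} {x} q))

      PQ : ∀ {x} → ⋃ L ∋ x → P ∋ x ⊎ Q ∋ x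
      PQ {x} p with cov (⋃⁻ {L} {x} p)
      ... | inj₁ a = inj₁ (⋃⁺ {L′} {x} a)
      ... | inj₂ c = inj₂ (cls⁺ {r} {x} c)

      disj : ∀ {x} → P ∋ x → Q ∋ x → ⊥
      disj {x} p q with find (⋃⁻ {L′} {x} p)
      ... | z , z∈ , c = All.lookup far z∈ (conn-sym (cls⁻ {r} {x} q) ◅◅ c)

      ∉Q : ∀ {x} → P ∋ x → Q (edge x) ≡ false
      ∉Q {x} p = ≢true⇒false (disj {x} p)

      ∉P : ∀ {x} → Q ∋ x → P (edge x) ≡ false
      ∉P {x} q = ≢true⇒false (λ p → disj {x} p q)

      ¬Q⇒P : ∀ {x} → ⋃ L ∋ x → Q (edge x) ≡ false → P ∋ x
      ¬Q⇒P {x} p n = [ id , (λ q → ⊥-elim (true≢false q n)) ]′ (PQ {x} p)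

      tQ : ∀ {x} → Q ∋ x → Q ∋ t ⟨ x ⟩
      tQ {x} q = cls⁺ {r} {t ⟨ x ⟩} (conn-sym (conn-s x) ◅◅ cls⁻ {r} {x} q)

      tP : ∀ {x} → P ∋ x → P ∋ t ⟨ x ⟩
      tP {x} p = ⋃⁺ {L′} {t ⟨ x ⟩} (Any.map (conn-sym (conn-s x) ◅◅_) (⋃⁻ {L′} {x} p))

      u∈ : ∀ {x} → ⋃ L ∋ x → ⋃ L ∋ u ⟨ x ⟩
      u∈ {x} = restr-∋ s (⋃ L) {x}

      abstract
        -- `y` belongs to another class, so connectedness forces a corner that leads out of `Q`.
        exit : ∃ λ z → Q ∋ z × Q (edge (u ⟨ z ⟩)) ≡ false
        exit with Colour.Leaves.crossing Q u (conn {r} {y} (Q⊆ {r} r∈Q) (P⊆ {y} y∈P)) (trans (∉Q {y} y∈P) (cong not (sym r∈Q)))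
          where
          r∈Q : Q ∋ r
          r∈Q = cls⁺ {r} {r} ε
          y∈P : P ∋ y
          y∈P = ⋃⁺ {L′} {y} (lose y∈L′ ε)
        ... | z , _ , p , q = z , trans p (cls⁺ {r} {r} ε) , trans q (cong not (trans p (cls⁺ {r} {r} ε)))

      q₁ q₂ p₁ p₂ : X
      q₁ = proj₁ exit
      q₂ = t ⟨ q₁ ⟩
      p₁ = u ⟨ q₁ ⟩
      p₂ = u ⟨ q₂ ⟩

      q₁∈Q : Q ∋ q₁
      q₁∈Q = proj₁ (proj₂ exit)

      q₂∈Q : Q ∋ q₂
      q₂∈Q = tQ {q₁} q₁∈Q

      p₁∈P : P ∋ p₁
      p₁∈P = ¬Q⇒P {p₁} (u∈ {q₁} (Q⊆ {q₁} q₁∈Q)) (proj₂ (proj₂ exit))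

      tp₁ : t ⟨ p₁ ⟩ ≡ p₂
      tp₁ = comm {q₁} (Q⊆ {q₁} q₁∈Q)

      p₂∈P : P ∋ p₂
      p₂∈P = subst (λ z → P ∋ z) tp₁ (tP {p₁} p₁∈P)

      up₁ : u ⟨ p₁ ⟩ ≡ q₁
      up₁ = invol u q₁

      up₂ : u ⟨ p₂ ⟩ ≡ q₂
      up₂ = invol u q₂

      q₁≢q₂ : q₁ ≢ q₂
      q₁≢q₂ e = fpf t q₁ (sym e)

      p₁≢p₂ : p₁ ≢ p₂
      p₁≢p₂ e = fpf t p₁ (trans tp₁ (sym e))

      leaves-Q : ∀ {x} → Q ∋ x → Q (edge (u ⟨ x ⟩)) ≡ false → t ⟨ x ⟩ ≢ u ⟨ x ⟩
      leaves-Q {x} q n e = true≢false (tQ {x} q) (trans (cong (Q ∘ edge) e) n)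

      bad-Q : ∀ {x} → Q ∋ x → t ⟨ x ⟩ ≢ u ⟨ x ⟩ →
        x ∈ filter (λ x → conn? {s = t} {full} {full} x r) (filterᵇ (bad L) flags)
      bad-Q {x} q n = Mem.∈-filter⁺ _ (Mem.∈-filter⁺ _ (∈-flags x) (≡⇒T (bad⁺ {L} {x} (Q⊆ {x} q) n))) (cls⁻ {r} {x} q)

      bad-t : ∀ {x} → ⋃ L ∋ x → t ⟨ x ⟩ ≢ u ⟨ x ⟩ → t ⟨ t ⟨ x ⟩ ⟩ ≢ u ⟨ t ⟨ x ⟩ ⟩
      bad-t {x} i n e = n (trans (sym (invol t (t ⟨ x ⟩))) (trans (cong (t ⟨_⟩) (trans e (sym (comm {x} i)))) (invol t (u ⟨ x ⟩))))

      bad-q₁ : t ⟨ q₁ ⟩ ≢ u ⟨ q₁ ⟩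
      bad-q₁ = leaves-Q {q₁} q₁∈Q (proj₂ (proj₂ exit))

      only-Q : ∀ {x} → Q ∋ x → t ⟨ x ⟩ ≢ u ⟨ x ⟩ → x ≡ q₁ ⊎ x ≡ q₂
      only-Q {x} q n with x ≟F q₁ | x ≟F q₂
      ... | yes e | _ = inj₁ e
      ... | no _ | yes e = inj₂ e
      ... | no a | no b = ⊥-elim (ℕ.1+n≰n (ℕ.≤-trans (unique-⊆-length {xs = x ∷ t ⟨ x ⟩ ∷ q₁ ∷ q₂ ∷ []}
              (((λ e → fpf t x (sym e)) ∷ a ∷ b ∷ []) ∷ ((λ e → b (swap e)) ∷ (λ e → a (trans (swap e) (invol t q₁))) ∷ []) ∷ (q₁≢q₂ ∷ []) ∷ [] ∷ [])
              (bad-Q {x} q n ∷ bad-Q {t ⟨ x ⟩} (tQ {x} q) (bad-t {x} (Q⊆ {x} q) n) ∷ bad-Q {q₁} q₁∈Q bad-q₁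
                ∷ bad-Q {q₂} q₂∈Q (bad-t {q₁} (Q⊆ {q₁} q₁∈Q) bad-q₁) ∷ [])) few))
        where
        swap : ∀ {z} → t ⟨ x ⟩ ≡ z → x ≡ t ⟨ z ⟩
        swap e = trans (sym (invol t x)) (cong (t ⟨_⟩) e)

      exits-Q : ∀ {x} → Q ∋ x → Q (edge (u ⟨ x ⟩)) ≡ false → x ≡ q₁ ⊎ x ≡ q₂
      exits-Q {x} q n = only-Q {x} q (leaves-Q {x} q n)

      exits-P : ∀ {x} → P ∋ x → P (edge (u ⟨ x ⟩)) ≡ false → x ≡ p₁ ⊎ x ≡ p₂
      exits-P {x} p n with PQ {u ⟨ x ⟩} (u∈ {x} (P⊆ {x} p))
      ... | inj₁ i = ⊥-elim (true≢false i n)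
      ... | inj₂ i = [ (λ e → inj₁ (swap e)) , (λ e → inj₂ (swap e)) ]′
              (exits-Q {u ⟨ x ⟩} i (trans (cong (Q ∘ edge) (invol u x)) (∉Q {x} p)))
        where
        swap : ∀ {z} → u ⟨ x ⟩ ≡ z → x ≡ u ⟨ z ⟩
        swap e = trans (sym (invol u x)) (cong (u ⟨_⟩) e)

      good : Good r
      good {x} q = trans (sym (restr-restr s (⋃ L) Q (λ e i → Q⊆ {e , false , false} i) x)) (via (Q (edge (u ⟨ x ⟩)) Bool.≟ true))
        where
        only₂ : ∀ {x} → Q ∋ x → Q (edge (u ⟨ x ⟩)) ≡ false → x ≡ q₂ ⊎ x ≡ q₁
        only₂ {x} q n = [ inj₂ , inj₁ ]′ (exits-Q {x} q n)
        via : Dec (Q ∋ u ⟨ x ⟩) → restr u Q ⟨ x ⟩ ≡ t ⟨ x ⟩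
        via (no n) with exits-Q {x} q (≢true⇒false n)
        ... | inj₁ refl = restr-exit u Q q₁∈Q (≢true⇒false n) (λ {x} → exits-Q {x})
        ... | inj₂ refl = trans (restr-exit u Q q₂∈Q (≢true⇒false n) (λ {x} → only₂ {x})) (sym (invol t q₁))
        via (yes i) with t ⟨ x ⟩ ≟F u ⟨ x ⟩
        ... | yes e = trans (restr-id u Q q i) (sym e)
        ... | no n with only-Q {x} q n
        ... | inj₁ refl = ⊥-elim (true≢false i (proj₂ (proj₂ exit)))
        ... | inj₂ refl = ⊥-elim (disj {p₂} p₂∈P i)

      u′ : Matching m
      u′ = restr s P

      u′-restr : ∀ x → u′ ⟨ x ⟩ ≡ restr u P ⟨ x ⟩
      u′-restr x = sym (restr-restr s (⋃ L) P (λ e i → P⊆ {e , false , false} i) x)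

      -- With `Q` removed, the two flags of `P` that faced it become partners, as they are in `t`
      -- already; so they cease to be bad and `comm` persists.
      u′p₁ : u′ ⟨ p₁ ⟩ ≡ p₂
      u′p₁ = trans (u′-restr p₁) (restr-exit u P p₁∈P (trans (cong (P ∘ edge) up₁) (∉P {q₁} q₁∈Q)) (λ {x} → exits-P {x}))

      u′p₂ : u′ ⟨ p₂ ⟩ ≡ p₁
      u′p₂ = trans (cong (u′ ⟨_⟩) (sym u′p₁)) (invol u′ p₁)

      u′-else : ∀ {x} → P ∋ x → x ≢ p₁ → x ≢ p₂ → u′ ⟨ x ⟩ ≡ u ⟨ x ⟩ × P ∋ u ⟨ x ⟩
      u′-else {x} p a b with P (edge (u ⟨ x ⟩)) in i
      ... | true = trans (u′-restr x) (restr-id u P p i) , refl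
      ... | false = ⊥-elim ([ a , b ]′ (exits-P {x} p i))

      comm′ : ∀ {x} → P ∋ x → t ⟨ u′ ⟨ x ⟩ ⟩ ≡ u′ ⟨ t ⟨ x ⟩ ⟩
      comm′ {x} p with x ≟F p₁ | x ≟F p₂
      ... | yes refl | _ = trans (cong (t ⟨_⟩) (trans u′p₁ (sym tp₁))) (trans (invol t p₁) (trans (sym u′p₂) (cong (u′ ⟨_⟩) (sym tp₁))))
      ... | no _ | yes refl = trans (cong (t ⟨_⟩) u′p₂) (trans tp₁ (trans (sym u′p₁) (cong (u′ ⟨_⟩) (sym tp₂))))
        where
        tp₂ : t ⟨ p₂ ⟩ ≡ p₁
        tp₂ = trans (cong (t ⟨_⟩) (sym tp₁)) (invol t p₁)
      ... | no a | no b = trans (cong (t ⟨_⟩) (proj₁ (u′-else {x} p a b))) (trans (comm {x} (P⊆ {x} p))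
              (sym (proj₁ (u′-else {t ⟨ x ⟩} (tP {x} p) (λ e → b (trans (swap e) tp₁)) (λ e → a (trans (swap e) (trans (cong (t ⟨_⟩) (sym tp₁)) (invol t p₁))))))))
        where
        swap : ∀ {z} → t ⟨ x ⟩ ≡ z → x ≡ t ⟨ z ⟩
        swap e = trans (sym (invol t x)) (cong (t ⟨_⟩) e)

      conn′ : ∀ {x y} → P ∋ x → P ∋ y → Conn u′ full full x y
      conn′ {x} {y} px py = proj₁ (conn-closed Inv via-s (λ z _ (a , b) → (λ i → a i ◅◅ conn-0 z refl) , b)
          (λ z _ (a , b) → (λ i → a i ◅◅ conn-2 z refl) , b) (conn {x} {y} (P⊆ {x} px) (P⊆ {y} py)) ((λ _ → ε) , λ n → ⊥-elim (true≢false px n))) py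
        where
        -- A detour through `Q` leaves and re-enters `P` only at `p₁` and `p₂`, which `u′` pairs.
        -- During the detour it is enough to remember that `p₁` has been reached.
        Inv : X → Set
        Inv z = (P ∋ z → Conn u′ full full x z) × (P (edge z) ≡ false → Q ∋ z → Conn u′ full full x p₁)
        p₁p₂ : Conn u′ full full p₁ p₂
        p₁p₂ = subst (Conn u′ full full p₁) u′p₁ (conn-s p₁)
        toP₁ : ∀ {z} → z ≡ p₁ ⊎ z ≡ p₂ → Conn u′ full full z p₁
        toP₁ (inj₁ refl) = ε
        toP₁ (inj₂ refl) = conn-sym p₁p₂
        via-s : ∀ z → Inv z → Inv (u ⟨ z ⟩)
        via-s z (a , b) = onP , onQ
          where
          onP : P ∋ u ⟨ z ⟩ → Conn u′ full full x (u ⟨ z ⟩)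
          onP i with P (edge z) in j
          ... | true = a refl ◅◅ subst (Conn u′ full full z) (trans (u′-restr z) (restr-id u P j i)) (conn-s z)
          ... | false = b refl q ◅◅ conn-sym (toP₁ (exits-P {u ⟨ z ⟩} i (trans (cong (P ∘ edge) (invol u z)) j)))
            where
            q : Q ∋ z
            q = [ (λ p → ⊥-elim (true≢false p j)) , id ]′ (PQ {z} (subst (λ w → ⋃ L ∋ w) (invol u z) (u∈ {u ⟨ z ⟩} (P⊆ {u ⟨ z ⟩} i))))
          onQ : P (edge (u ⟨ z ⟩)) ≡ false → Q ∋ u ⟨ z ⟩ → Conn u′ full full x p₁
          onQ n i with P (edge z) in j
          ... | true = a refl ◅◅ toP₁ (exits-P {z} j n)
          ... | false = b refl ([ (λ p → ⊥-elim (true≢false p j)) , id ]′ (PQ {z} (subst (λ w → ⋃ L ∋ w) (invol u z) (u∈ {u ⟨ z ⟩} (Q⊆ {u ⟨ z ⟩} i)))))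

      -- Four flags leave the bad list, two on either side of the join, while the number of classes
      -- drops by one.
      bound′ : countB (bad L′) flags + 4 ≤ 4 * length L′
      bound′ = ℕ.+-cancelˡ-≤ 4 _ _ (ℕ.≤-trans (ℕ.≤-reflexive (sym (ℕ.+-assoc 4 _ 4))) (ℕ.≤-trans (ℕ.+-monoˡ-≤ 4 (subst₂ (λ a b → 4 + a ≤ b)
          (sym (countB-filter (bad L′) flags)) (sym (countB-filter (bad L) flags))
          (unique-⊆-length {xs = p₁ ∷ p₂ ∷ q₁ ∷ q₂ ∷ filterᵇ (bad L′) flags} uniq incl)))
          (ℕ.≤-trans bound (ℕ.≤-reflexive (trans (cong (4 *_) len) (ℕ.*-suc 4 _))))))
        where
        inner : ∀ {x} → x ∈ filterᵇ (bad L′) flags → P ∋ x × (x ≢ p₁ × x ≢ p₂)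
        inner {x} i with bad⁻ {L′} {x} (T⇒≡ (proj₂ (Mem.∈-filter⁻ _ {xs = flags} i)))
        ... | p , n = p , (λ { refl → n (trans tp₁ (sym u′p₁)) })
                        , (λ { refl → n (trans (trans (cong (t ⟨_⟩) (sym tp₁)) (invol t p₁)) (sym u′p₂)) })
        ≢PQ : ∀ {a b} → P ∋ a → Q ∋ b → a ≢ b
        ≢PQ {a} p q refl = disj {a} p q
        uniq : Unique (p₁ ∷ p₂ ∷ q₁ ∷ q₂ ∷ filterᵇ (bad L′) flags)
        uniq = (p₁≢p₂ ∷ ≢PQ p₁∈P q₁∈Q ∷ ≢PQ p₁∈P q₂∈Q ∷ All.tabulate (λ i e → proj₁ (proj₂ (inner i)) (sym e)))
          ∷ (≢PQ p₂∈P q₁∈Q ∷ ≢PQ p₂∈P q₂∈Q ∷ All.tabulate (λ i e → proj₂ (proj₂ (inner i)) (sym e)))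
          ∷ (q₁≢q₂ ∷ All.tabulate (λ i e → ≢PQ (proj₁ (inner i)) q₁∈Q (sym e)))
          ∷ All.tabulate (λ i e → ≢PQ (proj₁ (inner i)) q₂∈Q (sym e))
          ∷ Unique.filter⁺ _ flags-unique
        isBad : ∀ {x} → ⋃ L ∋ x → t ⟨ x ⟩ ≢ u ⟨ x ⟩ → x ∈ filterᵇ (bad L) flags
        isBad {x} i n = Mem.∈-filter⁺ _ (∈-flags x) (≡⇒T (bad⁺ {L} {x} i n))
        leaves-P : ∀ {x q} → P ∋ x → Q ∋ q → u ⟨ x ⟩ ≡ q → t ⟨ x ⟩ ≢ u ⟨ x ⟩
        leaves-P {x} {q} p qq e e′ = disj {q} (subst (λ z → P ∋ z) (trans e′ e) (tP {x} p)) qq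
        incl : All (_∈ filterᵇ (bad L) flags) (p₁ ∷ p₂ ∷ q₁ ∷ q₂ ∷ filterᵇ (bad L′) flags)
        incl = isBad (P⊆ {p₁} p₁∈P) (leaves-P p₁∈P q₁∈Q up₁) ∷ isBad (P⊆ {p₂} p₂∈P) (leaves-P p₂∈P q₂∈Q up₂)
          ∷ isBad (Q⊆ {q₁} q₁∈Q) bad-q₁ ∷ isBad (Q⊆ {q₂} q₂∈Q) (bad-t {q₁} (Q⊆ {q₁} q₁∈Q) bad-q₁)
          ∷ All.tabulate more-bad
          where
          more-bad : ∀ {x} → x ∈ filterᵇ (bad L′) flags → x ∈ filterᵇ (bad L) flags
          more-bad {x} i = let p , a , b = inner i in isBad {x} (P⊆ {x} p) (λ e →
            proj₂ (bad⁻ {L′} {x} (T⇒≡ (proj₂ (Mem.∈-filter⁻ _ {xs = flags} i)))) (trans e (sym (proj₁ (u′-else {x} p a b)))))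

      stage′ : Stage L′
      stage′ = record { indep = indep′ ; conn = λ {x} {y} → conn′ {x} {y} ; comm = λ {x} → comm′ {x} ; bound = bound′ }

      -- `P′` will be the union of the list that the recursion returns, which equals `P` only
      -- pointwise.
      joined : ∀ {P′ : ES} → (∀ e → P′ e ≡ P e) → Joined s P′ Q
      joined {P′} h = record
        { disjoint = λ e p → ∉Q {e , false , false} (trans (sym (h e)) p)
        ; p₁ = p₁ ; p₂ = p₂ ; p₁∈P = trans (h _) p₁∈P ; p₂∈P = trans (h _) p₂∈P
        ; p₁→Q = subst (λ z → Q ∋ z) (sym (trans (same p₁) up₁)) q₁∈Q
        ; p₂→Q = subst (λ z → Q ∋ z) (sym (trans (same p₂) up₂)) q₂∈Q
        ; p₁≢p₂ = p₁≢p₂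
        ; only = λ {x} p q → exits-P {x} (trans (sym (h _)) p) (∉P {u ⟨ x ⟩} (subst (λ z → Q ∋ z) (same x) q)) }
        where
        same : ∀ x → restr s (P′ ∪ Q) ⟨ x ⟩ ≡ u ⟨ x ⟩
        same = restr-cong s λ e → bool-≡
          (λ p → [ (λ i → P⊆ {e , false , false} (trans (sym (h e)) i)) , Q⊆ {e , false , false} ]′ (∨-true {P′ e} p))
          (λ p → [ (λ i → ∨-trueˡ (trans (h e) i)) , ∨-trueʳ {P′ e} ]′ (PQ {e , false , false} p))

    Result : List X → Set
    Result L = Σ (List X) λ L* → Indep L* × (∀ e → ⋃ L* e ≡ ⋃ L e) × Ordered L*

    peel : ∀ n L → length L ≡ suc n → Stage L → Result L
    -- With a single class left, the bound admits no bad flag at all.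
    peel zero (r ∷ []) refl st = r ∷ [] , [] ∷ [] , (λ _ → refl) , one good
      where
      open Stage st
      empty : countB (bad (r ∷ [])) flags ≡ 0
      empty = ℕ.n≤0⇒n≡0 (ℕ.+-cancelʳ-≤ 4 _ _ bound)
      good : Good r
      good {x} q with t ⟨ x ⟩ ≟F restr s (⋃ (r ∷ [])) ⟨ x ⟩
      ... | yes e = trans (restr-cong s single x) (sym e)
        where
        only : ∀ {e} → Any ((e , false , false) ~_) (r ∷ []) → cls r e ≡ true
        only {e} (here c) = cls⁺ {r} {e , false , false} c
        single : ∀ e → cls r e ≡ ⋃ (r ∷ []) e
        single e = bool-≡ (λ i → ⋃⁺ {r ∷ []} {e , false , false} (here (cls⁻ {r} {e , false , false} i)))
          (λ i → only (⋃⁻ {r ∷ []} {e , false , false} i))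
      ... | no n = ⊥-elim (ℕ.n≮0 (subst (1 ≤_) empty (ℕ.≤-trans (s≤s z≤n) (countB-strict {p = λ _ → false} (λ _ ()) (∈-flags x) refl
              (bad⁺ {r ∷ []} {x} (⋃⁺ {r ∷ []} {x} (here (cls⁻ {r} {x} q))) n)))))
    peel (suc n) L len st = from (small-of deg L bound′)
      where
      open Stage st
      xs : List X
      xs = filterᵇ (bad L) flags
      deg : X → ℕ
      deg = degree conn-equivalence (conn? {s = t} {full} {full}) xs
      bound′ : sum (map deg L) + 4 ≤ 4 * length L
      bound′ = subst (λ z → z + 4 ≤ 4 * length L) (trans (countB-filter (bad L) flags) (sym (sum-degree conn-equivalence conn? xs indep
        (All.tabulate λ {x} i → ⋃⁻ {L} {x} (proj₁ (bad⁻ {L} {x} (T⇒≡ (proj₂ (Mem.∈-filter⁻ _ {xs = flags} i))))))))) bound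
      from : (∃ λ r → r ∈ L × deg r ≤ 3) → Result L
      from (r , r∈L , few) = continue (remove-class conn-equivalence r L indep (lose r∈L ε))
        where
        continue : (Σ (List X) λ ys → length L ≡ suc (length ys) × Indep ys × All (λ z → ¬ (r ~ z)) ys
          × (∀ {Q : X → Set} → All Q L → All Q ys) × (∀ {z} → Any (z ~_) L → Any (z ~_) ys ⊎ z ~ r)) → Result L
        continue ([] , l , _) = contradiction (ℕ.suc-injective (trans (sym len) l)) λ ()
        continue (y ∷ L′ , l , indep′ , far , sub , cov) = finish (peel n (y ∷ L′) (ℕ.suc-injective (trans (sym l) len)) S.stage′)
          where
          module S = Step st r∈L few l indep′ far sub cov (here {xs = L′} (refl {x = y}))
          finish : Result (y ∷ L′) → Result L
          finish (L* , i , h , o) = r ∷ L* , All.tabulate (λ {z} z∈ c → S.disj {z} (trans (sym (h _)) (⋃⁺ {L*} {z} (lose z∈ ε))) (cls⁺ {r} {z} (conn-sym c))) ∷ i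
            , (λ e → bool-≡
                (λ p → [ (λ j → S.P⊆ {e , false , false} (trans (sym (h e)) j)) , S.Q⊆ {e , false , false} ]′ (⋃-∷⁻ {r} {L*} p))
                (λ p → [ (λ j → ⋃-∷ˡ {r} {L*} (trans (h e) j)) , ⋃-∷ʳ {r} {L*} ]′ (S.PQ {e , false , false} p)))
            , more S.good (S.joined h) o

  order : (∀ x → t ⟨ s ⟨ x ⟩ ⟩ ≡ s ⟨ t ⟨ x ⟩ ⟩) → (∀ x y → Conn s full full x y) → Flag m →
    countB (differ s t) flags + 4 ≤ 4 * cnt t full full →
    Σ (List X) λ L → AllPairs (λ a b → ¬ (a ~ b)) L × (∀ x → Any (x ~_) L) × Ordered L
  order comm conn x₀ bound = start (Count.reps c) refl
    where
    c = cnt-count t full full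
    L₀ = Count.reps c
    everything : ∀ e → ⋃ L₀ e ≡ true
    everything e = ⋃⁺ {L₀} {e , false , false} (Count.cover c tt)
    same : ∀ x → restr s (⋃ L₀) ⟨ x ⟩ ≡ s ⟨ x ⟩
    same x = restr-id s (⋃ L₀) (everything _) (everything _)
    stage : Stage L₀
    stage = record
      { indep = Count.indep c
      ; conn = λ {x} {y} _ _ → conn-⊆ ε _◅◅_ (λ z → subst (Conn (restr s (⋃ L₀)) full full z) (same z) (conn-s z)) conn-0 conn-2 (conn x y)
      ; comm = λ {x} _ → trans (cong (t ⟨_⟩) (same x)) (trans (comm x) (sym (same _)))
      ; bound = ℕ.≤-trans (ℕ.+-monoˡ-≤ 4 (countB-mono (λ x p → differ⁺ {s = s} {t} {x} λ e →
            proj₂ (bad⁻ {L₀} {x} p) (trans e (sym (same x)))) flags))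
          (ℕ.≤-trans bound (ℕ.≤-reflexive (cong (4 *_) (sym (Count.len c))))) }
    start : ∀ L → L ≡ L₀ → Σ (List X) λ L → AllPairs (λ a b → ¬ (a ~ b)) L × (∀ x → Any (x ~_) L) × Ordered L
    start [] e = contradiction (subst (Any (x₀ ~_)) (sym e) (Count.cover c tt)) λ ()
    start (r ∷ L) refl′ with peel (length L) L₀ (cong length (sym refl′)) stage
    ... | L* , i , h , o = L* , i , (λ x → ⋃⁻ {L*} {x} (trans (h _) (everything _))) , o

-- Additivity under joins

module _ {m : ℕ} where

  private
    X = Flag m
    ES = Fin m → Bool

  module _ {s : Matching m} {P Q : ES} (j : Joined s P Q) where

    open Joined j

    private
      U : ES
      U = P ∪ Q

      u : Matching m
      u = restr s U

      P⊆U : ∀ {x} → P ∋ x → U ∋ x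
      P⊆U = ∨-trueˡ

      Q⊆U : ∀ {x} → Q ∋ x → U ∋ x
      Q⊆U {x} = ∨-trueʳ {P (edge x)}

      ∉Q : ∀ {x} → P ∋ x → Q (edge x) ≡ false
      ∉Q p = disjoint _ p

      clash : ∀ {x} → P ∋ x → Q ∋ x → ⊥
      clash p q = true≢false q (disjoint _ p)

      q₁ q₂ : X
      q₁ = u ⟨ p₁ ⟩
      q₂ = u ⟨ p₂ ⟩

      up₁≢p₂ : q₁ ≢ p₂
      up₁≢p₂ e = clash {p₂} p₂∈P (subst (λ z → Q ∋ z) e p₁→Q)

      -- This surgery undoes the join: `v` is the restriction to `P` on the flags of `P` and the
      -- restriction to `Q` on those of `Q`.
      open Surgery u p₁ p₂ p₁≢p₂ up₁≢p₂ renaming (surg to v)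

      exits-P : ∀ {x} → P ∋ x → P (edge (u ⟨ x ⟩)) ≡ false → x ≡ p₁ ⊎ x ≡ p₂
      exits-P {x} p n = only p ([ (λ i → ⊥-elim (true≢false i n)) , id ]′ (∨-true {P (edge (u ⟨ x ⟩))} (restr-∋ s U (P⊆U {x} p))))

      exits-Q : ∀ {x} → Q ∋ x → Q (edge (u ⟨ x ⟩)) ≡ false → x ≡ q₁ ⊎ x ≡ q₂
      exits-Q {x} q n = [ (λ e → inj₁ (swap e)) , (λ e → inj₂ (swap e)) ]′ (only
          ([ id , (λ i → ⊥-elim (true≢false i n)) ]′ (∨-true {P (edge (u ⟨ x ⟩))} (restr-∋ s U (Q⊆U {x} q))))
          (subst (λ z → Q ∋ z) (sym (invol u x)) q))
        where
        swap : ∀ {z} → u ⟨ x ⟩ ≡ z → x ≡ u ⟨ z ⟩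
        swap e = trans (sym (invol u x)) (cong (u ⟨_⟩) e)

      restr-P : ∀ x → restr u P ⟨ x ⟩ ≡ restr s P ⟨ x ⟩
      restr-P = restr-restr s U P (λ e → ∨-trueˡ)

      restr-Q : ∀ x → restr u Q ⟨ x ⟩ ≡ restr s Q ⟨ x ⟩
      restr-Q = restr-restr s U Q (λ e → ∨-trueʳ {P e})

    joined-p₁p₂ : restr (restr s (P ∪ Q)) P ⟨ p₁ ⟩ ≡ p₂
    joined-p₁p₂ = restr-exit u P p₁∈P (≢true⇒false λ i → clash {q₁} i p₁→Q) exits-P

    private
      pq₁ : restr u Q ⟨ q₁ ⟩ ≡ q₂
      pq₁ = restr-exit u Q p₁→Q (trans (cong (Q ∘ edge) (invol u p₁)) (∉Q {p₁} p₁∈P)) exits-Q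

      v-P : ∀ {x} → P ∋ x → restr s P ⟨ x ⟩ ≡ v ⟨ x ⟩
      v-P {x} p with surg-view x
      ... | at-f refl = trans (sym (restr-P p₁)) (trans joined-p₁p₂ (sym (surg-f)))
      ... | at-g refl = trans (sym (restr-P p₂)) (trans (trans (cong (restr u P ⟨_⟩) (sym joined-p₁p₂)) (invol (restr u P) p₁)) (sym (surg-g)))
      ... | at-f′ refl = ⊥-elim (clash {q₁} p p₁→Q)
      ... | at-g′ refl = ⊥-elim (clash {q₂} p p₂→Q)
      ... | away a b c d = trans (sym (restr-P x)) (trans (restr-id u P p stay) (sym (surg-away a b c d)))
        where
        stay : P ∋ u ⟨ x ⟩
        stay with P (edge (u ⟨ x ⟩)) in i
        ... | true = refl
        ... | false = ⊥-elim ([ a , b ]′ (exits-P {x} p i))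

      v-Q : ∀ {x} → Q ∋ x → restr s Q ⟨ x ⟩ ≡ v ⟨ x ⟩
      v-Q {x} q with surg-view x
      ... | at-f refl = ⊥-elim (clash {p₁} p₁∈P q)
      ... | at-g refl = ⊥-elim (clash {p₂} p₂∈P q)
      ... | at-f′ refl = trans (sym (restr-Q q₁)) (trans pq₁ (sym (surg-f′)))
      ... | at-g′ refl = trans (sym (restr-Q q₂)) (trans (trans (cong (restr u Q ⟨_⟩) (sym pq₁)) (invol (restr u Q) q₁)) (sym (surg-g′)))
      ... | away a b c d = trans (sym (restr-Q x)) (trans (restr-id u Q q stay) (sym (surg-away a b c d)))
        where
        stay : Q ∋ u ⟨ x ⟩
        stay with Q (edge (u ⟨ x ⟩)) in i
        ... | true = refl
        ... | false = ⊥-elim ([ c , d ]′ (exits-Q {x} q i))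

      vP : ∀ {x} → P ∋ x → P ∋ v ⟨ x ⟩
      vP {x} p = subst (λ z → P ∋ z) (v-P {x} p) (restr-∋ s P p)

      vQ : ∀ {x} → Q ∋ x → Q ∋ v ⟨ x ⟩
      vQ {x} q = subst (λ z → Q ∋ z) (v-Q {x} q) (restr-∋ s Q q)

      Off : X → Set
      Off x = U (edge x) ≡ false

      u-off : ∀ {x} → Off x → v ⟨ x ⟩ ≡ u ⟨ x ⟩
      u-off {x} n = surg-away (not-U (P⊆U {p₁} p₁∈P)) (not-U (P⊆U {p₂} p₂∈P)) (not-U (Q⊆U {q₁} p₁→Q)) (not-U (Q⊆U {q₂} p₂→Q))
        where
        not-U : ∀ {z} → U ∋ z → x ≢ z
        not-U i refl = true≢false i n

      stays : ∀ {w S₀ S₂} (B : ES) → (∀ {x} → B ∋ x → B ∋ w ⟨ x ⟩) → ∀ {x y} → Conn w S₀ S₂ x y → B ∋ x → B ∋ y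
      stays B cl = conn-closed (B ∋_) (λ x → cl {x}) (λ _ _ → id) (λ _ _ → id)

      offU : ES
      offU e = not (U e)

      u-stays-off : ∀ {x} → offU ∋ x → offU ∋ u ⟨ x ⟩
      u-stays-off {x} n = subst (λ z → offU ∋ z) (sym (restr-∌ s U (trans (sym (Bool.not-involutive _)) (cong not n)))) n

      split-off : ∀ {w S₀ S₂ n k} → (∀ {x} → U ∋ x → U ∋ w ⟨ x ⟩) →
        Count (Conn w S₀ S₂) (U ∋_) n → Count (Conn w S₀ S₂) (offU ∋_) k → cnt w S₀ S₂ ≡ n + k
      split-off {w} {S₀} {S₂} cl c d = count-split conn-equivalence (λ x → U (edge x) Bool.≟ true) (stays U (λ {x} → cl {x})) c
        (record { Count d ; inP = All.map (λ n p → true≢false p (trans (sym (Bool.not-involutive _)) (cong not n))) (Count.inP d)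
                ; cover = λ n → Count.cover d (cong not (≢true⇒false n)) }) (cnt-count w S₀ S₂)

    -- Over all flags the surgery adds one class, since it separates `p₁` from its neighbour in `Q`.
    -- The isolated edges outside `P ∪ Q` contribute the same before and after, and cancel.
    nn-joined : ∀ S S′ → (∀ e → S′ e ≡ not (S e)) → suc (nn s (P ∪ Q) S S′) ≡ nn s P S S′ + nn s Q S S′
    nn-joined S S′ comp = ℕ.+-cancelʳ-≡ (proj₁ off) _ _ (trans (sym (cong suc cnt-u)) (trans (sym more) cnt-v))
      where
      count-on : ∀ w (B : ES) → ∃ λ n → Count (Conn w S S′) (B ∋_) n
      count-on w B = count-exists conn-equivalence conn? flags ∈-flags (λ x → B (edge x) Bool.≟ true)
      off : ∃ λ n → Count (Conn u S S′) (offU ∋_) n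
      off = count-on u offU
      cnt-u : cnt u S S′ ≡ nn s U S S′ + proj₁ off
      cnt-u = split-off {u} (λ {x} → restr-∋ s U {x}) (nn-count s U S S′) (proj₂ off)
      off-v : Count (Conn v S S′) (offU ∋_) (proj₁ off)
      off-v = subst (Count (Conn v S S′) (offU ∋_)) (count-≡ conn-equivalence conn-equivalence id id
        (λ p _ d → proj₂ (conn-agree offU (λ {x} n → vu {x} n) (λ {x} n → subst (λ z → offU ∋ z) (sym (vu {x} n)) (u-stays-off {x} n)) (λ _ _ → id) (λ _ _ → id) p d))
        (λ p _ d → proj₂ (conn-agree offU (λ {x} n → sym (vu {x} n)) (λ {x} → u-stays-off {x}) (λ _ _ → id) (λ _ _ → id) p d))
        (proj₂ (count-on v offU)) (proj₂ off)) (proj₂ (count-on v offU))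
        where
        vu : ∀ {x} → offU ∋ x → v ⟨ x ⟩ ≡ u ⟨ x ⟩
        vu {x} n = u-off {x} (trans (sym (Bool.not-involutive _)) (cong not n))
      on-P : Count (Conn v S S′) (P ∋_) (nn s P S S′)
      on-P = subst (Count (Conn v S S′) (P ∋_)) (nn-unique {s = s} {v} {P} (λ {x} → v-P {x}) (proj₂ (count-on v P))) (proj₂ (count-on v P))
      on-Q : Count (Conn v S S′) (Q ∋_) (nn s Q S S′)
      on-Q = subst (Count (Conn v S S′) (Q ∋_)) (nn-unique {s = s} {v} {Q} (λ {x} → v-Q {x}) (proj₂ (count-on v Q))) (proj₂ (count-on v Q))
      on-U : Count (Conn v S S′) (U ∋_) (nn s P S S′ + nn s Q S S′)
      on-U = count-++ conn-equivalence (λ {x} → P⊆U {x}) (λ {x} → Q⊆U {x})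
        (λ {x} i → [ (λ p → inj₁ (x , p , ε)) , (λ q → inj₂ (x , q , ε)) ]′ (∨-true {P (edge x)} i))
        (λ {x} {y} p q d → clash {y} (stays P (λ {x} → vP {x}) d p) q) on-P on-Q
      cnt-v : cnt v S S′ ≡ nn s P S S′ + nn s Q S S′ + proj₁ off
      cnt-v = split-off {v} (λ {x} i → [ (λ p → P⊆U {v ⟨ x ⟩} (vP {x} p)) , (λ q → Q⊆U {v ⟨ x ⟩} (vQ {x} q)) ]′ (∨-true {P (edge x)} i)) on-U off-v
      more : cnt v S S′ ≡ suc (cnt u S S′)
      more = surg-splits-cycle comp (λ c → clash {q₁} (stays P (λ {x} → vP {x}) c p₁∈P) p₁→Q)

    #E-joined : #E (P ∪ Q) ≡ #E P + #E Q
    #E-joined = go (allFin m)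
      where
      go : ∀ es → countB (P ∪ Q) es ≡ countB P es + countB Q es
      go [] = refl
      go (e ∷ es) with P e in p | Q e in q
      ... | true | true = contradiction (trans (sym q) (disjoint e p)) λ ()
      ... | true | false = cong suc (go es)
      ... | false | true = trans (cong suc (go es)) (sym (ℕ.+-suc _ _))
      ... | false | false = go es

-- Euler genus of ribbon subgraphs and of partial duals

mat : (G : RibbonGraph) → Matching (nE G)
mat G = record { fn = σ1 G ; invol = σ1-invol G ; fpf = σ1-fpf G }

-- The spanning subgraphs of B with edge sets B ∩ D and B ∖ D have together 2 + |B| - g
-- boundary components; for D = full these are the faces and the vertices of B.
HasGenus : ∀ {m} → Matching m → (B D : Fin m → Bool) → ℕ → Set
HasGenus s B D g = nn s B D (∁ D) + nn s B (∁ D) D + g ≡ 2 + #E B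

hasGenus-cong : ∀ {m} {s : Matching m} {B B′ D g} → (∀ e → B e ≡ B′ e) → HasGenus s B D g → HasGenus s B′ D g
hasGenus-cong {m} {g = g} h p = trans (cong (_+ g) (cong₂ _+_ (sym (nn-cong h)) (sym (nn-cong h)))) (trans p (cong (2 +_) (countB-cong h (allFin m))))

-- Both counts of the join are one short of the sum over `P` and `Q`, which absorbs the second 2 in
-- the equations for the parts.
hasGenus-joined : ∀ {m} {s : Matching m} {P Q D g h} → Joined s P Q → HasGenus s P D g → HasGenus s Q D h → HasGenus s (P ∪ Q) D (g + h)
hasGenus-joined {s = s} {P} {Q} {D} {g} {h} j p q = ℕ.+-cancelˡ-≡ 2 _ _ (begin
  2 + (a + b + (g + h)) ≡⟨ e₁ a b g h ⟩
  suc a + suc b + (g + h) ≡⟨ cong₂ (λ x y → x + y + (g + h)) (nn-joined j D (∁ D) (λ _ → refl)) (nn-joined j (∁ D) D (λ e → sym (Bool.not-involutive _))) ⟩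
  (aP + aQ) + (bP + bQ) + (g + h) ≡⟨ e₂ aP aQ bP bQ g h ⟩
  (aP + bP + g) + (aQ + bQ + h) ≡⟨ cong₂ _+_ p q ⟩
  (2 + #E P) + (2 + #E Q) ≡⟨ e₃ (#E P) (#E Q) ⟩
  2 + (2 + (#E P + #E Q)) ≡⟨ cong (λ z → 2 + (2 + z)) (sym (#E-joined j)) ⟩
  2 + (2 + #E (P ∪ Q)) ∎)
  where
  open ≡-Reasoning
  a = nn s (P ∪ Q) D (∁ D)
  b = nn s (P ∪ Q) (∁ D) D
  aP = nn s P D (∁ D)
  bP = nn s P (∁ D) D
  aQ = nn s Q D (∁ D)
  bQ = nn s Q (∁ D) D
  e₁ : ∀ a b g h → 2 + (a + b + (g + h)) ≡ suc a + suc b + (g + h)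
  e₁ = solve-∀
  e₂ : ∀ a b c d g h → (a + b) + (c + d) + (g + h) ≡ (a + c + g) + (b + d + h)
  e₂ = solve-∀
  e₃ : ∀ a b → (2 + a) + (2 + b) ≡ 2 + (2 + (a + b))
  e₃ = solve-∀

-- On a monochromatic part `A` acts as `full` or as `none`, so its two counts are the faces and the
-- vertices in one order or the other. Partial duality thus leaves the genus of the part alone.
hasGenus-pure : ∀ {m} {s : Matching m} {B A g c} → (∀ e → B e ≡ true → A e ≡ c) → HasGenus s B full g → HasGenus s B A g
hasGenus-pure {g = g} {true} h p = trans (cong (_+ g) (cong₂ _+_ (nn-agree h (λ e b → cong not (h e b))) (nn-agree (λ e b → cong not (h e b)) h))) p
hasGenus-pure {s = s} {B} {g = g} {false} h p = trans (cong (_+ g) (trans (cong₂ _+_ (nn-agree h (λ e b → cong not (h e b))) (nn-agree (λ e b → cong not (h e b)) h))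
  (ℕ.+-comm (nn s B none full) (nn s B full none)))) p

Genus : (G : RibbonGraph) → EdgeSet G → ℕ → Set
Genus G B g = Sub.connected G B × Sub.eulerGenus G B ≡ g

module _ (G : RibbonGraph) where

  private
    m = nE G
    s = mat G

  module _ (B : EdgeSet G) where

    private
      via-s : ∀ {S₀ S₂} x → B ∋ x → B ∋ σ1↾ (σ1 G) B x × Conn (restr s B) S₀ S₂ x (σ1↾ (σ1 G) B x)
      via-s {S₀} {S₂} x b = subst (λ z → B ∋ z × Conn (restr s B) S₀ S₂ x z) (restr-on s B b) (restr-∋ s B b , conn-s x)

    #V-nn : Sub.#V G B ≡ nIso G + nn s B none full
    #V-nn = cong (nIso G +_) (orbitCount-nn s B (σ1↾ (σ1 G) B ∷ σ2 ∷ []) (via-s ∷ (λ x b → b , conn-2 x refl) ∷ [])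
      (λ x _ → here refl ◅ ε) (λ x ()) (λ x _ → there (here refl) ◅ ε))

    #F-nn : Sub.#F G B ≡ nIso G + nn s B full none
    #F-nn = cong (nIso G +_) (orbitCount-nn s B (σ0 ∷ σ1↾ (σ1 G) B ∷ []) ((λ x b → b , conn-0 x refl) ∷ via-s ∷ [])
      (λ x _ → there (here refl) ◅ ε) (λ x _ → here refl ◅ ε) (λ x ()))

    #K-nn : Sub.#K G B ≡ nIso G + nn s B full full
    #K-nn = cong (nIso G +_) (orbitCount-nn s B (σ0 ∷ σ1↾ (σ1 G) B ∷ σ2 ∷ [])
      ((λ x b → b , conn-0 x refl) ∷ via-s ∷ (λ x b → b , conn-2 x refl) ∷ [])
      (λ x _ → there (here refl) ◅ ε) (λ x _ → here refl ◅ ε) (λ x _ → there (there (here refl)) ◅ ε))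

    module _ (iso : nIso G ≡ 0) where

      private
        drop : ∀ {n k} → n ≡ nIso G + k → n ≡ k
        drop e = trans e (cong (_+ _) iso)

        euler : Sub.eulerGenus G B ≡ (2 * nn s B full full + #E B) ∸ (nn s B none full + nn s B full none)
        euler = cong₂ _∸_ (cong (λ z → 2 * z + #E B) (drop #K-nn)) (cong₂ _+_ (drop #V-nn) (drop #F-nn))

      genus⁺ : nn s B full full ≡ 1 → ∀ {g} → HasGenus s B full g → Genus G B g
      genus⁺ k {g} p = trans (drop #K-nn) k , trans euler (trans (cong (λ z → 2 * z + #E B ∸ (nn s B none full + nn s B full none)) k)
        (trans (cong (_∸ (nn s B none full + nn s B full none)) (sym p))
        (trans (cong (λ z → z + g ∸ (nn s B none full + nn s B full none)) (ℕ.+-comm (nn s B full none) _)) (ℕ.m+n∸m≡n (nn s B none full + nn s B full none) g))))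

      -- `eulerGenus` is a truncated difference; Euler's inequality makes it exact.
      genus⁻ : ∀ {g} → Genus G B g → nn s B full full ≡ 1 × HasGenus s B full g
      genus⁻ {g} (k , e) = k′ , trans (cong (_+ g) (ℕ.+-comm (nn s B full none) (nn s B none full)))
          (trans (cong (nn s B none full + nn s B full none +_) (trans (sym e) (trans euler (cong (λ z → 2 * z + #E B ∸ (nn s B none full + nn s B full none)) k′))))
            (ℕ.m+[n∸m]≡n (subst (λ z → nn s B none full + nn s B full none ≤ 2 * z + #E B) k′ (sub-genus-≥0 s B))))
        where
        k′ : nn s B full full ≡ 1
        k′ = trans (sym (drop #K-nn)) k

  module _ (A : EdgeSet G) where

    private
      φ-edge : ∀ x → edge (φ A x) ≡ edge x
      φ-edge (e , a , b) with A e
      ... | true = refl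
      ... | false = refl

      φ-σ0-in : ∀ x → A ∋ x → φ A (σ0 x) ≡ σ2 (φ A x)
      φ-σ0-in (e , a , b) p rewrite p = refl

      φ-σ2-in : ∀ x → A ∋ x → φ A (σ2 x) ≡ σ0 (φ A x)
      φ-σ2-in (e , a , b) p rewrite p = refl

      φ-σ0-out : ∀ x → A (edge x) ≡ false → φ A (σ0 x) ≡ σ0 (φ A x)
      φ-σ0-out (e , a , b) p rewrite p = refl

      φ-σ2-out : ∀ x → A (edge x) ≡ false → φ A (σ2 x) ≡ σ2 (φ A x)
      φ-σ2-out (e , a , b) p rewrite p = refl

      dual : Matching m
      dual = mat (G ^ A)

      -- In terms of G, the dual matching uses σ0 and σ2 with their roles exchanged on A.
      module _ {S₀ S₂ T₀ T₂ : Fin m → Bool}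
        (in₀ : ∀ e → A e ≡ true → S₀ e ≡ T₂ e) (in₂ : ∀ e → A e ≡ true → S₂ e ≡ T₀ e)
        (out₀ : ∀ e → A e ≡ false → S₀ e ≡ T₀ e) (out₂ : ∀ e → A e ≡ false → S₂ e ≡ T₂ e) where

        to : ∀ {x y} → Conn dual S₀ S₂ x y → Conn s T₀ T₂ (φ A x) (φ A y)
        to = conn-⊆ {R = λ x y → Conn s T₀ T₂ (φ A x) (φ A y)} ε _◅◅_
          (λ x → subst (Conn s T₀ T₂ (φ A x)) (sym (φ-invol A _)) (conn-s (φ A x))) at-0 at-2
          where
          at-0 : ∀ x → S₀ ∋ x → Conn s T₀ T₂ (φ A x) (φ A (σ0 x))
          at-0 x i with A (edge x) Bool.≟ true
          ... | yes a = subst (Conn s T₀ T₂ (φ A x)) (sym (φ-σ0-in x a)) (conn-2 _ (trans (cong T₂ (φ-edge x)) (trans (sym (in₀ _ a)) i)))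
          ... | no n = subst (Conn s T₀ T₂ (φ A x)) (sym (φ-σ0-out x (≢true⇒false n))) (conn-0 _ (trans (cong T₀ (φ-edge x)) (trans (sym (out₀ _ (≢true⇒false n))) i)))
          at-2 : ∀ x → S₂ ∋ x → Conn s T₀ T₂ (φ A x) (φ A (σ2 x))
          at-2 x i with A (edge x) Bool.≟ true
          ... | yes a = subst (Conn s T₀ T₂ (φ A x)) (sym (φ-σ2-in x a)) (conn-0 _ (trans (cong T₀ (φ-edge x)) (trans (sym (in₂ _ a)) i)))
          ... | no n = subst (Conn s T₀ T₂ (φ A x)) (sym (φ-σ2-out x (≢true⇒false n))) (conn-2 _ (trans (cong T₂ (φ-edge x)) (trans (sym (out₂ _ (≢true⇒false n))) i)))

        from : ∀ {x y} → Conn s T₀ T₂ x y → Conn dual S₀ S₂ (φ A x) (φ A y)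
        from = conn-⊆ {R = λ x y → Conn dual S₀ S₂ (φ A x) (φ A y)} ε _◅◅_
          (λ x → subst (λ z → Conn dual S₀ S₂ (φ A x) (φ A (σ1 G z))) (φ-invol A x) (conn-s (φ A x))) at-0 at-2
          where
          at-0 : ∀ x → T₀ ∋ x → Conn dual S₀ S₂ (φ A x) (φ A (σ0 x))
          at-0 x i with A (edge x) Bool.≟ true
          ... | yes a = subst (Conn dual S₀ S₂ (φ A x)) (sym (φ-σ0-in x a)) (conn-2 _ (trans (cong S₂ (φ-edge x)) (trans (in₂ _ a) i)))
          ... | no n = subst (Conn dual S₀ S₂ (φ A x)) (sym (φ-σ0-out x (≢true⇒false n))) (conn-0 _ (trans (cong S₀ (φ-edge x)) (trans (out₀ _ (≢true⇒false n)) i)))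
          at-2 : ∀ x → T₂ ∋ x → Conn dual S₀ S₂ (φ A x) (φ A (σ2 x))
          at-2 x i with A (edge x) Bool.≟ true
          ... | yes a = subst (Conn dual S₀ S₂ (φ A x)) (sym (φ-σ2-in x a)) (conn-0 _ (trans (cong S₀ (φ-edge x)) (trans (in₀ _ a) i)))
          ... | no n = subst (Conn dual S₀ S₂ (φ A x)) (sym (φ-σ2-out x (≢true⇒false n))) (conn-2 _ (trans (cong S₂ (φ-edge x)) (trans (out₂ _ (≢true⇒false n)) i)))

        nn-dual : nn dual full S₀ S₂ ≡ nn s full T₀ T₂
        nn-dual = trans (nn-full dual S₀ S₂) (trans (count-≡ conn-equivalence conn-equivalence id id
          (λ _ _ → id) (λ _ _ → id) (cnt-count dual S₀ S₂)
          (count-map (φ A) (φ-invol A) _ _ (λ {x} {y} c → subst₂ (Conn dual S₀ S₂) (φ-invol A x) (φ-invol A y) (from c)) to (cnt-count s T₀ T₂)))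
          (sym (nn-full s T₀ T₂)))

    -- Turns the genus of `G ^ A` into a statement about the matching of `G`, where joins are
    -- additive.
    hasGenus-dual⁺ : ∀ {g} → HasGenus (mat (G ^ A)) full full g → HasGenus s full A g
    hasGenus-dual⁺ {g} = trans (cong (_+ g) (trans (ℕ.+-comm (nn s full A (∁ A)) _) (sym (cong₂ _+_
      (nn-dual {full} {none} {∁ A} {A} (λ _ a → sym a) (λ _ a → cong not (sym a)) (λ _ a → cong not (sym a)) (λ _ a → sym a))
      (nn-dual {none} {full} {A} {∁ A} (λ _ a → cong not (sym a)) (λ _ a → sym a) (λ _ a → sym a) (λ _ a → cong not (sym a)))))))

    hasGenus-dual⁻ : ∀ {g} → HasGenus s full A g → HasGenus (mat (G ^ A)) full full g
    hasGenus-dual⁻ {g} = trans (cong (_+ g) (trans (cong₂ _+_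
      (nn-dual {full} {none} {∁ A} {A} (λ _ a → sym a) (λ _ a → cong not (sym a)) (λ _ a → cong not (sym a)) (λ _ a → sym a))
      (nn-dual {none} {full} {A} {∁ A} (λ _ a → cong not (sym a)) (λ _ a → sym a) (λ _ a → sym a) (λ _ a → cong not (sym a))))
      (ℕ.+-comm (nn s full (∁ A) A) _)))

    connected-dual : nn (mat (G ^ A)) full full full ≡ nn s full full full
    connected-dual = nn-dual (λ _ _ → refl) (λ _ _ → refl) (λ _ _ → refl) (λ _ _ → refl)

-- Join decompositions

joined-cong : ∀ {m} {s : Matching m} {P P′ Q Q′} → (∀ e → P e ≡ P′ e) → (∀ e → Q e ≡ Q′ e) → Joined s P Q → Joined s P′ Q′
joined-cong {s = s} {P} {P′} {Q} {Q′} hP hQ j = record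
  { disjoint = λ e p → trans (sym (hQ e)) (disjoint e (trans (hP e) p))
  ; p₁ = p₁ ; p₂ = p₂ ; p₁∈P = trans (sym (hP _)) p₁∈P ; p₂∈P = trans (sym (hP _)) p₂∈P
  ; p₁→Q = to p₁ p₁→Q ; p₂→Q = to p₂ p₂→Q ; p₁≢p₂ = p₁≢p₂
  ; only = λ {x} p q → only (trans (hP _) p) (trans (hQ _) (subst (λ z → Q′ ∋ z) (sym (same x)) q)) }
  where
  open Joined j
  same : ∀ x → restr s (P ∪ Q) ⟨ x ⟩ ≡ restr s (P′ ∪ Q′) ⟨ x ⟩
  same = restr-cong s (λ e → cong₂ _∨_ (hP e) (hQ e))
  to : ∀ x → Q ∋ restr s (P ∪ Q) ⟨ x ⟩ → Q′ ∋ restr s (P′ ∪ Q′) ⟨ x ⟩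
  to x q = trans (sym (hQ _)) (subst (λ z → Q ∋ z) (same x) q)

-- The sum of the first `n` values; the cut-off is separate from `l` because the induction over the
-- joins runs through initial segments of the labels.
gsum : ∀ {l} → (Fin l → ℕ) → ℕ → ℕ
gsum {zero} g n = 0
gsum {suc l} g zero = 0
gsum {suc l} g (suc n) = g Fin.zero + gsum (g ∘ Fin.suc) n

gsum-start : ∀ {l} (g : Fin l → ℕ) → gsum g 0 ≡ 0
gsum-start {zero} g = refl
gsum-start {suc l} g = refl

gsum-suc : ∀ {l} (g : Fin l → ℕ) k → gsum g (suc (toℕ k)) ≡ gsum g (toℕ k) + g k
gsum-suc {suc l} g Fin.zero = trans (cong (g Fin.zero +_) (gsum-start (g ∘ Fin.suc))) (ℕ.+-identityʳ _)
gsum-suc {suc l} g (Fin.suc k) = trans (cong (g Fin.zero +_) (gsum-suc (g ∘ Fin.suc) k)) (sym (ℕ.+-assoc (g Fin.zero) _ _))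

gsum-zero⁺ : ∀ {l} (g : Fin l → ℕ) → (∀ i → g i ≡ 0) → gsum g l ≡ 0
gsum-zero⁺ {zero} g h = refl
gsum-zero⁺ {suc l} g h = cong₂ _+_ (h Fin.zero) (gsum-zero⁺ (g ∘ Fin.suc) (h ∘ Fin.suc))

gsum-zero⁻ : ∀ {l} (g : Fin l → ℕ) → gsum g l ≡ 0 → ∀ i → g i ≡ 0
gsum-zero⁻ {suc l} g h Fin.zero = ℕ.m+n≡0⇒m≡0 _ h
gsum-zero⁻ {suc l} g h (Fin.suc i) = gsum-zero⁻ (g ∘ Fin.suc) (ℕ.m+n≡0⇒n≡0 (g Fin.zero) h) i

gsum-one⁺ : ∀ {l} (g : Fin l → ℕ) i₀ → g i₀ ≡ 1 → (∀ i → i ≢ i₀ → g i ≡ 0) → gsum g l ≡ 1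
gsum-one⁺ {suc l} g Fin.zero p h = cong₂ _+_ p (gsum-zero⁺ (g ∘ Fin.suc) (λ i → h (Fin.suc i) λ ()))
gsum-one⁺ {suc l} g (Fin.suc i₀) p h = cong₂ _+_ (h Fin.zero λ ())
  (gsum-one⁺ (g ∘ Fin.suc) i₀ p (λ i n → h (Fin.suc i) λ e → n (Fin.suc-injective e)))

gsum-one⁻ : ∀ {l} (g : Fin l → ℕ) → gsum g l ≡ 1 → ∃ λ i₀ → g i₀ ≡ 1 × (∀ i → i ≢ i₀ → g i ≡ 0)
gsum-one⁻ {suc l} g h with g Fin.zero in e
... | suc zero = Fin.zero , e , λ { Fin.zero n → contradiction refl n ; (Fin.suc i) _ → gsum-zero⁻ (g ∘ Fin.suc) (ℕ.suc-injective h) i }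
... | zero with gsum-one⁻ (g ∘ Fin.suc) h
... | i₀ , p , q = Fin.suc i₀ , p , λ { Fin.zero _ → e ; (Fin.suc i) n → q i (λ k → n (cong Fin.suc k)) }

module _ (G : RibbonGraph) {l : ℕ} (lab : Fin (nE G) → Fin l) where

  private
    m = nE G
    s = mat G
    X = Flag m

    prefix : ℕ → EdgeSet G
    prefix n e = toℕ (lab e) ℕ.<ᵇ n

  -- A common form for `l ≡ 1` and `2 ≤ l`, with the counting condition of `JoinStep` replaced by
  -- its two corners.
  record Decomposition : Set where
    field
      nonempty  : 1 ≤ l
      inhabited : ∀ i → Σ (Fin m) λ e → lab e ≡ i
      connected : ∀ i → nn s (part G lab i) full full ≡ 1
      joined    : ∀ k → 1 ≤ toℕ k → Joined s (before G lab k) (part G lab k)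

  part⁺ : ∀ {i e} → lab e ≡ i → part G lab i e ≡ true
  part⁺ {i} {e} p = does⁺ (lab e Fin.≟ i) p

  part⁻ : ∀ {i e} → part G lab i e ≡ true → lab e ≡ i
  part⁻ {i} {e} p = does⁻ (lab e Fin.≟ i) p

  private
    prefix⁺ : ∀ {n e} → toℕ (lab e) < n → prefix n e ≡ true
    prefix⁺ p = T⇒≡ (ℕ.<⇒<ᵇ p)

    prefix⁻ : ∀ {n e} → prefix n e ≡ true → toℕ (lab e) < n
    prefix⁻ {n} {e} p = ℕ.<ᵇ⇒< (toℕ (lab e)) n (≡⇒T p)

    prefix-suc : ∀ k e → (before G lab k ∪ part G lab k) e ≡ prefix (suc (toℕ k)) e
    prefix-suc k e = bool-≡
      (λ p → [ (λ q → prefix⁺ (ℕ.m≤n⇒m≤1+n (prefix⁻ {toℕ k} q))) , (λ q → prefix⁺ (s≤s (ℕ.≤-reflexive (cong toℕ (part⁻ {k} q))))) ]′ (∨-true {before G lab k e} p))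
      (λ p → [ (λ q → ∨-trueˡ (prefix⁺ {toℕ k} q)) , (λ q → ∨-trueʳ {before G lab k e} (part⁺ (Fin.toℕ-injective q))) ]′ (ℕ.m<1+n⇒m<n∨m≡n (prefix⁻ {suc (toℕ k)} p)))

    upto-∪ : ∀ k e → upto G lab k e ≡ (before G lab k ∪ part G lab k) e
    upto-∪ k e = trans (bool-≡ (λ p → prefix⁺ (s≤s (ℕ.≤ᵇ⇒≤ (toℕ (lab e)) (toℕ k) (≡⇒T p)))) (λ p → T⇒≡ (ℕ.≤⇒≤ᵇ (ℕ.≤-pred (prefix⁻ {suc (toℕ k)} p))))) (sym (prefix-suc k e))

  hasGenus-sum : Decomposition → ∀ {D} (g : Fin l → ℕ) → (∀ i → HasGenus s (part G lab i) D (g i)) → HasGenus s full D (gsum g l)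
  hasGenus-sum d {D} g h = hasGenus-cong everything (subst (λ n → HasGenus s (prefix n) D (gsum g n)) top (chain (l ∸ 1) (Fin.fromℕ< (ℕ.≤-reflexive top)) (Fin.toℕ-fromℕ< _)))
    where
    open Decomposition d
    top : suc (l ∸ 1) ≡ l
    top = ℕ.m+[n∸m]≡n nonempty
    everything : ∀ e → prefix l e ≡ true
    everything e = prefix⁺ (Fin.toℕ<n (lab e))
    chain : ∀ n k → toℕ k ≡ n → HasGenus s (prefix (suc n)) D (gsum g (suc n))
    chain zero k eq = hasGenus-cong first (subst (HasGenus s (part G lab k) D) (sym one) (h k))
      where
      one : gsum g 1 ≡ g k
      one = trans (cong (λ n → gsum g (suc n)) (sym eq)) (trans (gsum-suc g k) (cong (_+ g k) (trans (cong (gsum g) eq) (gsum-start g))))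
      first : ∀ e → part G lab k e ≡ prefix 1 e
      first e = bool-≡ (λ p → prefix⁺ (s≤s (ℕ.≤-reflexive (trans (cong toℕ (part⁻ {k} p)) eq))))
        (λ p → part⁺ (Fin.toℕ-injective (trans (ℕ.n<1⇒n≡0 (prefix⁻ {1} p)) (sym eq))))
    chain (suc n) k eq = subst (λ j → HasGenus s (prefix (suc j)) D (gsum g (suc j))) eq
      (hasGenus-cong (prefix-suc k) (subst (HasGenus s (before G lab k ∪ part G lab k) D) (sym (gsum-suc g k))
        (hasGenus-joined (joined k (subst (1 ≤_) (sym eq) (s≤s z≤n)))
          (subst (λ j → HasGenus s (prefix j) D (gsum g j)) (sym eq) (chain n (Fin.fromℕ< lt) (Fin.toℕ-fromℕ< lt))) (h k))))
      where
      lt : n < l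
      lt = ℕ.<-trans (ℕ.n<1+n n) (subst (_< l) eq (Fin.toℕ<n k))

  private
    sameV⁻ : ∀ {x y} → T (sameV G lab x y) → Conn s none full x y
    sameV⁻ p = orb-⊆ ε _◅◅_ (conn-s ∷ (λ x → conn-2 x refl) ∷ []) (sameOrbit⁻ (σ1 G ∷ σ2 ∷ []) (T⇒≡ p))

    sameV⁺ : ∀ {x y} → Conn s none full x y → T (sameV G lab x y)
    sameV⁺ c = ≡⇒T (sameOrbit⁺ (σ1 G ∷ σ2 ∷ []) (conn-⊆ {R = Orb (σ1 G ∷ σ2 ∷ [])} ε orb-trans (λ x → here refl ◅ ε) (λ x ()) (λ x _ → there (here refl) ◅ ε) c))
      where
      orb-trans : ∀ {x y z : X} → Orb (σ1 G ∷ σ2 ∷ []) x y → Orb (σ1 G ∷ σ2 ∷ []) y z → Orb (σ1 G ∷ σ2 ∷ []) x z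
      orb-trans ε q = q
      orb-trans (g ◅ p) q = g ◅ orb-trans p q

    module At (k : Fin l) where

      P Q : EdgeSet G
      P = before G lab k
      Q = part G lab k

      u : Matching m
      u = restr s (P ∪ Q)

      to-u : ∀ {x y} → (P ∪ Q) ∋ x → (P ∪ Q) ∋ y → Conn s none full x y → Conn u none full x y
      to-u = span-restr s (P ∪ Q) (λ _ _ → refl) (λ _ _ → refl) (λ _ _ → refl) (λ _ _ → refl)

      from-u : ∀ {x y} → (P ∪ Q) ∋ x → Conn u none full x y → (P ∪ Q) ∋ y × Conn s none full x y
      from-u = restr-span s (P ∪ Q) (λ _ _ → refl) (λ _ _ → refl) (λ _ _ → refl) (λ _ _ → refl)

      skip-u : ∀ {x} → (P ∪ Q) ∋ x → σ1↾ (σ1 G) (upto G lab k) x ≡ u ⟨ x ⟩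
      skip-u {x} i = trans (sym (restr-on s (upto G lab k) {x} (trans (upto-∪ k _) i))) (restr-cong s (upto-∪ k) x)

      P⊆ : ∀ {x} → P ∋ x → (P ∪ Q) ∋ x
      P⊆ = ∨-trueˡ

      Q⊆ : ∀ {x} → Q ∋ x → (P ∪ Q) ∋ x
      Q⊆ {x} = ∨-trueʳ {P (edge x)}

      disj : ∀ e → P e ≡ true → Q e ≡ false
      disj e p = ≢true⇒false λ q → ℕ.<-irrefl (cong toℕ (part⁻ {k} q)) (prefix⁻ {toℕ k} p)

      ∉P : ∀ {x} → Q ∋ x → P (edge x) ≡ false
      ∉P q = ≢true⇒false λ p → true≢false q (disj _ p)

      -- Going round a shared vertex within `P ∪ Q`, the walk must pass from `P` to `Q` at some
      -- corner.
      cross : ∀ {x y} → P ∋ x → Q ∋ y → Conn s none full x y → ∃ λ z → Conn s none full x z × P ∋ z × Q ∋ u ⟨ z ⟩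
      cross {x} {y} p q c with Colour.Leaves.crossing P u (to-u (P⊆ {x} p) (Q⊆ {y} q) c) (trans (∉P {y} q) (cong not (sym p)))
      ... | z , d , e , mz = let i , d′ = from-u (P⊆ {x} p) d ; pz = trans e p in z , d′ , pz
            , [ (λ h → ⊥-elim (true≢false h (trans mz (cong not pz)))) , id ]′ (∨-true {P (edge (u ⟨ z ⟩))} (restr-∋ s (P ∪ Q) i))

      counted : X → X → Bool
      counted f₀ f = sameV G lab f₀ f ∧ before G lab k (edge f) ∧ part G lab k (edge (σ1↾ (σ1 G) (upto G lab k) f))

      step⁻ : JoinStep G lab k → Joined s P Q
      step⁻ (f₀ , g₀ , pf , qg , v , unique , few) = from (cross (T⇒≡ pf) (T⇒≡ qg) (sameV⁻ v))
        where
        from : (∃ λ z → Conn s none full f₀ z × P ∋ z × Q ∋ u ⟨ z ⟩) → Joined s P Q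
        from (p₁ , _ , p₁∈P , p₁→Q) = record { disjoint = disj ; p₁ = p₁ ; p₂ = p₂ ; p₁∈P = p₁∈P ; p₂∈P = p₂∈P
          ; p₁→Q = p₁→Q ; p₂→Q = p₂→Q ; p₁≢p₂ = p₁≢p₂ ; only = only }
          where
          -- Restricting to `P` closes the gap behind `p₁`; the flag on the far side of the gap must
          -- face `Q` as well. A third such flag would exceed the 2 in `JoinStep`.
          p₂ : X
          p₂ = restr u P ⟨ p₁ ⟩
          p₂∈P : P ∋ p₂
          p₂∈P = restr-∋ u P p₁∈P
          p₂→Q : Q ∋ u ⟨ p₂ ⟩
          p₂→Q = [ (λ h → ⊥-elim (true≢false h (restr-exits u P p₁∈P (∉P {u ⟨ p₁ ⟩} p₁→Q)))) , id ]′
            (∨-true {P (edge (u ⟨ p₂ ⟩))} (restr-∋ s (P ∪ Q) (P⊆ {p₂} p₂∈P)))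
          p₁≢p₂ : p₁ ≢ p₂
          p₁≢p₂ e = fpf (restr u P) p₁ (sym e)
          count : ∀ {x} → P ∋ x → Q ∋ u ⟨ x ⟩ → x ∈ filterᵇ (counted f₀) flags
          count {x} p q = Mem.∈-filter⁺ _ (∈-flags x) (Equivalence.from (Bool.T-∧ {sameV G lab f₀ x}) (sameV⁺ (conn-sym (sameV⁻
              (unique x (u ⟨ x ⟩) (≡⇒T p) (≡⇒T q) (sameV⁺ (proj₂ (from-u (P⊆ {x} p) (conn-s x)))))))
            , Equivalence.from (Bool.T-∧ {before G lab k (edge x)}) (≡⇒T p , ≡⇒T (trans (cong (λ z → Q (edge z)) (skip-u {x} (P⊆ {x} p))) q))))
          only : ∀ {x} → P ∋ x → Q ∋ u ⟨ x ⟩ → x ≡ p₁ ⊎ x ≡ p₂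
          only {x} p q with x ≟F p₁ | x ≟F p₂
          ... | yes e | _ = inj₁ e
          ... | no _ | yes e = inj₂ e
          ... | no a | no b = ⊥-elim (ℕ.1+n≰n (ℕ.≤-trans (unique-⊆-length {xs = x ∷ p₁ ∷ p₂ ∷ []} ((a ∷ b ∷ []) ∷ (p₁≢p₂ ∷ []) ∷ [] ∷ [])
                  (count p q ∷ count p₁∈P p₁→Q ∷ count p₂∈P p₂→Q ∷ [])) (subst (_≤ 2) (countB-filter (counted f₀) flags) few)))

      -- Both corners lie at one vertex by `joined-p₁p₂`, and by `cross` every vertex common to `P`
      -- and `Q` contains one of them.
      step⁺ : Joined s P Q → JoinStep G lab k
      step⁺ j = p₁ , u ⟨ p₁ ⟩ , ≡⇒T p₁∈P , ≡⇒T p₁→Q , sameV⁺ (proj₂ (from-u (P⊆ {p₁} p₁∈P) (conn-s p₁)))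
        , (λ f g pf qg v → toP₁ (cross (T⇒≡ pf) (T⇒≡ qg) (sameV⁻ v)))
        , ℕ.≤-trans (countB-mono two flags) (countB-∈ (p₁ ∷ p₂ ∷ []))
        where
        open Joined j
        p₁p₂ : Conn s none full p₁ p₂
        p₁p₂ = proj₂ (from-u (P⊆ {p₁} p₁∈P) (proj₂ (restr-span u P (λ _ _ → refl) (λ _ _ → refl) (λ _ _ → refl) (λ _ _ → refl) p₁∈P
          (subst (Conn (restr u P) none full p₁) (joined-p₁p₂ j) (conn-s p₁)))))
        toP₁ : ∀ {f} → (∃ λ z → Conn s none full f z × P ∋ z × Q ∋ u ⟨ z ⟩) → T (sameV G lab f p₁)
        toP₁ (z , c , p , q) with only p q
        ... | inj₁ refl = sameV⁺ c
        ... | inj₂ refl = sameV⁺ (c ◅◅ conn-sym p₁p₂)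
        two : ∀ x → counted p₁ x ≡ true → elemB x (p₁ ∷ p₂ ∷ []) ≡ true
        two x p with Equivalence.to (Bool.T-∧ {sameV G lab p₁ x}) (≡⇒T p)
        ... | _ , t with Equivalence.to (Bool.T-∧ {before G lab k (edge x)}) t
        ... | a , b with only (T⇒≡ a) (trans (cong (λ z → Q (edge z)) (sym (skip-u {x} (P⊆ {x} (T⇒≡ a))))) (T⇒≡ b))
        ... | inj₁ e = ∈-elemB {x = x} {p₁ ∷ p₂ ∷ []} (here e)
        ... | inj₂ e = ∈-elemB {x = x} {p₁ ∷ p₂ ∷ []} (there (here e))

  decomposition⁺ : nIso G ≡ 0 → Decomposition → IsJoinDecomposition G lab
  decomposition⁺ iso d = by-size (1 ℕ.<? l)
    where
    open Decomposition d
    by-size : Dec (2 ≤ l) → IsJoinDecomposition G lab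
    by-size (no n) = inj₁ (ℕ.≤-antisym (ℕ.≤-pred (ℕ.≰⇒> n)) nonempty)
    by-size (yes p) = inj₂ (p , iso , inhabited
      , (λ i → trans (#K-nn G (part G lab i)) (trans (cong (_+ nn s (part G lab i) full full) iso) (connected i)))
      , λ k h → At.step⁺ k (joined k h))

  -- For `l ≡ 1` the definition of a join decomposition asks nothing more, so the data come from the
  -- connectedness of `G` and the edge `e₀`.
  decomposition⁻ : nIso G ≡ 0 → Fin m → nn s full full full ≡ 1 → IsJoinDecomposition G lab → Decomposition
  decomposition⁻ iso e₀ c (inj₁ refl) = record
    { nonempty = s≤s z≤n
    ; inhabited = λ i → e₀ , trans (only (lab e₀)) (sym (only i))
    ; connected = λ i → trans (nn-cong (λ e → part⁺ (trans (only (lab e)) (sym (only i))))) c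
    ; joined = λ k h → ⊥-elim (ℕ.n≮0 (subst (1 ≤_) (cong toℕ (only k)) h)) }
    where
    only : (i : Fin 1) → i ≡ Fin.zero
    only Fin.zero = refl
  decomposition⁻ iso e₀ c (inj₂ (p , _ , inh , con , js)) = record
    { nonempty = ℕ.≤-trans (s≤s z≤n) p
    ; inhabited = inh
    ; connected = λ i → trans (sym (trans (#K-nn G (part G lab i)) (cong (_+ nn s (part G lab i) full full) iso))) (con i)
    ; joined = λ k h → At.step⁻ k (js k h) }

-- The labelling given by an ordered resolution

count-one : ∀ {X : Set} {R : X → X → Set} {P : X → Set} → IsEquivalence R → Count R P 1 → ∀ {x y} → P x → P y → R x y
count-one {R = R} {P} eq c {x} {y} px py with Count.reps c | Count.len c | Count.cover c {x} px | Count.cover c {y} py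
... | _ ∷ [] | _ | here p | here q = IsEquivalence.trans eq p (IsEquivalence.sym eq q)

module Label {m : ℕ} (s t : Matching m) where

  open Peel s t

  private X = Flag m

  -- Counted from the end of the list, since its head is joined last and must get the largest label.
  position : ∀ {L x} → Any (x ~_) L → Fin (length L)
  position {q ∷ L} (here _) = Fin.fromℕ (length L)
  position (there a) = Fin.inject₁ (position a)

  -- `rest` is what follows `q` in the list, that is, the parts joined before it.
  record Place (L : List X) (k : ℕ) : Set where
    field
      q      : X
      rest   : List X
      q∈L    : q ∈ L
      rest⊆L : ∀ {x} → Any (x ~_) rest → Any (x ~_) L
      at⁻    : ∀ {x} (a : Any (x ~_) L) → toℕ (position a) ≡ k → x ~ q
      at⁺    : ∀ {x} (a : Any (x ~_) L) → x ~ q → toℕ (position a) ≡ k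
      lt⁻    : ∀ {x} (a : Any (x ~_) L) → toℕ (position a) < k → Any (x ~_) rest
      lt⁺    : ∀ {x} (a : Any (x ~_) L) → Any (x ~_) rest → toℕ (position a) < k
      good   : Good q
      joined : 1 ≤ k → Joined s (⋃ rest) (cls q)

  private
    apart : ∀ {q L x} → All (λ z → ¬ (q ~ z)) L → x ~ q → Any (x ~_) L → ⊥
    apart far c a = All.lookupWith (λ n d → n (conn-sym c ◅◅ d)) far a

    last-place : ∀ {q L} → All (λ z → ¬ (q ~ z)) L → Good q → (1 ≤ length L → Joined s (⋃ L) (cls q)) → Place (q ∷ L) (length L)
    last-place {q} {L} far g j = record
      { q = q ; rest = L ; q∈L = here refl ; rest⊆L = there ; good = g ; joined = j
      ; at⁻ = λ { (here c) _ → c ; (there a) e → ⊥-elim (ℕ.<-irrefl (trans (sym (Fin.toℕ-inject₁ (position a))) e) (Fin.toℕ<n (position a))) }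
      ; at⁺ = λ { (here _) _ → Fin.toℕ-fromℕ _ ; (there a) c → ⊥-elim (apart far c a) }
      ; lt⁻ = λ { (here _) h → ⊥-elim (ℕ.<-irrefl (Fin.toℕ-fromℕ _) h) ; (there a) _ → a }
      ; lt⁺ = λ { (here c) a → ⊥-elim (apart far c a) ; (there a) _ → subst (_< length L) (sym (Fin.toℕ-inject₁ (position a))) (Fin.toℕ<n (position a)) } }

    earlier-place : ∀ {q L k} → All (λ z → ¬ (q ~ z)) L → k < length L → Place L k → Place (q ∷ L) k
    earlier-place {q₀} {L} {k} far lt p = record
      { q = q ; rest = rest ; q∈L = there q∈L ; rest⊆L = λ a → there (rest⊆L a) ; good = good ; joined = joined
      ; at⁻ = λ { (here _) e → ⊥-elim (ℕ.<-irrefl (trans (sym e) (Fin.toℕ-fromℕ _)) lt) ; (there a) e → at⁻ a (trans (sym (Fin.toℕ-inject₁ (position a))) e) }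
      ; at⁺ = λ { (here c) d → ⊥-elim (apart far c (lose q∈L d)) ; (there a) d → trans (Fin.toℕ-inject₁ (position a)) (at⁺ a d) }
      ; lt⁻ = λ { (here _) h → ⊥-elim (ℕ.<-asym lt (subst (_< k) (Fin.toℕ-fromℕ _) h)) ; (there a) h → lt⁻ a (subst (_< k) (Fin.toℕ-inject₁ (position a)) h) }
      ; lt⁺ = λ { (here c) b → ⊥-elim (apart far c (rest⊆L b)) ; (there a) b → subst (_< k) (sym (Fin.toℕ-inject₁ (position a))) (lt⁺ a b) } }
      where open Place p

  place : ∀ {L} → AllPairs (λ a b → ¬ (a ~ b)) L → Ordered L → ∀ k → k < length L → Place L k
  place (far ∷ _) (one g) zero lt = last-place far g (λ ())
  place (far ∷ _) (one g) (suc k) (s≤s ())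
  place {q ∷ L} (far ∷ ind) (more g j o) k (s≤s le) with ℕ.m≤n⇒m<n∨m≡n le
  ... | inj₁ lt = earlier-place far lt (place ind o k lt)
  ... | inj₂ refl = last-place far g (λ _ → j)

-- Genus as the sum over the parts, and the two equivalences

module _ (G : RibbonGraph) (A : EdgeSet G) (iso : nIso G ≡ 0) (e₀ : Fin (nE G)) (one : nn (mat G) full full full ≡ 1) where

  private
    m = nE G
    s = mat G
    X = Flag m

    sub-connected : ∀ B → nn s B full full ≡ 1 → Sub.connected G B
    sub-connected B p = trans (#K-nn G B) (trans (cong (_+ nn s B full full) iso) p)

    iso-dual : nIso (G ^ A) ≡ 0
    iso-dual = iso

  -- The parts are monochromatic, so each contributes the same amount to `G` and to `G ^ A`. Both
  -- directions rest on this: it computes the genera from the parts, and it tells which parts are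
  -- plane from the total.
  genus-of-sum : ∀ {l} (lab : Fin m → Fin l) → Decomposition G lab → Defines G lab A →
    let g = gsum (λ i → Sub.eulerGenus G (part G lab i)) l in Genus G (allEdges G) g × Genus (G ^ A) (allEdges (G ^ A)) g
  genus-of-sum lab d (I , def) = genus⁺ G full iso one (hasGenus-sum G lab d _ parts)
    , genus⁺ (G ^ A) full iso-dual (trans (connected-dual G A) one) (hasGenus-dual⁻ G A (hasGenus-sum G lab d _ pure-parts))
    where
    parts : ∀ i → HasGenus s (part G lab i) full (Sub.eulerGenus G (part G lab i))
    parts i = proj₂ (genus⁻ G (part G lab i) iso (sub-connected _ (Decomposition.connected d i) , refl))
    pure-parts : ∀ i → HasGenus s (part G lab i) A (Sub.eulerGenus G (part G lab i))
    pure-parts i = hasGenus-pure {c = I i} (λ e p → trans (def e) (cong I (part⁻ G lab p))) (parts i)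

  -- One construction serves both statements; a total of 0 makes all parts plane, a total of 1
  -- singles out one part.
  find-decomposition : ∀ {g} → g ≤ 1 → Genus G (allEdges G) g → Genus (G ^ A) (allEdges (G ^ A)) g →
    Σ ℕ λ l → Σ (Fin m → Fin l) λ lab → Decomposition G lab × Defines G lab A
  find-decomposition {g} g≤1 γ γ′ = from (Peel.order s t comm connected (e₀ , false , false) bound)
    where
    euler : ∀ {D} → HasGenus s full D g → 2 + m ≤ suc (cnt s D (∁ D) + cnt s (∁ D) D)
    euler {D} h = ℕ.≤-trans (ℕ.≤-reflexive (trans (cong (2 +_) (sym (#E-full {m}))) (trans (sym h) (cong (_+ g) (cong₂ _+_ (nn-full s D (∁ D)) (nn-full s (∁ D) D))))))
      (ℕ.≤-trans (ℕ.+-monoʳ-≤ _ g≤1) (ℕ.≤-reflexive (ℕ.+-comm _ 1)))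
    K₁ : cnt s full full ≡ 1
    K₁ = trans (sym (nn-full s full full)) one
    open Resolve A s using (Resolution; resolution)
    res : Resolution
    res = resolution K₁ (ℕ.≤-trans (euler (proj₂ (genus⁻ G full iso γ))) (ℕ.≤-reflexive (cong suc (ℕ.+-comm (cnt s full none) _))))
      (euler (hasGenus-dual⁺ G A (proj₂ (genus⁻ (G ^ A) full iso-dual γ′))))
    open Resolution res
    connected : ∀ x y → Conn s full full x y
    connected x y = count-one conn-equivalence (subst (Count (Conn s full full) (λ _ → ⊤)) K₁ (cnt-count s full full)) tt tt
    from : (Σ (List X) λ L → AllPairs (λ a b → ¬ Conn t full full a b) L × (∀ x → Any (Conn t full full x) L) × Peel.Ordered s t L) →
      Σ ℕ λ l → Σ (Fin m → Fin l) λ lab → Decomposition G lab × Defines G lab A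
    from (L , indep , cover , ordered) = length L , lab , record
        { nonempty = nonempty L (cover (e₀ , false , false))
        ; inhabited = λ i → edge (q i) , Fin.toℕ-injective (at⁺ i (cover _) (conn-sym (base-conn (q i))))
        ; connected = λ i → one-class i
        ; joined = λ k h → joined-cong (before-⋃ k) (part-cls k) (Place.joined (pl k) h) }
      , (λ i → A (edge (q i))) , λ e → same-colour (at⁻ (lab e) (cover _) refl)
      where
      open Peel s t
      open Label s t
      lab : Fin m → Fin (length L)
      lab e = position (cover (e , false , false))
      pl : ∀ i → Place L (toℕ i)
      pl i = place indep ordered (toℕ i) (Fin.toℕ<n i)
      q : Fin (length L) → X
      q i = Place.q (pl i)
      at⁻ : ∀ i {x} (a : Any (x ~_) L) → toℕ (position a) ≡ toℕ i → x ~ q i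
      at⁻ i = Place.at⁻ (pl i)
      at⁺ : ∀ i {x} (a : Any (x ~_) L) → x ~ q i → toℕ (position a) ≡ toℕ i
      at⁺ i = Place.at⁺ (pl i)
      nonempty : ∀ {x} L → Any (x ~_) L → 1 ≤ length L
      nonempty (_ ∷ _) _ = s≤s z≤n
      same-colour : ∀ {x y} → x ~ y → A (edge x) ≡ A (edge y)
      same-colour {x} c = sym (conn-closed (λ z → A (edge z) ≡ A (edge x)) (λ z e → trans (pure z) e) (λ _ _ → id) (λ _ _ → id) c refl)
      part-cls : ∀ k e → cls (q k) e ≡ part G lab k e
      part-cls k e = bool-≡
        (λ c → part⁺ G lab (Fin.toℕ-injective (at⁺ k (cover _) (cls⁻ {q k} {e , false , false} c))))
        (λ h → cls⁺ {q k} {e , false , false} (at⁻ k (cover _) (cong toℕ (part⁻ G lab h))))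
      before-⋃ : ∀ k e → ⋃ (Place.rest (pl k)) e ≡ before G lab k e
      before-⋃ k e = bool-≡
        (λ c → T⇒≡ (ℕ.<⇒<ᵇ (Place.lt⁺ (pl k) (cover _) (⋃⁻ {Place.rest (pl k)} {e , false , false} c))))
        (λ h → ⋃⁺ {Place.rest (pl k)} {e , false , false} (Place.lt⁻ (pl k) (cover _) (ℕ.<ᵇ⇒< _ (toℕ k) (≡⇒T h))))
      one-class : ∀ i → nn s (part G lab i) full full ≡ 1
      one-class i = trans (sym (nn-cong (part-cls i))) (sym (nn-unique {s = s} {t} {cls (q i)} (λ {x} → Place.good (pl i) {x}) (record
        { reps = q i ∷ [] ; len = refl ; inP = cls⁺ {q i} {q i} ε ∷ [] ; indep = [] ∷ [] ; cover = λ {x} c → here (cls⁻ {q i} {x} c) })))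

  private
    plane⁺ : IsPlane G × IsPlane (G ^ A) → PlaneJoinBiseparation G A
    plane⁺ (p , p′) = from (find-decomposition z≤n p p′)
      where
      from : (Σ ℕ λ l → Σ (Fin m → Fin l) λ lab → Decomposition G lab × Defines G lab A) → PlaneJoinBiseparation G A
      from (l , lab , d , def) = l , lab , decomposition⁺ G lab iso d , def
        , λ i → sub-connected _ (Decomposition.connected d i) , gsum-zero⁻ _ (trans (sym (proj₂ (proj₁ (genus-of-sum lab d def)))) (proj₂ p)) i

    plane⁻ : PlaneJoinBiseparation G A → IsPlane G × IsPlane (G ^ A)
    plane⁻ (l , lab , j , def , h) = subst (λ g → Genus G full g × Genus (G ^ A) full g) (gsum-zero⁺ _ (λ i → proj₂ (h i)))
      (genus-of-sum lab (decomposition⁻ G lab iso e₀ one j) def)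

    rp2⁺ : IsRP2 G × IsRP2 (G ^ A) → RP2JoinBiseparation G A
    rp2⁺ (p , p′) = from (find-decomposition ℕ.≤-refl p p′)
      where
      from : (Σ ℕ λ l → Σ (Fin m → Fin l) λ lab → Decomposition G lab × Defines G lab A) → RP2JoinBiseparation G A
      from (l , lab , d , def) = one-part (gsum-one⁻ _ (trans (sym (proj₂ (proj₁ (genus-of-sum lab d def)))) (proj₂ p)))
        where
        one-part : (∃ λ i₀ → Sub.eulerGenus G (part G lab i₀) ≡ 1 × (∀ i → i ≢ i₀ → Sub.eulerGenus G (part G lab i) ≡ 0)) → RP2JoinBiseparation G A
        one-part (i₀ , e , h) = l , lab , decomposition⁺ G lab iso d , def
          , i₀ , (sub-connected _ (Decomposition.connected d i₀) , e) , λ i n → sub-connected _ (Decomposition.connected d i) , h i n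

    rp2⁻ : RP2JoinBiseparation G A → IsRP2 G × IsRP2 (G ^ A)
    rp2⁻ (l , lab , j , def , i₀ , p , h) = subst (λ g → Genus G full g × Genus (G ^ A) full g) (gsum-one⁺ _ i₀ (proj₂ p) (λ i n → proj₂ (h i n)))
      (genus-of-sum lab (decomposition⁻ G lab iso e₀ one j) def)

  theorem-with-edges : ((IsPlane G × IsPlane (G ^ A)) ⇔ PlaneJoinBiseparation G A) × ((IsRP2 G × IsRP2 (G ^ A)) ⇔ RP2JoinBiseparation G A)
  theorem-with-edges = mk⇔ plane⁺ plane⁻ , mk⇔ rp2⁺ rp2⁻

-- The graph without edges

private
  no-edges : ∀ G → nE G ≡ 0 → nIso G ≡ 1 → ∀ B → Genus G B 0
  no-edges record { nE = .0 ; nIso = .1 } refl refl B = refl , refl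

  no-edges-iso : ∀ G → nE G ≡ 0 → Connected G → nIso G ≡ 1
  no-edges-iso record { nE = .0 ; nIso = n } refl c = trans (sym (ℕ.+-identityʳ n)) c

  -- The single vertex carries no flag and is visible only in `nIso`, whereas the argument with
  -- flags assumes `nIso G ≡ 0`.
  theorem-without-edges : ∀ G A → nE G ≡ 0 → Connected G →
    ((IsPlane G × IsPlane (G ^ A)) ⇔ PlaneJoinBiseparation G A) × ((IsRP2 G × IsRP2 (G ^ A)) ⇔ RP2JoinBiseparation G A)
  theorem-without-edges G A e c = mk⇔ (λ _ → 1 , (λ _ → Fin.zero) , inj₁ refl , ((λ _ → true) , λ x → absurd x) , λ i → no-edges G e iso _)
      (λ _ → no-edges G e iso _ , no-edges (G ^ A) e iso _)
    , mk⇔ (λ { ((_ , p) , _) → clash p (proj₂ (no-edges G e iso (allEdges G))) })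
      (λ { (l , lab , j , def , i₀ , (_ , p) , h) → clash p (proj₂ (no-edges G e iso (part G lab i₀))) })
    where
    iso : nIso G ≡ 1
    iso = no-edges-iso G e c
    absurd : ∀ {P : Set} → Fin (nE G) → P
    absurd x with subst Fin e x
    ... | ()
    clash : ∀ {P : Set} {n} → n ≡ 1 → n ≡ 0 → P
    clash refl ()

theorem4 : (G : RibbonGraph) (A : EdgeSet G) → Connected G
    → ((IsPlane G × IsPlane (G ^ A)) ⇔ PlaneJoinBiseparation G A)
    × ((IsRP2 G × IsRP2 (G ^ A)) ⇔ RP2JoinBiseparation G A)
theorem4 G A c = by-edges (nE G) refl
  where
  by-edges : ∀ n → nE G ≡ n → ((IsPlane G × IsPlane (G ^ A)) ⇔ PlaneJoinBiseparation G A) × ((IsRP2 G × IsRP2 (G ^ A)) ⇔ RP2JoinBiseparation G A)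
  by-edges zero e = theorem-without-edges G A e c
  by-edges (suc n) e = theorem-with-edges G A iso e₀ (trans (cong (_+ nn (mat G) full full full) (sym iso)) total)
    where
    e₀ : Fin (nE G)
    e₀ = subst Fin (sym e) Fin.zero
    total : nIso G + nn (mat G) full full full ≡ 1
    total = trans (sym (#K-nn G full)) c
    -- The edge `e₀` already accounts for one component, which leaves none for an isolated vertex.
    iso : nIso G ≡ 0
    iso = ℕ.n≤0⇒n≡0 (ℕ.+-cancelʳ-≤ 1 _ _ (ℕ.≤-trans (ℕ.+-monoʳ-≤ (nIso G) (count-positive {x = e₀ , false , false} refl (nn-count (mat G) full full full))) (ℕ.≤-reflexive total)))
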